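{- Let $p>3$ be a prime. Then $$\sum_{k=0}^{p-1}(4k+1)^3\frac{\binom{2k}k^3}{(-64)^k}\equiv-3(-1)^{\frac{p-1}2}p+p^3(4-3E_{p-3})\pmod{p^4},$$ $$\sum_{k=0}^{p-1}(4k-1)\frac{\binom{2k}k^3}{(-64)^k(2k-1)^3}\equiv(-1)^{\frac{p-1}2}p+p^3(E_{p-3}-2)\pmod{p^4},$$ $$\sum_{k=0}^{p-1}(4k-1)^3\frac{\binom{2k}k^3}{(-64)^k(2k-1)^3}\equiv-3(-1)^{\frac{p-1}2}p+p^3(2-3E_{p-3})\pmod{p^4},$$ $$\sum_{k=0}^{p-1}(12k+1)\binom{ -1/6}k^3\equiv\begin{cases}(-1)^{\frac{p-1}2}p+\frac59p^3E_{p-3}\pmod{p^4}&\text{if }3\mid p-1,\\5(-1)^{\frac{p-1}2}p+\frac{625}9p^3E_{p-3}\pmod{p^4}&\text{if }3\mid p-2,\end{cases}$$ $$\sum_{k=0}^{p-1}(12k+1)^3\binom{ -1/6}k^3\equiv\begin{cases}-3(-1)^{\frac{p-1}2}p+p^3(4-\frac53E_{p-3})\pmod{p^4}&\text{if }3\mid p-1,\\-15(-1)^{\frac{p-1}2}p+p^3(500-\frac{625}3E_{p-3})\pmod{p^4}&\text{if }3\mid p-2,\end{cases}$$ $$\sum_{k=0}^{p-1}(6k+1)\binom{ -1/3}k^3\equiv\begin{cases}p+p^3U_{p-3}\pmod{p^4}&\text{if }3\mid p-1,\\-2p+8p^3U_{p-3}\pmod{p^4}&\text{if }3\mid p-2,\end{cases}$$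 $$\sum_{k=0}^{p-1}(6k+1)^3\binom{ -1/3}k^3\equiv\begin{cases}-3p+p^3(4-3U_{p-3})\pmod{p^4}&\text{if }3\mid p-1,\\6p+8p^3(4-3U_{p-3})\pmod{p^4}&\text{if }3\mid p-2.\end{cases}$$
   Context: The general binomial coefficient is $\binom a0=1$, $\binom ak=a(a-1)\cdots(a-k+1)/k!$ for $k\ge1$. Congruences are in the ring of rationals with denominators prime to $p$. The Euler numbers are $E_0=1$, $E_{2n-1}=0$, $E_{2n}=-\sum_{k=1}^n\binom{2n}{2k}E_{2n-2k}$ ($n\ge1$). The sequence $U_n$ is given by $U_0=1$, $U_{2n-1}=0$, $U_{2n}=-2\sum_{k=1}^n\binom{2n}{2k}U_{2n-2k}$ ($n\ge1$). -}

module Defs where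

open import Data.Nat as ℕ using (ℕ; zero; suc; _∸_; ⌊_/2⌋)
open import Data.Nat.Combinatorics using (_C_)
open import Data.Nat.Coprimality using (Coprime)
open import Data.Nat.Properties using (_!≢0)
open import Data.Integer as ℤ using (ℤ; +_; -[1+_])
open import Data.Rational as ℚ using (ℚ; 0ℚ; 1ℚ; _+_; _*_; _-_; ↧ₙ_)
open import Data.List using (List; []; _∷_; _++_; map; foldr; upTo)
open import Data.Product using (Σ; _×_)
open import Relation.Binary.PropositionalEquality using (_≡_)

ℕ→ℚ : ℕ → ℚ
ℕ→ℚ n = (+ n) ℚ./ 1

ℤ→ℚ : ℤ → ℚ
ℤ→ℚ z = z ℚ./ 1

infixr 8 _^ℚ_
_^ℚ_ : ℚ → ℕ → ℚ
q ^ℚ zero = 1ℚ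
q ^ℚ suc n = q * (q ^ℚ n)

-- the rational number n / d for integers n, d (the value for d = 0 is
-- an irrelevant convention; it is never used with d = 0 below)
_/ℤ_ : ℤ → ℤ → ℚ
n /ℤ (+ zero) = 0ℚ
n /ℤ (+ suc m) = n ℚ./ suc m
n /ℤ (-[1+ m ]) = (ℤ.- n) ℚ./ suc m

sumℚ : List ℚ → ℚ
sumℚ = foldr _+_ 0ℚ

sumℤ : List ℤ → ℤ
sumℤ = foldr ℤ._+_ (+ 0)

Σℚ[<_] : ℕ → (ℕ → ℚ) → ℚ
Σℚ[< n ] f = sumℚ (map f (upTo n))

-- Congruences in the ring of rationals with denominators prime to p:
-- a ≡ b (mod m)  iff  a - b = m * r for some rational r whose
-- (reduced) denominator is prime to p.

infix 4 _≡_[mod_]over_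
_≡_[mod_]over_ : ℚ → ℚ → ℕ → ℕ → Set
a ≡ b [mod m ]over p = Σ ℚ (λ r → Coprime (↧ₙ r) p × (a - b ≡ ℕ→ℚ m * r))

falling : ℚ → ℕ → ℚ
falling a zero = 1ℚ
falling a (suc k) = falling a k * (a - ℕ→ℚ k)

binomℚ : ℚ → ℕ → ℚ
binomℚ a k = falling a k * ((+ 1) ℚ./ (k ℕ.!)) where instance _ = k !≢0

-- Sequences defined by  s_0 = 1, s_{2n-1} = 0,
--   s_{2n} = - c * Σ_{k=1}^{n} binom(2n,2k) s_{2n-2k}   (n ≥ 1).

nth : List ℤ → ℕ → ℤ
nth [] _ = + 0
nth (x ∷ xs) zero = x
nth (x ∷ xs) (suc j) = nth xs j

-- next value s_m, given the list prev = [s_0, ..., s_{m-1}]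
nextVal : ℤ → ℕ → List ℤ → ℤ
nextVal c zero prev = + 1
nextVal c (suc m) prev with (suc m) ℕ.% 2
... | suc _ = + 0
... | zero  = ℤ.- (c ℤ.* sumℤ (map (λ k → (+ ((suc m) C (2 ℕ.* k))) ℤ.* nth prev (suc m ∸ 2 ℕ.* k))
                                    (map suc (upTo ⌊ suc m /2⌋))))

initSeq : ℤ → ℕ → List ℤ
initSeq c zero = []
initSeq c (suc n) = initSeq c n ++ (nextVal c n (initSeq c n) ∷ [])

seqAt : ℤ → ℕ → ℤ
seqAt c n = nth (initSeq c (suc n)) n

Euler : ℕ → ℤ
Euler = seqAt (+ 1)

U : ℕ → ℤ
U = seqAt (+ 2)

{-# OPTIONS --safe #-}
module Submission where

-- Write C(a,k) for binomℚ a k and S(a) for the sum of (2k - a) C(a,k)³ over k < p.  The summand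
-- (2k - a)³ C(a,k)³ differs from -3a² (2k - a) C(a,k)³ by the telescoping -4 Δ(k³ C(a,k)³), and
-- S(a) + S(a - 1) = (p - 2a) C(a - 1, p - 1)³, again by telescoping.  For a = pt + j with 0 < j < p one has
-- C(a - 1, p - 1) ≡ pt / j (mod p²), so descending from a to pt, where S(pt) ≡ -pt, expresses S(a)
-- modulo p⁴ by the sum of (-1)ⁱ / i² over i ≤ j.  As i⁻² ≡ i^(p-3), that sum is up to a factor the value
-- at 2a + 1 of the Appell polynomial A of the Euler numbers, A(x + 1) + A(x - 1) = 2 x^(p-3).  A function on ℤ/p
-- that changes sign under a translation vanishes at 0, because p is odd; this gives A(2/3) ≡ 5 E and
-- A(1/3) ≡ (9/4) U modulo p.

open import Defs
open import Data.Nat using (ℕ; zero; suc; z≤n; s≤s; z<s; s<s; _<_; _≤_; _∸_; ⌊_/2⌋)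
import Data.Nat as ℕ
import Data.Nat.Properties as ℕ
import Data.Nat.DivMod as ℕ
import Data.Nat.Divisibility as ℕ
import Data.Nat.Tactic.RingSolver as ℕS
open import Data.Nat.Divisibility using (_∣_)
open import Data.Nat.Combinatorics using (_C_; nC1≡n; nCn≡1; nCk+nC[k+1]≡[n+1]C[k+1]; k>n⇒nCk≡0; nCk≡nC[n∸k])
open import Data.Nat.Coprimality using (Coprime)
open import Data.Nat.Primality using (Prime; prime?; prime⇒nonTrivial; prime⇒irreducible; euclidsLemma)
open import Data.Integer as ℤ using (ℤ; +_; -[1+_])
import Data.Integer.Properties as ℤₚ
import Data.Integer.Divisibility.Signed as ℤ∣
open import Data.Integer.GCD using (gcd)
import Data.Integer.Tactic.RingSolver as ℤS
open import Data.List using (List; []; _∷_; _++_; map; upTo; applyUpTo; length)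
open import Data.List.Properties using (map-upTo; map-∘; map-++; upTo-∷ʳ; length-++)
open import Data.Maybe.Base using (just; nothing)
open import Data.Product using (_,_; _×_; proj₁; proj₂; ∃-syntax)
open import Data.Sum using (_⊎_; inj₁; inj₂)
open import Data.Empty using (⊥-elim)
open import Function using (_∘_)
open import Level using (0ℓ)
open import Relation.Nullary using (¬_)
open import Relation.Nullary.Decidable using (from-no; from-yes)
open import Relation.Binary.Bundles using (Setoid)
open import Relation.Binary.PropositionalEquality
import Relation.Binary.Reasoning.Setoid
open import Tactic.RingSolver using () renaming (solve-∀ to solve-∀-in)
open import Tactic.RingSolver.Core.AlmostCommutativeRing using (AlmostCommutativeRing; fromCommutativeRing)

-- The cube is what lifts a congruence modulo p² to one modulo p⁴: with c = C(a - 1, p - 1), both c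
-- and pt are divisible by p, so jc ≡ pt (mod p²) gives j c³ ≡ (pt)³ / j² (mod p⁴), and 1 / j²
-- matters only modulo p. The parameters are -1/2 = -p/2 + (p - 1)/2, 1/2 = -p/2 + (p + 1)/2, and
-- -1/6 = -κp/6 + j, -1/3 = -κp/3 + j, where κ is 1 or 5, respectively 1 or 2, according to p modulo
-- 3. For them 2a + 1 is 0, 2, 2/3 and 1/3. The constants 5 and 9/4 come from generating functions,
-- 1 / cosh t for the Euler numbers and 1 / (2 cosh t - 1) for U. Tripling the argument gives 3⁻ⁿ E
-- = 2 A(2/3) - E, while cosh 3s = cosh s (2 cosh 2s - 1) gives U = (3/2)ⁿ A(1/3); for n = p - 3 the
-- powers 3⁻ⁿ and 2⁻ⁿ are 9 and 4 modulo p. Since A is evaluated at integers, 1/3 is represented by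
-- an integer c with 3c ≡ 1, and both identities are proved as congruences between functions on ℤ/p
-- rather than between polynomials.

⌊n*2/2⌋≡n : ∀ n → ⌊ n ℕ.* 2 /2⌋ ≡ n
⌊n*2/2⌋≡n zero    = refl
⌊n*2/2⌋≡n (suc n) = cong suc (⌊n*2/2⌋≡n n)

-- Exponential generating functions as integer sequences.

module HurwitzProduct where
  open import Data.Integer using (_+_; _*_; -_)
  open ≡-Reasoning

  Seq : Set
  Seq = ℕ → ℤ

  -- Differentiation of the exponential generating function.
  tail : Seq → Seq
  tail f n = f (suc n)

  infixl 6 _⊕_
  _⊕_ : Seq → Seq → Seq
  (f ⊕ g) n = f n + g n

  infixl 7 _⋆_
  -- The product of exponential generating functions, given by the Leibniz rule instead of binomial
  -- sums: each ring law then follows by induction on the index, with the sequences generalised.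
  _⋆_ : Seq → Seq → Seq
  (f ⋆ g) zero    = f 0 * g 0
  (f ⋆ g) (suc n) = (tail f ⋆ g) n + (f ⋆ tail g) n

  δ : Seq
  δ zero    = + 1
  δ (suc _) = + 0

  -- As a sequence in the exponent this is the generating function exp(xt).
  Pow : ℤ → Seq
  Pow x zero    = + 1
  Pow x (suc n) = x * Pow x n

  private
    +-interchange : ∀ a b c d → (a + b) + (c + d) ≡ (a + c) + (b + d)
    +-interchange = ℤS.solve-∀

  ⋆-cong : ∀ {f f′ g g′} → f ≗ f′ → g ≗ g′ → f ⋆ g ≗ f′ ⋆ g′
  ⋆-cong p q zero    = cong₂ _*_ (p 0) (q 0)
  ⋆-cong p q (suc n) = cong₂ _+_ (⋆-cong (p ∘ suc) q n) (⋆-cong p (q ∘ suc) n)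

  ⋆-comm : ∀ f g → f ⋆ g ≗ g ⋆ f
  ⋆-comm f g zero    = ℤₚ.*-comm (f 0) (g 0)
  ⋆-comm f g (suc n) = trans (cong₂ _+_ (⋆-comm (tail f) g n) (⋆-comm f (tail g) n))
                             (ℤₚ.+-comm ((g ⋆ tail f) n) ((tail g ⋆ f) n))

  ⋆-distribʳ : ∀ f g h → (f ⊕ g) ⋆ h ≗ f ⋆ h ⊕ g ⋆ h
  ⋆-distribʳ f g h zero    = ℤₚ.*-distribʳ-+ (h 0) (f 0) (g 0)
  ⋆-distribʳ f g h (suc n) = trans
    (cong₂ _+_ (⋆-distribʳ (tail f) (tail g) h n) (⋆-distribʳ f g (tail h) n))
    (+-interchange ((tail f ⋆ h) n) ((tail g ⋆ h) n) ((f ⋆ tail h) n) ((g ⋆ tail h) n))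

  ⋆-distribˡ : ∀ f g h → f ⋆ (g ⊕ h) ≗ f ⋆ g ⊕ f ⋆ h
  ⋆-distribˡ f g h n = trans (⋆-comm f (g ⊕ h) n)
    (trans (⋆-distribʳ g h f n) (cong₂ _+_ (⋆-comm g f n) (⋆-comm h f n)))

  ⋆-assoc : ∀ f g h → f ⋆ g ⋆ h ≗ f ⋆ (g ⋆ h)
  ⋆-assoc f g h zero    = ℤₚ.*-assoc (f 0) (g 0) (h 0)
  ⋆-assoc f g h (suc n) = begin
    (tail (f ⋆ g) ⋆ h) n + (f ⋆ g ⋆ tail h) n
      ≡⟨ cong (λ z → z + (f ⋆ g ⋆ tail h) n) (⋆-distribʳ (tail f ⋆ g) (f ⋆ tail g) h n) ⟩
    (tail f ⋆ g ⋆ h) n + (f ⋆ tail g ⋆ h) n + (f ⋆ g ⋆ tail h) n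
      ≡⟨ cong₂ _+_ (cong₂ _+_ (⋆-assoc (tail f) g h n) (⋆-assoc f (tail g) h n)) (⋆-assoc f g (tail h) n) ⟩
    (tail f ⋆ (g ⋆ h)) n + (f ⋆ (tail g ⋆ h)) n + (f ⋆ (g ⋆ tail h)) n
      ≡⟨ ℤₚ.+-assoc ((tail f ⋆ (g ⋆ h)) n) _ _ ⟩
    (tail f ⋆ (g ⋆ h)) n + ((f ⋆ (tail g ⋆ h)) n + (f ⋆ (g ⋆ tail h)) n)
      ≡⟨ cong (λ z → (tail f ⋆ (g ⋆ h)) n + z) (sym (⋆-distribˡ f (tail g ⋆ h) (g ⋆ tail h) n)) ⟩
    (f ⋆ (g ⋆ h)) (suc n) ∎

  ⋆-scaleˡ : ∀ c f g → (λ n → c * f n) ⋆ g ≗ λ n → c * (f ⋆ g) n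
  ⋆-scaleˡ c f g zero    = ℤₚ.*-assoc c (f 0) (g 0)
  ⋆-scaleˡ c f g (suc n) = trans (cong₂ _+_ (⋆-scaleˡ c (tail f) g n) (⋆-scaleˡ c f (tail g) n))
                                 (sym (ℤₚ.*-distribˡ-+ c ((tail f ⋆ g) n) ((f ⋆ tail g) n)))

  ⋆-scaleʳ : ∀ c f g → f ⋆ (λ n → c * g n) ≗ λ n → c * (f ⋆ g) n
  ⋆-scaleʳ c f g n = trans (⋆-comm f (λ k → c * g k) n)
                           (trans (⋆-scaleˡ c g f n) (cong (c *_) (⋆-comm g f n)))

  ⋆-identityˡ : ∀ f → δ ⋆ f ≗ f
  ⋆-identityˡ f zero    = ℤₚ.*-identityˡ (f 0)
  ⋆-identityˡ f (suc n) = begin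
    (tail δ ⋆ f) n + (δ ⋆ tail f) n        ≡⟨ cong₂ _+_ (⋆-scaleˡ (+ 0) (tail δ) f n) (⋆-identityˡ (tail f) n) ⟩
    + 0 * (tail δ ⋆ f) n + f (suc n)       ≡⟨ ℤₚ.+-identityˡ (f (suc n)) ⟩
    f (suc n)                              ∎

  -- Both sides solve f′ = (x + y) f with f(0) = 1. Combined with `⋆-binomial` this is the binomial
  -- theorem.
  Pow-⋆ : ∀ x y → Pow x ⋆ Pow y ≗ Pow (x + y)
  Pow-⋆ x y zero    = refl
  Pow-⋆ x y (suc n) = begin
    (tail (Pow x) ⋆ Pow y) n + (Pow x ⋆ tail (Pow y)) n
      ≡⟨ cong₂ _+_ (⋆-scaleˡ x (Pow x) (Pow y) n) (⋆-scaleʳ y (Pow x) (Pow y) n) ⟩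
    x * (Pow x ⋆ Pow y) n + y * (Pow x ⋆ Pow y) n
      ≡⟨ ℤₚ.*-distribʳ-+ ((Pow x ⋆ Pow y) n) x y ⟨
    (x + y) * (Pow x ⋆ Pow y) n
      ≡⟨ cong ((x + y) *_) (Pow-⋆ x y n) ⟩
    (x + y) * Pow (x + y) n ∎

  Pow-* : ∀ x y n → Pow (x * y) n ≡ Pow x n * Pow y n
  Pow-* x y zero    = refl
  Pow-* x y (suc n) = trans (cong (λ z → x * y * z) (Pow-* x y n)) (rearrange x y (Pow x n) (Pow y n))
    where
    rearrange : ∀ x y u v → x * y * (u * v) ≡ x * u * (y * v)
    rearrange = ℤS.solve-∀

  Pow-1 : ∀ n → Pow (+ 1) n ≡ + 1
  Pow-1 zero    = refl
  Pow-1 (suc n) = trans (ℤₚ.*-identityˡ (Pow (+ 1) n)) (Pow-1 n)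

  -- The substitution of -t for t.
  reflect : Seq → Seq
  reflect f n = Pow (- + 1) n * f n

  reflect-⋆ : ∀ f g → reflect (f ⋆ g) ≗ reflect f ⋆ reflect g
  reflect-⋆ f g zero    = one (f 0) (g 0)
    where
    one : ∀ a b → + 1 * (a * b) ≡ + 1 * a * (+ 1 * b)
    one = ℤS.solve-∀
  reflect-⋆ f g (suc n) = begin
    - + 1 * e * ((tail f ⋆ g) n + (f ⋆ tail g) n)
      ≡⟨ expand e ((tail f ⋆ g) n) ((f ⋆ tail g) n) ⟩
    - + 1 * (e * (tail f ⋆ g) n) + - + 1 * (e * (f ⋆ tail g) n)
      ≡⟨ cong₂ (λ u v → - + 1 * u + - + 1 * v) (reflect-⋆ (tail f) g n) (reflect-⋆ f (tail g) n) ⟩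
    - + 1 * (reflect (tail f) ⋆ reflect g) n + - + 1 * (reflect f ⋆ reflect (tail g)) n
      ≡⟨ cong₂ _+_ (⋆-scaleˡ (- + 1) (reflect (tail f)) (reflect g) n) (⋆-scaleʳ (- + 1) (reflect f) (reflect (tail g)) n) ⟨
    ((λ k → - + 1 * reflect (tail f) k) ⋆ reflect g) n + (reflect f ⋆ (λ k → - + 1 * reflect (tail g) k)) n
      ≡⟨ cong₂ _+_ (⋆-cong (shift f) (λ _ → refl) n) (⋆-cong (λ _ → refl) (shift g) n) ⟩
    (reflect f ⋆ reflect g) (suc n) ∎
    where
    e : ℤ
    e = Pow (- + 1) n
    expand : ∀ e a b → - + 1 * e * (a + b) ≡ - + 1 * (e * a) + - + 1 * (e * b)
    expand = ℤS.solve-∀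
    shift : ∀ f k → - + 1 * reflect (tail f) k ≡ tail (reflect f) k
    shift f k = sym (ℤₚ.*-assoc (- + 1) (Pow (- + 1) k) (f (suc k)))

  ∑ : ℕ → Seq → ℤ
  ∑ n f = sumℤ (applyUpTo f n)

  ∑-cong : ∀ {f g} n → (∀ {k} → k < n → f k ≡ g k) → ∑ n f ≡ ∑ n g
  ∑-cong zero    p = refl
  ∑-cong (suc n) p = cong₂ _+_ (p z<s) (∑-cong n (p ∘ s<s))

  ∑-+ : ∀ n f g → ∑ n f + ∑ n g ≡ ∑ n (f ⊕ g)
  ∑-+ zero    f g = refl
  ∑-+ (suc n) f g = trans (+-interchange (f 0) (∑ n (tail f)) (g 0) (∑ n (tail g)))
                          (cong (λ z → f 0 + g 0 + z) (∑-+ n (tail f) (tail g)))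

  ∑-* : ∀ c n f → c * ∑ n f ≡ ∑ n (λ k → c * f k)
  ∑-* c zero    f = ℤₚ.*-zeroʳ c
  ∑-* c (suc n) f = trans (ℤₚ.*-distribˡ-+ c (f 0) (∑ n (tail f))) (cong (λ z → c * f 0 + z) (∑-* c n (tail f)))

  ∑-last : ∀ n f → ∑ (suc n) f ≡ ∑ n f + f n
  ∑-last zero    f = ℤₚ.+-comm (f 0) (+ 0)
  ∑-last (suc n) f = trans (cong (λ z → f 0 + z) (∑-last n (tail f))) (sym (ℤₚ.+-assoc (f 0) (∑ n (tail f)) (f (suc n))))

  ∑-even : ∀ m f → (∀ k → f (suc (k ℕ.* 2)) ≡ + 0) → ∑ (suc (m ℕ.* 2)) f ≡ ∑ (suc m) (λ k → f (k ℕ.* 2))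
  ∑-even zero    f odd = refl
  ∑-even (suc m) f odd = cong (λ z → f 0 + z) (begin
    f 1 + ∑ (suc (m ℕ.* 2)) (λ k → f (suc (suc k)))   ≡⟨ cong₂ _+_ (odd 0) (∑-even m (λ k → f (suc (suc k))) (odd ∘ suc)) ⟩
    + 0 + ∑ (suc m) (λ k → f (suc (suc (k ℕ.* 2))))   ≡⟨ ℤₚ.+-identityˡ _ ⟩
    ∑ (suc m) (λ k → f (suc k ℕ.* 2))                 ∎)

  nC0≡1 : ∀ n → n C 0 ≡ 1
  nC0≡1 n = trans (nCk≡nC[n∸k] {n = n} z≤n) (nCn≡1 n)

  -- Connects the Leibniz product with the binomial sums by which the Euler numbers and U are
  -- defined; the two Leibniz terms are the two terms of Pascal's rule.
  ⋆-binomial : ∀ n f g → (f ⋆ g) n ≡ ∑ (suc n) (λ k → + (n C k) * (f k * g (n ∸ k)))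
  ⋆-binomial zero    f g = simplify (f 0 * g 0)
    where
    simplify : ∀ x → x ≡ + 1 * x + + 0
    simplify = ℤS.solve-∀
  ⋆-binomial (suc n) f g = begin
    (tail f ⋆ g) n + (f ⋆ tail g) n
      ≡⟨ cong₂ _+_ (⋆-binomial n (tail f) g) (⋆-binomial n f (tail g)) ⟩
    ∑ (suc n) u + (head + ∑ n v)
      ≡⟨ cong (λ z → ∑ (suc n) u + (head + z)) (trans (∑-cong n shift) extend) ⟩
    ∑ (suc n) u + (head + ∑ (suc n) w)
      ≡⟨ rotate (∑ (suc n) u) head (∑ (suc n) w) ⟩
    head + (∑ (suc n) u + ∑ (suc n) w)
      ≡⟨ cong₂ _+_ (cong (λ z → + z * (f 0 * g (suc n))) (trans (nC0≡1 n) (sym (nC0≡1 (suc n)))))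
          (trans (∑-+ (suc n) u w) (∑-cong (suc n) λ {k} _ → pascal k)) ⟩
    + (suc n C 0) * (f 0 * g (suc n)) + ∑ (suc n) (λ k → + (suc n C suc k) * (f (suc k) * g (n ∸ k))) ∎
    where
    head : ℤ
    head = + (n C 0) * (f 0 * g (suc n))
    u v w : Seq
    u k = + (n C k) * (f (suc k) * g (n ∸ k))
    v k = + (n C suc k) * (f (suc k) * g (suc (n ∸ suc k)))
    w k = + (n C suc k) * (f (suc k) * g (n ∸ k))
    rotate : ∀ a b c → a + (b + c) ≡ b + (a + c)
    rotate = ℤS.solve-∀
    shift : ∀ {k} → k < n → v k ≡ w k
    shift {k} k<n = cong (λ z → + (n C suc k) * (f (suc k) * g z)) (sym (ℕ.+-∸-assoc 1 k<n))
    -- C(n, n + 1) = 0, so a last term can be added to match the length of the other sum.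
    extend : ∑ n w ≡ ∑ (suc n) w
    extend = begin
      ∑ n w          ≡⟨ ℤₚ.+-identityʳ (∑ n w) ⟨
      ∑ n w + + 0    ≡⟨ cong (λ z → ∑ n w + + z * (f (suc n) * g (n ∸ n))) (k>n⇒nCk≡0 (ℕ.n<1+n n)) ⟨
      ∑ n w + w n    ≡⟨ ∑-last n w ⟨
      ∑ (suc n) w    ∎
    pascal : ∀ k → u k + w k ≡ + (suc n C suc k) * (f (suc k) * g (n ∸ k))
    pascal k = trans (sym (ℤₚ.*-distribʳ-+ (f (suc k) * g (n ∸ k)) (+ (n C k)) (+ (n C suc k))))
                     (cong (λ z → + z * (f (suc k) * g (n ∸ k))) (nCk+nC[k+1]≡[n+1]C[k+1] n k))

open HurwitzProduct

-- The Euler numbers, the sequence U and their Appell polynomials.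

module EulerLikeSequences where
  open import Data.Integer using (_+_; _*_; -_; _-_; 1ℤ)
  open ≡-Reasoning

  nth-++ˡ : ∀ xs ys k → k < length xs → nth (xs ++ ys) k ≡ nth xs k
  nth-++ˡ (x ∷ xs) ys zero    _       = refl
  nth-++ˡ (x ∷ xs) ys (suc k) (s≤s q) = nth-++ˡ xs ys k q

  nth-last : ∀ xs y → nth (xs ++ y ∷ []) (length xs) ≡ y
  nth-last []       y = refl
  nth-last (x ∷ xs) y = nth-last xs y

  length-initSeq : ∀ c n → length (initSeq c n) ≡ n
  length-initSeq c zero    = refl
  length-initSeq c (suc n) = trans (length-++ (initSeq c n)) (trans (cong (ℕ._+ 1) (length-initSeq c n)) (ℕ.+-comm n 1))

  seqAt-nextVal : ∀ c n → seqAt c n ≡ nextVal c n (initSeq c n)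
  seqAt-nextVal c n = subst (λ k → nth (initSeq c (suc n)) k ≡ nextVal c n (initSeq c n)) (length-initSeq c n)
                            (nth-last (initSeq c n) (nextVal c n (initSeq c n)))

  -- Later stages only append to the list, so an entry never changes. This turns the recurrence over
  -- list prefixes into one between values of `seqAt`.
  nth-initSeq : ∀ c {n k} → k < n → nth (initSeq c n) k ≡ seqAt c k
  nth-initSeq c {suc n} {k} (s≤s k≤n) with ℕ.m≤n⇒m<n∨m≡n k≤n
  ... | inj₂ refl = refl
  ... | inj₁ k<n  = trans (nth-++ˡ (initSeq c n) _ k (subst (k <_) (sym (length-initSeq c n)) k<n)) (nth-initSeq c k<n)

  nextVal-odd : ∀ c k prev → nextVal c (suc (k ℕ.* 2)) prev ≡ + 0
  nextVal-odd c k prev with suc (k ℕ.* 2) ℕ.% 2 in eq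
  ... | suc _ = refl
  ... | zero  with trans (sym (ℕ.[m+kn]%n≡m%n 1 k 2)) eq
  ...   | ()

  nextVal-even : ∀ c m prev → nextVal c (suc m ℕ.* 2) prev ≡
    - (c * ∑ (suc m) (λ k → + ((suc m ℕ.* 2) C (suc k ℕ.* 2)) * nth prev (suc m ℕ.* 2 ∸ suc k ℕ.* 2)))
  nextVal-even c m prev with (suc m ℕ.* 2) ℕ.% 2 in eq
  ... | suc _ with trans (sym (ℕ.m*n%n≡0 (suc m) 2)) eq
  ...   | ()
  nextVal-even c m prev | zero = cong (λ z → - (c * z)) (begin
    sumℤ (map h (map suc (upTo ⌊ suc m ℕ.* 2 /2⌋)))   ≡⟨ cong sumℤ (map-∘ {g = h} {f = suc} (upTo ⌊ suc m ℕ.* 2 /2⌋)) ⟨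
    sumℤ (map (h ∘ suc) (upTo ⌊ suc m ℕ.* 2 /2⌋))     ≡⟨ cong sumℤ (map-upTo (h ∘ suc) ⌊ suc m ℕ.* 2 /2⌋) ⟩
    ∑ ⌊ suc m ℕ.* 2 /2⌋ (h ∘ suc)                     ≡⟨ cong (λ z → ∑ z (h ∘ suc)) (⌊n*2/2⌋≡n (suc m)) ⟩
    ∑ (suc m) (h ∘ suc)                               ≡⟨ ∑-cong (suc m) (λ {k} _ → cong
        (λ z → + ((suc m ℕ.* 2) C z) * nth prev (suc m ℕ.* 2 ∸ z)) (ℕ.*-comm 2 (suc k))) ⟩
    ∑ (suc m) (λ k → + ((suc m ℕ.* 2) C (suc k ℕ.* 2)) * nth prev (suc m ℕ.* 2 ∸ suc k ℕ.* 2)) ∎)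
    where
    h : Seq
    h k = + ((suc m ℕ.* 2) C (2 ℕ.* k)) * nth prev (suc m ℕ.* 2 ∸ 2 ℕ.* k)

  seqAt-odd : ∀ c k → seqAt c (suc (k ℕ.* 2)) ≡ + 0
  seqAt-odd c k = trans (seqAt-nextVal c (suc (k ℕ.* 2))) (nextVal-odd c k _)

  -- The exponential generating function of κ c is 1 + c (cosh t − 1).
  κ : ℤ → Seq
  κ c zero          = + 1
  κ c (suc zero)    = + 0
  κ c (suc (suc zero)) = c
  κ c (suc (suc (suc n))) = κ c (suc n)

  κ-odd : ∀ c k → κ c (suc (k ℕ.* 2)) ≡ + 0
  κ-odd c zero    = refl
  κ-odd c (suc k) = κ-odd c k

  κ-even : ∀ c k → κ c (suc k ℕ.* 2) ≡ c
  κ-even c zero    = refl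
  κ-even c (suc k) = κ-even c k

  data Parity : ℕ → Set where
    even : ∀ k → Parity (k ℕ.* 2)
    odd  : ∀ k → Parity (suc (k ℕ.* 2))

  parity : ∀ n → Parity n
  parity zero = even 0
  parity (suc n) with parity n
  ... | even k = odd k
  ... | odd k  = even (suc k)

  private
    sign-even : ∀ k → Pow (- + 1) (k ℕ.* 2) ≡ + 1
    sign-even zero    = refl
    sign-even (suc k) = trans (square (Pow (- + 1) (k ℕ.* 2))) (sign-even k)
      where
      square : ∀ x → - + 1 * (- + 1 * x) ≡ x
      square = ℤS.solve-∀

  reflect-even : ∀ f k → reflect f (k ℕ.* 2) ≡ f (k ℕ.* 2)
  reflect-even f k = trans (cong (_* f (k ℕ.* 2)) (sign-even k)) (ℤₚ.*-identityˡ (f (k ℕ.* 2)))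

  reflect-evenSeq : ∀ f → (∀ k → f (suc (k ℕ.* 2)) ≡ + 0) → reflect f ≗ f
  reflect-evenSeq f f-odd n with parity n
  ... | odd k  = trans (cong (Pow (- + 1) n *_) (f-odd k)) (trans (ℤₚ.*-zeroʳ (Pow (- + 1) n)) (sym (f-odd k)))
  ... | even k = reflect-even f k

  -- Reflection negates an odd coefficient, so a fixed one satisfies 2x = 0.
  reflect-fixed-odd : ∀ f → reflect f ≗ f → ∀ k → f (suc (k ℕ.* 2)) ≡ + 0
  reflect-fixed-odd f fixed k = ℤₚ.*-cancelˡ-≡ (+ 2) _ _ (begin
    + 2 * x                                                  ≡⟨ double x ⟩
    x + x                                                    ≡⟨ cong (λ z → x + z) (fixed (suc (k ℕ.* 2))) ⟨
    x + - + 1 * Pow (- + 1) (k ℕ.* 2) * x                    ≡⟨ cong (λ z → x + - + 1 * z * x) (sign-even k) ⟩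
    x + - + 1 * + 1 * x                                      ≡⟨ cancel x ⟩
    + 2 * + 0                                                ∎)
    where
    x : ℤ
    x = f (suc (k ℕ.* 2))
    double : ∀ x → + 2 * x ≡ x + x
    double = ℤS.solve-∀
    cancel : ∀ x → x + - + 1 * + 1 * x ≡ + 0
    cancel = ℤS.solve-∀

  -- The defining recurrence says that `seqAt c` is the reciprocal of 1 + c (cosh t - 1), that is 1
  -- / cosh t for the Euler numbers and 1 / (2 cosh t - 1) for U. At positive even indices it is the
  -- recurrence itself; at odd ones the product vanishes because both factors are even functions of
  -- t.
  κ-⋆-seqAt : ∀ c → κ c ⋆ seqAt c ≗ δ
  κ-⋆-seqAt c n with parity n
  ... | even zero    = refl
  ... | odd k        = reflect-fixed-odd (κ c ⋆ seqAt c) (λ i → trans (reflect-⋆ (κ c) (seqAt c) i)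
          (⋆-cong (reflect-evenSeq (κ c) (κ-odd c)) (reflect-evenSeq (seqAt c) (seqAt-odd c)) i)) k
  ... | even (suc m) = begin
    (κ c ⋆ s) M
      ≡⟨ ⋆-binomial M (κ c) s ⟩
    ∑ (suc M) t
      ≡⟨ ∑-even (suc m) t (λ k → trans (cong (λ z → + (M C suc (k ℕ.* 2)) * (z * s (M ∸ suc (k ℕ.* 2))))
          (κ-odd c k)) (ℤₚ.*-zeroʳ (+ (M C suc (k ℕ.* 2))))) ⟩
    t 0 + ∑ (suc m) (λ k → t (suc k ℕ.* 2))
      ≡⟨ cong₂ _+_ first (trans (∑-cong (suc m) (λ {k} k<m → term k k<m)) (sym (∑-* c (suc m) r))) ⟩
    s M + c * ∑ (suc m) r
      ≡⟨ cong (λ z → z + c * ∑ (suc m) r) (trans (seqAt-nextVal c M) (nextVal-even c m (initSeq c M))) ⟩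
    - (c * ∑ (suc m) r) + c * ∑ (suc m) r
      ≡⟨ ℤₚ.+-inverseˡ (c * ∑ (suc m) r) ⟩
    + 0 ∎
    where
    s : Seq
    s = seqAt c
    M : ℕ
    M = suc m ℕ.* 2
    t r : Seq
    t k = + (M C k) * (κ c k * s (M ∸ k))
    r k = + (M C (suc k ℕ.* 2)) * nth (initSeq c M) (M ∸ suc k ℕ.* 2)
    first : t 0 ≡ s M
    first = trans (cong (λ z → + z * (+ 1 * s M)) (nC0≡1 M)) (trans (ℤₚ.*-identityˡ (+ 1 * s M)) (ℤₚ.*-identityˡ (s M)))
    swap : ∀ a c b → a * (c * b) ≡ c * (a * b)
    swap = ℤS.solve-∀
    term : ∀ k → k < suc m → t (suc k ℕ.* 2) ≡ c * r k
    term k k<m = begin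
      + (M C (suc k ℕ.* 2)) * (κ c (suc k ℕ.* 2) * s (M ∸ suc k ℕ.* 2))
        ≡⟨ cong₂ (λ u v → + (M C (suc k ℕ.* 2)) * (u * v)) (κ-even c k) (sym (nth-initSeq c (s≤s (ℕ.≤-trans (ℕ.m∸n≤m
            (m ℕ.* 2) (k ℕ.* 2)) (ℕ.n≤1+n (m ℕ.* 2)))))) ⟩
      + (M C (suc k ℕ.* 2)) * (c * nth (initSeq c M) (M ∸ suc k ℕ.* 2))
        ≡⟨ swap (+ (M C (suc k ℕ.* 2))) c (nth (initSeq c M) (M ∸ suc k ℕ.* 2)) ⟩
      c * r k ∎

  -- The coefficient of tⁿ / n! in s(t) exp(xt).
  Appell : Seq → ℕ → ℤ → ℤ
  Appell s n x = (s ⋆ Pow x) n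

  -- This is 2 cosh t. It equals twice `κ (+ 1)` and also `κ (+ 2)` plus 1, whence the two
  -- difference equations `Euler-Appell` and `U-Appell`.
  Pow±1 : Seq
  Pow±1 = Pow (+ 1) ⊕ Pow (- + 1)

  Appell-± : ∀ s n x → Appell s n (x + + 1) + Appell s n (x - + 1) ≡ (Pow±1 ⋆ s ⋆ Pow x) n
  Appell-± s n x = begin
    (s ⋆ Pow (x + + 1)) n + (s ⋆ Pow (x + - + 1)) n
      ≡⟨ ⋆-distribˡ s (Pow (x + + 1)) (Pow (x + - + 1)) n ⟨
    (s ⋆ (Pow (x + + 1) ⊕ Pow (x + - + 1))) n
      ≡⟨ ⋆-cong (λ _ → refl) (λ k → trans (cong₂ _+_ (factor (+ 1) k) (factor (- + 1) k)) (sym (⋆-distribʳ (Pow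
          (+ 1)) (Pow (- + 1)) (Pow x) k))) n ⟩
    (s ⋆ (Pow±1 ⋆ Pow x)) n
      ≡⟨ ⋆-assoc s Pow±1 (Pow x) n ⟨
    (s ⋆ Pow±1 ⋆ Pow x) n
      ≡⟨ ⋆-cong (⋆-comm s Pow±1) (λ _ → refl) n ⟩
    (Pow±1 ⋆ s ⋆ Pow x) n ∎
    where
    factor : ∀ y k → Pow (x + y) k ≡ (Pow y ⋆ Pow x) k
    factor y k = trans (cong (λ z → Pow z k) (ℤₚ.+-comm x y)) (sym (Pow-⋆ y x k))

  Pow±1-odd : ∀ k → Pow±1 (suc (k ℕ.* 2)) ≡ + 0
  Pow±1-odd k = cong₂ _+_ (Pow-1 (suc (k ℕ.* 2))) (cong (- + 1 *_) (sign-even k))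

  Pow±1-even : ∀ k → Pow±1 (k ℕ.* 2) ≡ + 2
  Pow±1-even k = cong₂ _+_ (Pow-1 (k ℕ.* 2)) (sign-even k)

  Pow±1-κ₁ : ∀ n → Pow±1 n ≡ + 2 * κ (+ 1) n
  Pow±1-κ₁ n with parity n
  ... | even zero    = refl
  ... | even (suc k) = trans (Pow±1-even (suc k)) (cong (+ 2 *_) (sym (κ-even (+ 1) k)))
  ... | odd k        = trans (Pow±1-odd k) (cong (+ 2 *_) (sym (κ-odd (+ 1) k)))

  Pow±1-κ₂ : ∀ n → Pow±1 n ≡ (κ (+ 2) ⊕ δ) n
  Pow±1-κ₂ n with parity n
  ... | even zero    = refl
  ... | even (suc k) = trans (Pow±1-even (suc k)) (cong (_+ + 0) (sym (κ-even (+ 2) k)))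
  ... | odd k        = trans (Pow±1-odd k) (cong (_+ + 0) (sym (κ-odd (+ 2) k)))

  Euler-Appell : ∀ n x → Appell Euler n (x + + 1) + Appell Euler n (x - + 1) ≡ + 2 * Pow x n
  Euler-Appell n x = begin
    Appell Euler n (x + + 1) + Appell Euler n (x - + 1)   ≡⟨ Appell-± Euler n x ⟩
    (Pow±1 ⋆ Euler ⋆ Pow x) n                             ≡⟨ ⋆-cong total (λ _ → refl) n ⟩
    ((λ k → + 2 * δ k) ⋆ Pow x) n                         ≡⟨ ⋆-scaleˡ (+ 2) δ (Pow x) n ⟩
    + 2 * (δ ⋆ Pow x) n                                   ≡⟨ cong (+ 2 *_) (⋆-identityˡ (Pow x) n) ⟩
    + 2 * Pow x n                                         ∎
    where
    total : Pow±1 ⋆ Euler ≗ λ k → + 2 * δ k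
    total k = trans (⋆-cong Pow±1-κ₁ (λ _ → refl) k)
      (trans (⋆-scaleˡ (+ 2) (κ (+ 1)) Euler k) (cong (+ 2 *_) (κ-⋆-seqAt (+ 1) k)))

  -- Writing 2 cosh t as (2 cosh t - 1) + 1, its product with the generating function of U is 1 + U.
  U-Appell : ∀ n x → Appell U n (x + + 1) + Appell U n (x - + 1) ≡ Pow x n + Appell U n x
  U-Appell n x = begin
    Appell U n (x + + 1) + Appell U n (x - + 1)   ≡⟨ Appell-± U n x ⟩
    (Pow±1 ⋆ U ⋆ Pow x) n                         ≡⟨ ⋆-cong total (λ _ → refl) n ⟩
    ((δ ⊕ U) ⋆ Pow x) n                           ≡⟨ ⋆-distribʳ δ U (Pow x) n ⟩
    (δ ⋆ Pow x) n + Appell U n x                  ≡⟨ cong (_+ Appell U n x) (⋆-identityˡ (Pow x) n) ⟩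
    Pow x n + Appell U n x                        ∎
    where
    total : Pow±1 ⋆ U ≗ δ ⊕ U
    total k = trans (⋆-cong Pow±1-κ₂ (λ _ → refl) k) (trans (⋆-distribʳ (κ (+ 2)) δ U k)
      (cong₂ _+_ (κ-⋆-seqAt (+ 2) k) (⋆-identityˡ U k)))

  Appell-0 : ∀ s n → Appell s n (+ 0) ≡ s n
  Appell-0 s n = trans (⋆-cong (λ _ → refl) Pow-0 n) (trans (⋆-comm s δ n) (⋆-identityˡ s n))
    where
    Pow-0 : Pow (+ 0) ≗ δ
    Pow-0 zero    = refl
    Pow-0 (suc k) = refl

  -- As s is even, s(t) exp(-xt) is the reflection of s(t) exp(xt), and reflection fixes
  -- coefficients of even index.
  Appell-neg : ∀ c m x → Appell (seqAt c) (m ℕ.* 2) (- x) ≡ Appell (seqAt c) (m ℕ.* 2) x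
  Appell-neg c m x = begin
    (s ⋆ Pow (- x)) n
      ≡⟨ ⋆-cong (λ k → sym (reflect-evenSeq s (seqAt-odd c) k)) (λ k → trans
          (cong (λ z → Pow z k) (sym (ℤₚ.-1*i≡-i x))) (Pow-* (- + 1) x k)) n ⟩
    (reflect s ⋆ reflect (Pow x)) n
      ≡⟨ reflect-⋆ s (Pow x) n ⟨
    reflect (s ⋆ Pow x) n
      ≡⟨ reflect-even (s ⋆ Pow x) m ⟩
    (s ⋆ Pow x) n ∎
    where
    n : ℕ
    n = m ℕ.* 2
    s : Seq
    s = seqAt c

  -- At x = 0 the difference equation reads A(1) + A(-1) = 2 · 0ⁿ with n > 0, and A(-1) = A(1). This
  -- zero makes the initial values in both inductions modulo p⁴ exact.
  Euler-Appell-1 : ∀ m → Appell Euler (suc m ℕ.* 2) (+ 1) ≡ + 0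
  Euler-Appell-1 m = ℤₚ.*-cancelˡ-≡ (+ 2) _ _ (begin
    + 2 * a 1ℤ                        ≡⟨ double (a 1ℤ) ⟩
    a (+ 0 + + 1) + a 1ℤ              ≡⟨ cong (λ z → a 1ℤ + z) (Appell-neg (+ 1) (suc m) (+ 1)) ⟨
    a (+ 0 + + 1) + a (+ 0 - + 1)     ≡⟨ Euler-Appell (suc m ℕ.* 2) (+ 0) ⟩
    + 2 * + 0                         ∎)
    where
    a : ℤ → ℤ
    a = Appell Euler (suc m ℕ.* 2)
    double : ∀ x → + 2 * x ≡ x + x
    double = ℤS.solve-∀

open EulerLikeSequences

absorption : ∀ n k → suc k ℕ.* (suc n C suc k) ≡ suc n ℕ.* (n C k)
absorption zero    zero    = refl
absorption zero    (suc k) = ℕ.*-zeroʳ (suc (suc k))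
absorption (suc n) zero    = trans (ℕ.*-identityˡ (suc (suc n) C 1)) (trans (nC1≡n (suc (suc n)))
  (trans (sym (ℕ.*-identityʳ (suc (suc n)))) (cong (suc (suc n) ℕ.*_) (sym (nC0≡1 (suc n))))))
absorption (suc n) (suc k) = begin
  suc (suc k) ℕ.* (suc (suc n) C suc (suc k))
    ≡⟨ cong (suc (suc k) ℕ.*_) (nCk+nC[k+1]≡[n+1]C[k+1] (suc n) (suc k)) ⟨
  suc (suc k) ℕ.* (A ℕ.+ (suc n C suc (suc k)))
    ≡⟨ ℕ.*-distribˡ-+ (suc (suc k)) A (suc n C suc (suc k)) ⟩
  A ℕ.+ suc k ℕ.* A ℕ.+ suc (suc k) ℕ.* (suc n C suc (suc k))
    ≡⟨ cong₂ (λ u v → A ℕ.+ u ℕ.+ v) (absorption n k) (absorption n (suc k)) ⟩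
  A ℕ.+ suc n ℕ.* (n C k) ℕ.+ suc n ℕ.* (n C suc k)
    ≡⟨ collect A (suc n) (n C k) (n C suc k) ⟩
  A ℕ.+ suc n ℕ.* ((n C k) ℕ.+ (n C suc k))
    ≡⟨ cong (λ z → A ℕ.+ suc n ℕ.* z) (nCk+nC[k+1]≡[n+1]C[k+1] n k) ⟩
  A ℕ.+ suc n ℕ.* A ∎
  where
  open ≡-Reasoning
  A : ℕ
  A = suc n C suc k
  collect : ∀ a m x y → a ℕ.+ m ℕ.* x ℕ.+ m ℕ.* y ≡ a ℕ.+ m ℕ.* (x ℕ.+ y)
  collect = ℕS.solve-∀

-- Integer congruences modulo p.

module Modulo (p : ℕ) where
  open import Data.Integer using (_+_; _*_; -_)

  infix 4 _≈_
  -- With the quotient explicit, matching the equality against `refl` reduces each closure property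
  -- to a ring identity.
  record _≈_ (x y : ℤ) : Set where
    constructor congruent
    field
      quotient : ℤ
      equality : x ≡ y + quotient * + p

  ≡⇒≈ : ∀ {x y} → x ≡ y → x ≈ y
  ≡⇒≈ {x} refl = congruent (+ 0) (sym (ℤₚ.+-identityʳ x))

  ≈-sym : ∀ {x y} → x ≈ y → y ≈ x
  ≈-sym {x} {y} (congruent q refl) = congruent (- q) (lemma y q (+ p))
    where
    lemma : ∀ y q p → y ≡ y + q * p + - q * p
    lemma = ℤS.solve-∀

  ≈-trans : ∀ {x y z} → x ≈ y → y ≈ z → x ≈ z
  ≈-trans {z = z} (congruent q refl) (congruent r refl) = congruent (r + q) (lemma z r q (+ p))
    where
    lemma : ∀ z r q p → z + r * p + q * p ≡ z + (r + q) * p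
    lemma = ℤS.solve-∀

  ≈-setoid : Setoid _ _
  ≈-setoid = record { _≈_ = _≈_ ; isEquivalence = record { refl = ≡⇒≈ refl ; sym = ≈-sym ; trans = ≈-trans } }

  module ≈-Reasoning = Relation.Binary.Reasoning.Setoid ≈-setoid

  +-cong : ∀ {x y u v} → x ≈ y → u ≈ v → x + u ≈ y + v
  +-cong {y = y} {v = v} (congruent q refl) (congruent r refl) = congruent (q + r) (lemma y v q r (+ p))
    where
    lemma : ∀ y v q r p → (y + q * p) + (v + r * p) ≡ y + v + (q + r) * p
    lemma = ℤS.solve-∀

  *-cong : ∀ {x y u v} → x ≈ y → u ≈ v → x * u ≈ y * v
  *-cong {y = y} {v = v} (congruent q refl) (congruent r refl) = congruent (y * r + q * v + q * r * + p)
      (lemma y v q r (+ p))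
    where
    lemma : ∀ y v q r p → (y + q * p) * (v + r * p) ≡ y * v + (y * r + q * v + q * r * p) * p
    lemma = ℤS.solve-∀

  +-congˡ : ∀ x {u v} → u ≈ v → x + u ≈ x + v
  +-congˡ x = +-cong (≡⇒≈ {x} refl)

  +-congʳ : ∀ x {u v} → u ≈ v → u + x ≈ v + x
  +-congʳ x u≈v = +-cong u≈v (≡⇒≈ {x} refl)

  *-congˡ : ∀ x {u v} → u ≈ v → x * u ≈ x * v
  *-congˡ x = *-cong (≡⇒≈ {x} refl)

  *-congʳ : ∀ x {u v} → u ≈ v → u * x ≈ v * x
  *-congʳ x u≈v = *-cong u≈v (≡⇒≈ {x} refl)

  -‿cong : ∀ {x y} → x ≈ y → - x ≈ - y
  -‿cong {x} {y} x≈y = ≈-trans (≡⇒≈ (sym (ℤₚ.-1*i≡-i x))) (≈-trans (*-congˡ (- + 1) x≈y) (≡⇒≈ (ℤₚ.-1*i≡-i y)))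

  Pow-cong : ∀ {x y} → x ≈ y → ∀ n → Pow x n ≈ Pow y n
  Pow-cong x≈y zero    = ≡⇒≈ refl
  Pow-cong x≈y (suc n) = *-cong x≈y (Pow-cong x≈y n)

  ⋆-congˡ : ∀ f {g g′} → (∀ n → g n ≈ g′ n) → ∀ n → (f ⋆ g) n ≈ (f ⋆ g′) n
  ⋆-congˡ f q zero    = *-congˡ (f 0) (q 0)
  ⋆-congˡ f q (suc n) = +-cong (⋆-congˡ (tail f) q n) (⋆-congˡ f (q ∘ suc) n)

  Appell-cong : ∀ s n {x y} → x ≈ y → Appell s n x ≈ Appell s n y
  Appell-cong s n x≈y = ⋆-congˡ s (Pow-cong x≈y) n

  ∑-zero : ∀ n f → (∀ {k} → k < n → f k ≈ + 0) → ∑ n f ≈ + 0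
  ∑-zero zero    f q = ≡⇒≈ refl
  ∑-zero (suc n) f q = +-cong (q z<s) (∑-zero n (tail f) (q ∘ s<s))

-- Fermat's theorem, and antiperiodic functions on ℤ/p.

module PrimeModulus (p : ℕ) (prime : Prime p) where
  open import Data.Integer using (_+_; _*_; -_; _-_)
  open Modulo p
  open ≈-Reasoning

  ∣⇒≈0 : ∀ x → p ℕ.∣ ℤ.∣ x ∣ → x ≈ + 0
  ∣⇒≈0 x d with ℤ∣.∣ᵤ⇒∣ {+ p} {x} d
  ... | ℤ∣.divides q eq = congruent q (trans eq (sym (ℤₚ.+-identityˡ (q * + p))))

  ≈0⇒∣ : ∀ {x} → x ≈ + 0 → p ℕ.∣ ℤ.∣ x ∣
  ≈0⇒∣ {x} (congruent q eq) = ℤ∣.∣⇒∣ᵤ {+ p} {x} (ℤ∣.divides q (trans eq (ℤₚ.+-identityˡ (q * + p))))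

  ∤-below : ∀ {j} → 0 < j → j < p → ¬ p ℕ.∣ j
  ∤-below {suc j} _ j<p = ℕ.>⇒∤ j<p

  cancel : ∀ {j x y} → ¬ p ℕ.∣ j → + j * x ≈ + j * y → x ≈ y
  cancel {j} {x} {y} p∤j eq = factor (euclidsLemma j ℤ.∣ x - y ∣ prime
      (subst (p ℕ.∣_) (ℤₚ.abs-* (+ j) (x - y)) (≈0⇒∣ difference)))
    where
    distrib : ∀ j x y → j * (x - y) ≡ j * x + - (j * y)
    distrib = ℤS.solve-∀
    split : ∀ x y → x ≡ (x - y) + y
    split = ℤS.solve-∀
    difference : + j * (x - y) ≈ + 0
    difference = begin
      + j * (x - y)           ≡⟨ distrib (+ j) x y ⟩
      + j * x + - (+ j * y)   ≈⟨ +-congʳ (- (+ j * y)) eq ⟩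
      + j * y + - (+ j * y)   ≡⟨ ℤₚ.+-inverseʳ (+ j * y) ⟩
      + 0                     ∎
    factor : p ℕ.∣ j ⊎ p ℕ.∣ ℤ.∣ x - y ∣ → x ≈ y
    factor (inj₁ d) = ⊥-elim (p∤j d)
    factor (inj₂ d) = begin
      x              ≡⟨ split x y ⟩
      (x - y) + y    ≈⟨ +-congʳ y (∣⇒≈0 (x - y) d) ⟩
      + 0 + y        ≡⟨ ℤₚ.+-identityˡ y ⟩
      y              ∎

  p∣pCk : ∀ q k → p ≡ suc q → k < q → p ℕ.∣ (p C suc k)
  p∣pCk q k refl k<q with euclidsLemma (suc k) (suc q C suc k) prime
       (ℕ.divides (q C k) (trans (absorption q k) (ℕ.*-comm (suc q) (q C k))))
  ... | inj₁ d = ⊥-elim (∤-below z<s (s<s k<q) d)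
  ... | inj₂ d = d

  -- The binomial theorem, taken from exp(xt) exp(t) = exp((x + 1)t); the coefficients strictly
  -- between the ends are divisible by p.
  freshman : ∀ q → p ≡ suc q → ∀ x → Pow (x + + 1) p ≈ Pow x p + + 1
  freshman q refl x = begin
    Pow (x + + 1) p                                  ≡⟨ Pow-⋆ x (+ 1) p ⟨
    (Pow x ⋆ Pow (+ 1)) p                            ≡⟨ ⋆-binomial p (Pow x) (Pow (+ 1)) ⟩
    t 0 + ∑ p (tail t)                               ≡⟨ cong (λ z → t 0 + z) (∑-last q (tail t)) ⟩
    t 0 + (∑ q (tail t) + t p)                       ≈⟨ +-congˡ (t 0) (+-congʳ (t p) (∑-zero q (tail t) middle)) ⟩
    t 0 + (+ 0 + t p)                                ≡⟨ cong₂ (λ u v → u + (+ 0 + v)) first last ⟩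
    + 1 + (+ 0 + Pow x p)                            ≡⟨ swap (Pow x p) ⟩
    Pow x p + + 1                                    ∎
    where
    t : Seq
    t k = + (p C k) * (Pow x k * Pow (+ 1) (p ∸ k))
    swap : ∀ x → + 1 + (+ 0 + x) ≡ x + + 1
    swap = ℤS.solve-∀
    middle : ∀ {k} → k < q → tail t k ≈ + 0
    middle {k} k<q = *-congʳ (Pow x (suc k) * Pow (+ 1) (p ∸ suc k)) (∣⇒≈0 (+ (p C suc k)) (p∣pCk q k refl k<q))
    first : t 0 ≡ + 1
    first = cong₂ (λ u v → + u * (+ 1 * v)) (nC0≡1 p) (Pow-1 p)
    last : t p ≡ Pow x p
    last = trans (cong₂ (λ u v → + u * (Pow x p * v)) (nCn≡1 p) (Pow-1 (p ∸ p))) (ones (Pow x p))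
      where
      ones : ∀ x → + 1 * (x * + 1) ≡ x
      ones = ℤS.solve-∀

  fermat : ∀ q → p ≡ suc q → ∀ j → Pow (+ j) p ≈ + j
  fermat q refl zero    = ≡⇒≈ refl
  fermat q refl (suc j) = begin
    Pow (+ suc j) p       ≡⟨ cong (λ z → Pow (+ z) p) (ℕ.+-comm 1 j) ⟩
    Pow (+ j + + 1) p     ≈⟨ freshman q refl (+ j) ⟩
    Pow (+ j) p + + 1     ≈⟨ +-congʳ (+ 1) (fermat q refl j) ⟩
    + j + + 1             ≡⟨ cong +_ (ℕ.+-comm j 1) ⟩
    + suc j               ∎

  fermat-unit : ∀ q → p ≡ suc q → ∀ {j} → ¬ p ℕ.∣ j → Pow (+ j) q ≈ + 1
  fermat-unit q refl {j} p∤j = cancel p∤j (begin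
    + j * Pow (+ j) q   ≈⟨ fermat q refl j ⟩
    + j                 ≡⟨ ℤₚ.*-identityʳ (+ j) ⟨
    + j * + 1           ∎)

  -- After p translations by c the argument 0 is back in its class, while the sign has changed an
  -- odd number of times; hence d(0) ≡ -d(0), and 2 is invertible. Two functions with the same
  -- inhomogeneous recurrence have an antiperiodic difference, so they agree at 0: this stands in
  -- for the uniqueness of polynomial solutions.
  antiperiodic⇒zero : (d : ℤ → ℤ) (c : ℕ) → 2 < p → (∀ {x y} → x ≈ y → d x ≈ d y) → ∀ h → p ≡ suc (h ℕ.* 2) →
                      (∀ x → d (x + + c) ≈ - d x) → d (+ 0) ≈ + 0
  antiperiodic⇒zero d c 2<p d-cong h p-odd anti = cancel {2} (∤-below z<s 2<p) (begin
    + 2 * d (+ 0)               ≡⟨ double (d (+ 0)) ⟩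
    - (- d (+ 0)) + d (+ 0)     ≈⟨ +-congʳ (d (+ 0)) (-‿cong (≈-sym around)) ⟩
    - d (+ 0) + d (+ 0)         ≡⟨ ℤₚ.+-inverseˡ (d (+ 0)) ⟩
    + 2 * + 0                   ∎)
    where
    double : ∀ x → + 2 * x ≡ - (- x) + x
    double = ℤS.solve-∀
    double-step : ∀ x → d (x + + c + + c) ≈ d x
    double-step x = begin
      d (x + + c + + c)   ≈⟨ anti (x + + c) ⟩
      - d (x + + c)       ≈⟨ -‿cong (anti x) ⟩
      - (- d x)           ≡⟨ ℤₚ.neg-involutive (d x) ⟩
      d x                 ∎
    expand : ∀ i c → + suc (suc i) * c ≡ + i * c + c + c
    expand i c = trans (cong (_* c) (ℤₚ.pos-+ 2 i)) (lemma (+ i) c)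
      where
      lemma : ∀ i c → (+ 2 + i) * c ≡ i * c + c + c
      lemma = ℤS.solve-∀
    even-steps : ∀ i → d (+ (i ℕ.* 2) * + c) ≈ d (+ 0)
    even-steps zero    = ≡⇒≈ refl
    even-steps (suc i) = begin
      d (+ (suc i ℕ.* 2) * + c)             ≡⟨ cong d (expand (i ℕ.* 2) (+ c)) ⟩
      d (+ (i ℕ.* 2) * + c + + c + + c)     ≈⟨ double-step (+ (i ℕ.* 2) * + c) ⟩
      d (+ (i ℕ.* 2) * + c)                 ≈⟨ even-steps i ⟩
      d (+ 0)                               ∎
    around : d (+ 0) ≈ - d (+ 0)
    around = begin
      d (+ 0)                         ≈⟨ d-cong (congruent (- + c) (trans (lemma (+ p) (+ c)) refl)) ⟩
      d (+ p * + c)                   ≡⟨ cong (λ z → d (+ z * + c)) p-odd ⟩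
      d (+ suc (h ℕ.* 2) * + c)       ≡⟨ cong d (trans (cong (_* + c) (ℤₚ.pos-+ 1 (h ℕ.* 2))) (one (+ (h ℕ.* 2)) (+ c))) ⟩
      d (+ (h ℕ.* 2) * + c + + c)     ≈⟨ anti (+ (h ℕ.* 2) * + c) ⟩
      - d (+ (h ℕ.* 2) * + c)         ≈⟨ -‿cong (even-steps h) ⟩
      - d (+ 0)                       ∎
      where
      lemma : ∀ p c → + 0 ≡ p * c + - c * p
      lemma = ℤS.solve-∀
      one : ∀ i c → (+ 1 + i) * c ≡ i * c + c
      one = ℤS.solve-∀

-- Values of the Appell polynomials at 2/3 and 1/3 modulo p.

module EulerCongruences (m : ℕ) (prime : Prime (5 ℕ.+ m ℕ.* 2)) where
  open import Data.Integer using (_+_; _*_; -_; _-_)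

  -- Here n = p - 3, written as a positive even number, the form to which `Appell-neg` and
  -- `Euler-Appell-1` apply.
  p n : ℕ
  p = 5 ℕ.+ m ℕ.* 2
  n = suc m ℕ.* 2

  open Modulo p
  open PrimeModulus p prime
  open ≈-Reasoning

  A V : ℤ → ℤ
  A = Appell Euler n
  V = Appell U n

  2<p : 2 < p
  2<p = s<s (s<s z<s)

  p∤2 : ¬ p ∣ 2
  p∤2 = ∤-below z<s 2<p

  p∤3 : ¬ p ∣ 3
  p∤3 = ∤-below z<s (s<s (s<s (s<s z<s)))

  inverse-square : ∀ {j} → ¬ p ℕ.∣ j → + j * + j * Pow (+ j) n ≈ + 1
  inverse-square {j} p∤j = ≈-trans (≡⇒≈ (ℤₚ.*-assoc (+ j) (+ j) (Pow (+ j) n))) (fermat-unit (4 ℕ.+ m ℕ.* 2) refl p∤j)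

  -- The difference equation at 2x yields 2 · 2ⁿ xⁿ, and 4 · 2ⁿ = 2^(p-1) ≡ 1. Through it 1 / k²
  -- becomes a sum of values of A at the neighbouring odd arguments 2k + 1 and 2k - 1, so
  -- alternating sums of 1 / k² telescope.
  Pow-via-A : ∀ x → Pow x n ≈ + 2 * (A (+ 2 * x + + 1) + A (+ 2 * x - + 1))
  Pow-via-A x = begin
    Pow x n                                        ≡⟨ ℤₚ.*-identityˡ (Pow x n) ⟨
    + 1 * Pow x n                                  ≈⟨ *-congʳ (Pow x n) (inverse-square p∤2) ⟨
    + 4 * Pow (+ 2) n * Pow x n                    ≡⟨ regroup (Pow (+ 2) n) (Pow x n) ⟩
    + 2 * (+ 2 * (Pow (+ 2) n * Pow x n))          ≡⟨ cong (λ z → + 2 * (+ 2 * z)) (Pow-* (+ 2) x n) ⟨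
    + 2 * (+ 2 * Pow (+ 2 * x) n)                  ≡⟨ cong (+ 2 *_) (Euler-Appell n (+ 2 * x)) ⟨
    + 2 * (A (+ 2 * x + + 1) + A (+ 2 * x - + 1))  ∎
    where
    regroup : ∀ u v → + 4 * u * v ≡ + 2 * (+ 2 * (u * v))
    regroup = ℤS.solve-∀

  A-shift : ∀ x → A (x + + 1) ≈ + 2 * Pow x n - A (x - + 1)
  A-shift x = ≡⇒≈ (trans (move (A (x + + 1)) (A (x - + 1))) (cong (_- A (x - + 1)) (Euler-Appell n x)))
    where
    move : ∀ u v → u ≡ u + v - v
    move = ℤS.solve-∀

  -- Sum of the recurrences at x + 2 and x + 1. For the shift operator z this is (z + 1)(z² - z + 1)
  -- = z³ + 1, which makes V antiperiodic under a step of 3 up to powers.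
  V-shift : ∀ x → V (x + + 3) ≈ - V x + (Pow (x + + 2) n + Pow (x + + 1) n)
  V-shift x = ≡⇒≈ (from (V x) (V (x + + 1)) (V (x + + 2)) (V (x + + 3)) (Pow (x + + 2) n) (Pow (x + + 1) n)
      (recurrence (x + + 2) (x + + 3) (x + + 1) (e₁ x) (e₂ x)) (recurrence (x + + 1) (x + + 2) x (e₃ x) (e₄ x)))
    where
    e₁ : ∀ x → x + + 2 + + 1 ≡ x + + 3
    e₁ = ℤS.solve-∀
    e₂ : ∀ x → x + + 2 - + 1 ≡ x + + 1
    e₂ = ℤS.solve-∀
    e₃ : ∀ x → x + + 1 + + 1 ≡ x + + 2
    e₃ = ℤS.solve-∀
    e₄ : ∀ x → x + + 1 - + 1 ≡ x
    e₄ = ℤS.solve-∀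
    recurrence : ∀ y y⁺ y⁻ → y + + 1 ≡ y⁺ → y - + 1 ≡ y⁻ → V y⁺ + V y⁻ ≡ Pow y n + V y
    recurrence y _ _ refl refl = U-Appell n y
    isolate : ∀ a b c → a ≡ a + b + (c + - c) - b
    isolate = ℤS.solve-∀
    rearrange : ∀ v₀ v₁ v₂ u w → (u + v₂) + (w + v₁ - v₀ + - v₂) - v₁ ≡ - v₀ + (u + w)
    rearrange = ℤS.solve-∀
    move : ∀ a b → a ≡ a + b - b
    move = ℤS.solve-∀
    from : ∀ v₀ v₁ v₂ v₃ u w → v₃ + v₁ ≡ u + v₂ → v₂ + v₀ ≡ w + v₁ → v₃ ≡ - v₀ + (u + w)
    from v₀ v₁ v₂ v₃ u w eq eq′ = trans (isolate v₃ v₁ v₂)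
      (trans (cong₂ (λ s t → s + (t + - v₂) - v₁) eq (trans (move v₂ v₀) (cong (_- v₀) eq′)))
             (rearrange v₀ v₁ v₂ u w))

  -- c stands for 1/3, and 9 · 3ⁿ = 3^(p-1) ≡ 1.
  Pow-third : ∀ {c} → + 3 * c ≈ + 1 → Pow c n ≈ + 9
  Pow-third {c} 3c≈1 = begin
    Pow c n                          ≡⟨ ℤₚ.*-identityˡ (Pow c n) ⟨
    + 1 * Pow c n                    ≈⟨ *-congʳ (Pow c n) (inverse-square p∤3) ⟨
    + 9 * Pow (+ 3) n * Pow c n      ≡⟨ ℤₚ.*-assoc (+ 9) (Pow (+ 3) n) (Pow c n) ⟩
    + 9 * (Pow (+ 3) n * Pow c n)    ≡⟨ cong (+ 9 *_) (Pow-* (+ 3) c n) ⟨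
    + 9 * Pow (+ 3 * c) n            ≈⟨ *-congˡ (+ 9) (Pow-cong 3c≈1 n) ⟩
    + 9 * Pow (+ 1) n                ≡⟨ cong (+ 9 *_) (Pow-1 n) ⟩
    + 9                              ∎

  -- The multiplication formula by 3 for the Euler polynomials, evaluated at 0.
  A-two-thirds : ∀ {x} → + 3 * x ≈ + 2 → A x ≈ + 5 * Euler n
  A-two-thirds {x} 3x≈2 = cancel p∤2 (begin
    + 2 * A x                                    ≈⟨ ≡⇒≈ (isolate (A x) E) ⟩
    + 2 * A x - E + E                            ≈⟨ +-congʳ E (≈-sym main) ⟩
    + 9 * E + E                                  ≡⟨ ten E ⟩
    + 2 * (+ 5 * E)                              ∎)
    where
    E : ℤ
    E = Euler n
    isolate : ∀ a e → + 2 * a ≡ + 2 * a - e + e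
    isolate = ℤS.solve-∀
    ten : ∀ e → + 9 * e + e ≡ + 2 * (+ 5 * e)
    ten = ℤS.solve-∀
    -- As x stands for 2/3, this is an integer representing 1/3.
    c : ℤ
    c = + 2 * x - + 1
    3c≈1 : + 3 * c ≈ + 1
    3c≈1 = begin
      + 3 * (+ 2 * x - + 1)     ≡⟨ s x ⟩
      + 2 * (+ 3 * x) - + 3     ≈⟨ +-congʳ (- + 3) (*-congˡ (+ 2) 3x≈2) ⟩
      + 2 * + 2 - + 3           ∎
      where
      s : ∀ x → + 3 * (+ 2 * x - + 1) ≡ + 2 * (+ 3 * x) - + 3
      s = ℤS.solve-∀
    2c≈x : + 2 * c ≈ x
    2c≈x = begin
      + 2 * (+ 2 * x - + 1)     ≡⟨ s x ⟩
      + 3 * x + (x - + 2)       ≈⟨ +-congʳ (x - + 2) 3x≈2 ⟩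
      + 2 + (x - + 2)           ≡⟨ s′ x ⟩
      x                         ∎
      where
      s : ∀ x → + 2 * (+ 2 * x - + 1) ≡ + 3 * x + (x - + 2)
      s = ℤS.solve-∀
      s′ : ∀ x → + 2 + (x - + 2) ≡ x
      s′ = ℤS.solve-∀
    γ : ℤ
    γ = Pow c n
    -- `b` is the alternating sum over the points y/3 - 2/3, y/3, y/3 + 2/3; the tripling formula
    -- says that it agrees with 3⁻ⁿ A(y).
    b d : ℤ → ℤ
    b y = A (c * y - + 2 * c) - A (c * y) + A (c * y + + 2 * c)
    d y = γ * A y - b y
    d-cong : ∀ {y z} → y ≈ z → d y ≈ d z
    d-cong {y} {z} y≈z = +-cong (*-congˡ γ (Appell-cong Euler n y≈z)) (-‿cong
      (+-cong (+-cong (Appell-cong Euler n (+-congʳ (- (+ 2 * c)) cy≈cz)) (-‿cong (Appell-cong Euler n cy≈cz)))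
              (Appell-cong Euler n (+-congʳ (+ 2 * c) cy≈cz))))
      where
      cy≈cz : c * y ≈ c * z
      cy≈cz = *-congˡ c y≈z
    d-anti : ∀ y → d (y + + 2) ≈ - d y
    d-anti y = begin
      γ * A (y + + 2) - b (y + + 2)
        ≈⟨ +-cong (*-congˡ γ A-step) (-‿cong b-step) ⟩
      γ * (+ 2 * Pow (y + + 1) n - A y) - (+ 2 * (γ * Pow (y + + 1) n) - b y)
        ≡⟨ collect γ (Pow (y + + 1) n) (A y) (b y) ⟩
      - (γ * A y - b y) ∎
      where
      collect : ∀ γ P a b → γ * (+ 2 * P - a) - (+ 2 * (γ * P) - b) ≡ - (γ * a - b)
      collect = ℤS.solve-∀
      A-step : A (y + + 2) ≈ + 2 * Pow (y + + 1) n - A y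
      A-step = begin
        A (y + + 2)                                  ≡⟨ cong A (ℤₚ.+-assoc y (+ 1) (+ 1)) ⟨
        A (y + + 1 + + 1)                            ≈⟨ A-shift (y + + 1) ⟩
        + 2 * Pow (y + + 1) n - A (y + + 1 - + 1)    ≡⟨ cong (λ z → + 2 * Pow (y + + 1) n - A z) (s y) ⟩
        + 2 * Pow (y + + 1) n - A y                  ∎
        where
        s : ∀ y → y + + 1 - + 1 ≡ y
        s = ℤS.solve-∀
      r : ∀ c y → c * (y + + 2) + + 2 * c ≡ c * (y + + 1) + + 3 * c
      r = ℤS.solve-∀
      top : A (c * (y + + 2) + + 2 * c) ≈ + 2 * (γ * Pow (y + + 1) n) - A (c * y - + 2 * c)
      top = begin
        A (c * (y + + 2) + + 2 * c)                                   ≡⟨ cong A (r c y) ⟩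
        A (c * (y + + 1) + + 3 * c)                                   ≈⟨ Appell-cong Euler n (+-congˡ (c * (y + + 1)) 3c≈1) ⟩
        A (c * (y + + 1) + + 1)                                       ≈⟨ A-shift (c * (y + + 1)) ⟩
        + 2 * Pow (c * (y + + 1)) n - A (c * (y + + 1) - + 1)         ≈⟨ +-cong (≡⇒≈
            (cong (+ 2 *_) (Pow-* c (y + + 1) n))) (-‿cong (Appell-cong Euler n (+-congˡ (c * (y + + 1)) (-‿cong
            (≈-sym 3c≈1))))) ⟩
        + 2 * (γ * Pow (y + + 1) n) - A (c * (y + + 1) - + 3 * c)     ≡⟨ cong
            (λ z → + 2 * (γ * Pow (y + + 1) n) - A z) (r′ c y) ⟩
        + 2 * (γ * Pow (y + + 1) n) - A (c * y - + 2 * c)             ∎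
        where
        r′ : ∀ c y → c * (y + + 1) - + 3 * c ≡ c * y - + 2 * c
        r′ = ℤS.solve-∀
      low : ∀ c y → c * (y + + 2) - + 2 * c ≡ c * y
      low = ℤS.solve-∀
      mid : ∀ c y → c * (y + + 2) ≡ c * y + + 2 * c
      mid = ℤS.solve-∀
      cyclic : ∀ q a₋ a a₊ → a - a₊ + (q - a₋) ≡ q - (a₋ - a + a₊)
      cyclic = ℤS.solve-∀
      -- When y grows by 2 the three points move by 2/3. Two of them land on old points; the last
      -- lies 6c ≡ 2 beyond the first, so one use of the difference equation closes the cycle.
      b-step : b (y + + 2) ≈ + 2 * (γ * Pow (y + + 1) n) - b y
      b-step = begin
        A (c * (y + + 2) - + 2 * c) - A (c * (y + + 2)) + A (c * (y + + 2) + + 2 * c)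
          ≈⟨ +-cong (≡⇒≈ (cong₂ (λ u v → A u - A v) (low c y) (mid c y))) top ⟩
        A (c * y) - A (c * y + + 2 * c) + (+ 2 * (γ * Pow (y + + 1) n) - A (c * y - + 2 * c))
          ≡⟨ cyclic (+ 2 * (γ * Pow (y + + 1) n)) (A (c * y - + 2 * c)) (A (c * y)) (A (c * y + + 2 * c)) ⟩
        + 2 * (γ * Pow (y + + 1) n) - b y ∎
    -- The tripling formula at y = 0, where the outer points are ±2/3 and A is even.
    main : + 9 * E ≈ + 2 * A x - E
    main = begin
      + 9 * E                       ≈⟨ *-cong (Pow-third 3c≈1) (≡⇒≈ (Appell-0 Euler n)) ⟨
      γ * A (+ 0)                   ≡⟨ s (γ * A (+ 0)) (b (+ 0)) ⟩
      d (+ 0) + b (+ 0)             ≈⟨ +-congʳ (b (+ 0)) (antiperiodic⇒zero d 2 2<p d-cong (2 ℕ.+ m) refl d-anti) ⟩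
      + 0 + b (+ 0)                 ≡⟨ ℤₚ.+-identityˡ (b (+ 0)) ⟩
      A (c * + 0 - + 2 * c) - A (c * + 0) + A (c * + 0 + + 2 * c)
        ≡⟨ cong₂ _+_ (cong₂ (λ u v → A u - A v) (s₁ c) (ℤₚ.*-zeroʳ c)) (cong A (s₂ c)) ⟩
      A (- (+ 2 * c)) - A (+ 0) + A (+ 2 * c)
        ≡⟨ cong₂ (λ u v → u - v + A (+ 2 * c)) (Appell-neg (+ 1) (suc m) (+ 2 * c)) (Appell-0 Euler n) ⟩
      A (+ 2 * c) - E + A (+ 2 * c) ≡⟨ s₃ (A (+ 2 * c)) E ⟩
      + 2 * A (+ 2 * c) - E         ≈⟨ +-congʳ (- E) (*-congˡ (+ 2) (Appell-cong Euler n 2c≈x)) ⟩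
      + 2 * A x - E                 ∎
      where
      s : ∀ u v → u ≡ u - v + v
      s = ℤS.solve-∀
      s₁ : ∀ c → c * + 0 - + 2 * c ≡ - (+ 2 * c)
      s₁ = ℤS.solve-∀
      s₂ : ∀ c → c * + 0 + + 2 * c ≡ + 2 * c
      s₂ = ℤS.solve-∀
      s₃ : ∀ a e → a - e + a ≡ + 2 * a - e
      s₃ = ℤS.solve-∀

  -- Since 1 / (2 cosh t - 1) = cosh(t/2) / cosh(3t/2), one expects 2 (2/3)ⁿ V(y) = A((2y + 1)/3) +
  -- A((2y - 1)/3). Both sides obey the same recurrence under y + 3, so they agree modulo p at y =
  -- 0, giving (2/3)ⁿ U ≡ A(1/3). The factor 4 removes 2ⁿ, and 3⁻ⁿ ≡ 9.
  A-one-third : ∀ {c} → + 3 * c ≈ + 1 → + 4 * A c ≈ + 9 * U n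
  A-one-third {c} 3c≈1 = begin
    + 4 * A c                              ≈⟨ *-congˡ (+ 4) (≈-sym main) ⟩
    + 4 * (γ * U n)                        ≡⟨ cong (λ z → + 4 * (z * U n)) (Pow-* (+ 2) c n) ⟩
    + 4 * (Pow (+ 2) n * Pow c n * U n)    ≡⟨ regroup (Pow (+ 2) n) (Pow c n) (U n) ⟩
    + 4 * Pow (+ 2) n * (Pow c n * U n)    ≈⟨ *-cong (inverse-square p∤2) (*-congʳ (U n) (Pow-third 3c≈1)) ⟩
    + 1 * (+ 9 * U n)                      ≡⟨ ℤₚ.*-identityˡ (+ 9 * U n) ⟩
    + 9 * U n                              ∎
    where
    regroup : ∀ u v w → + 4 * (u * v * w) ≡ + 4 * u * (v * w)
    regroup = ℤS.solve-∀
    γ : ℤ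
    γ = Pow (+ 2 * c) n
    b d : ℤ → ℤ
    b y = A ((+ 2 * y + + 1) * c) + A ((+ 2 * y - + 1) * c)
    d y = + 2 * (γ * V y) - b y
    d-cong : ∀ {y z} → y ≈ z → d y ≈ d z
    d-cong {y} {z} y≈z = +-cong (*-congˡ (+ 2) (*-congˡ γ (Appell-cong U n y≈z))) (-‿cong
      (+-cong (Appell-cong Euler n (*-congʳ c (+-congʳ (+ 1) (*-congˡ (+ 2) y≈z))))
              (Appell-cong Euler n (*-congʳ c (+-congʳ (- + 1) (*-congˡ (+ 2) y≈z))))))
    step : ∀ z → A (+ 2 * c * z + + 3 * c) ≈ + 2 * (γ * Pow z n) - A (+ 2 * c * z - + 3 * c)
    step z = begin
      A (+ 2 * c * z + + 3 * c)                                 ≈⟨ Appell-cong Euler n (+-congˡ (+ 2 * c * z) 3c≈1) ⟩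
      A (+ 2 * c * z + + 1)                                     ≈⟨ A-shift (+ 2 * c * z) ⟩
      + 2 * Pow (+ 2 * c * z) n - A (+ 2 * c * z - + 1)         ≈⟨ +-cong (≡⇒≈
          (cong (+ 2 *_) (Pow-* (+ 2 * c) z n))) (-‿cong (Appell-cong Euler n (+-congˡ (+ 2 * c * z) (-‿cong
          (≈-sym 3c≈1))))) ⟩
      + 2 * (γ * Pow z n) - A (+ 2 * c * z - + 3 * c)           ∎
    d-anti : ∀ y → d (y + + 3) ≈ - d y
    d-anti y = begin
      + 2 * (γ * V (y + + 3)) - (A ((+ 2 * (y + + 3) + + 1) * c) + A ((+ 2 * (y + + 3) - + 1) * c))
        ≡⟨ cong (λ z → + 2 * (γ * V (y + + 3)) - z) (cong₂ (λ u v → A u + A v) (s₁ c y) (s₂ c y)) ⟩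
      + 2 * (γ * V (y + + 3)) - (A (+ 2 * c * (y + + 2) + + 3 * c) + A (+ 2 * c * (y + + 1) + + 3 * c))
        ≈⟨ +-cong (*-congˡ (+ 2) (*-congˡ γ (V-shift y))) (-‿cong (+-cong (step (y + + 2)) (step (y + + 1)))) ⟩
      + 2 * (γ * (- V y + (P₂ + P₁))) - (+ 2 * (γ * P₂) - A (+ 2 * c * (y + + 2) - + 3 * c) + (+ 2 * (γ * P₁) - A
          (+ 2 * c * (y + + 1) - + 3 * c)))
        ≡⟨ collect γ (V y) P₂ P₁ (A (+ 2 * c * (y + + 2) - + 3 * c)) (A (+ 2 * c * (y + + 1) - + 3 * c)) ⟩
      - (+ 2 * (γ * V y) - (A (+ 2 * c * (y + + 2) - + 3 * c) + A (+ 2 * c * (y + + 1) - + 3 * c)))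
        ≡⟨ cong (λ z → - (+ 2 * (γ * V y) - z)) (cong₂ (λ u v → A u + A v) (s₃ c y) (s₄ c y)) ⟩
      - d y ∎
      where
      P₂ P₁ : ℤ
      P₂ = Pow (y + + 2) n
      P₁ = Pow (y + + 1) n
      s₁ : ∀ c y → (+ 2 * (y + + 3) + + 1) * c ≡ + 2 * c * (y + + 2) + + 3 * c
      s₁ = ℤS.solve-∀
      s₂ : ∀ c y → (+ 2 * (y + + 3) - + 1) * c ≡ + 2 * c * (y + + 1) + + 3 * c
      s₂ = ℤS.solve-∀
      s₃ : ∀ c y → + 2 * c * (y + + 2) - + 3 * c ≡ (+ 2 * y + + 1) * c
      s₃ = ℤS.solve-∀
      s₄ : ∀ c y → + 2 * c * (y + + 1) - + 3 * c ≡ (+ 2 * y - + 1) * c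
      s₄ = ℤS.solve-∀
      collect : ∀ g v p₂ p₁ a₂ a₁ → + 2 * (g * (- v + (p₂ + p₁))) - (+ 2 * (g * p₂) - a₂ + (+ 2 * (g * p₁) - a₁))
          ≡ - (+ 2 * (g * v) - (a₂ + a₁))
      collect = ℤS.solve-∀
    main : γ * U n ≈ A c
    main = cancel p∤2 (begin
      + 2 * (γ * U n)            ≡⟨ cong (λ z → + 2 * (γ * z)) (Appell-0 U n) ⟨
      + 2 * (γ * V (+ 0))        ≡⟨ s (+ 2 * (γ * V (+ 0))) (b (+ 0)) ⟩
      d (+ 0) + b (+ 0)          ≈⟨ +-congʳ (b (+ 0)) (antiperiodic⇒zero d 3 2<p d-cong (2 ℕ.+ m) refl d-anti) ⟩
      + 0 + b (+ 0)              ≡⟨ ℤₚ.+-identityˡ (b (+ 0)) ⟩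
      A (+ 1 * c) + A (- + 1 * c) ≡⟨ cong₂ (λ u v → A u + A v) (ℤₚ.*-identityˡ c) (ℤₚ.-1*i≡-i c) ⟩
      A c + A (- c)              ≡⟨ cong (λ z → A c + z) (Appell-neg (+ 1) (suc m) c) ⟩
      A c + A c                  ≡⟨ s′ (A c) ⟩
      + 2 * A c                  ∎)
      where
      s : ∀ u v → u ≡ u - v + v
      s = ℤS.solve-∀
      s′ : ∀ a → a + a ≡ + 2 * a
      s′ = ℤS.solve-∀

open import Data.Rational using (ℚ; mkℚ; 0ℚ; 1ℚ; _+_; _*_; _-_; -_; _/_; toℚᵘ; ↧ₙ_; ↧_)
import Data.Rational.Properties as ℚ
open import Data.Rational.Unnormalised as ℚᵘ using (mkℚᵘ; *≡*)
import Data.Rational.Unnormalised.Properties as ℚᵘ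

ℚ-ring : AlmostCommutativeRing 0ℓ 0ℓ
ℚ-ring = fromCommutativeRing ℚ.+-*-commutativeRing λ { (mkℚ (+ 0) 0 _) → just refl ; _ → nothing }

-- Integers inside ℚ, and finite rational sums.

module RationalArithmetic where
  open ≡-Reasoning

  private
    toℚᵘ-ℤ→ℚ : ∀ z → toℚᵘ (ℤ→ℚ z) ℚᵘ.≃ mkℚᵘ z 0
    toℚᵘ-ℤ→ℚ z = ℚ.toℚᵘ-fromℚᵘ (mkℚᵘ z 0)

  ℤ→ℚ-+ : ∀ x y → ℤ→ℚ (x ℤ.+ y) ≡ ℤ→ℚ x + ℤ→ℚ y
  ℤ→ℚ-+ x y = ℚ.toℚᵘ-injective (ℚᵘ.≃-trans (toℚᵘ-ℤ→ℚ (x ℤ.+ y)) (ℚᵘ.≃-sym (ℚᵘ.≃-trans (ℚ.toℚᵘ-homo-+ (ℤ→ℚ x) (ℤ→ℚ y))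
    (ℚᵘ.≃-trans (ℚᵘ.+-cong (toℚᵘ-ℤ→ℚ x) (toℚᵘ-ℤ→ℚ y)) (*≡* (cong (ℤ._* + 1)
        (cong₂ ℤ._+_ (ℤₚ.*-identityʳ x) (ℤₚ.*-identityʳ y))))))))

  ℤ→ℚ-* : ∀ x y → ℤ→ℚ (x ℤ.* y) ≡ ℤ→ℚ x * ℤ→ℚ y
  ℤ→ℚ-* x y = ℚ.toℚᵘ-injective (ℚᵘ.≃-trans (toℚᵘ-ℤ→ℚ (x ℤ.* y)) (ℚᵘ.≃-sym (ℚᵘ.≃-trans (ℚ.toℚᵘ-homo-* (ℤ→ℚ x) (ℤ→ℚ y))
    (ℚᵘ.≃-trans (ℚᵘ.*-cong (toℚᵘ-ℤ→ℚ x) (toℚᵘ-ℤ→ℚ y)) (*≡* refl)))))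

  ℤ→ℚ-neg : ∀ x → ℤ→ℚ (ℤ.- x) ≡ - ℤ→ℚ x
  ℤ→ℚ-neg x = begin
    ℤ→ℚ (ℤ.- x)              ≡⟨ cong ℤ→ℚ (ℤₚ.-1*i≡-i x) ⟨
    ℤ→ℚ (ℤ.- + 1 ℤ.* x)      ≡⟨ ℤ→ℚ-* (ℤ.- + 1) x ⟩
    ℤ→ℚ (ℤ.- + 1) * ℤ→ℚ x    ≡⟨ lemma (ℤ→ℚ x) ⟩
    - ℤ→ℚ x                  ∎
    where
    lemma : ∀ x → ℤ→ℚ (ℤ.- + 1) * x ≡ - x
    lemma = solve-∀-in ℚ-ring

  ℕ→ℚ-+ : ∀ m n → ℕ→ℚ (m ℕ.+ n) ≡ ℕ→ℚ m + ℕ→ℚ n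
  ℕ→ℚ-+ m n = trans (cong ℤ→ℚ (ℤₚ.pos-+ m n)) (ℤ→ℚ-+ (+ m) (+ n))

  ℕ→ℚ-* : ∀ m n → ℕ→ℚ (m ℕ.* n) ≡ ℕ→ℚ m * ℕ→ℚ n
  ℕ→ℚ-* m n = trans (cong ℤ→ℚ (ℤₚ.pos-* m n)) (ℤ→ℚ-* (+ m) (+ n))

  /-*-cancel : ∀ z d .{{_ : ℕ.NonZero d}} → ℕ→ℚ d * (z / d) ≡ ℤ→ℚ z
  /-*-cancel z (suc d) = ℚ.toℚᵘ-injective (ℚᵘ.≃-trans (ℚ.toℚᵘ-homo-* (ℕ→ℚ (suc d)) (z / suc d))
    (ℚᵘ.≃-trans (ℚᵘ.*-cong (toℚᵘ-ℤ→ℚ (+ suc d)) (ℚ.toℚᵘ-fromℚᵘ (mkℚᵘ z d)))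
    (ℚᵘ.≃-trans (*≡* (trans (ℤₚ.*-identityʳ _) (trans (ℤₚ.*-comm (+ suc d) z)
        (cong (λ w → z ℤ.* + w) (sym (ℕ.*-identityˡ (suc d)))))))
                (ℚᵘ.≃-sym (toℚᵘ-ℤ→ℚ z)))))

  ℕ→ℚ-cancel : ∀ d .{{_ : ℕ.NonZero d}} {x y} → ℕ→ℚ d * x ≡ ℕ→ℚ d * y → x ≡ y
  ℕ→ℚ-cancel d {x} {y} eq = begin
    x                                ≡⟨ unit x ⟩
    (+ 1) / d * (ℕ→ℚ d * x)          ≡⟨ cong (λ z → (+ 1) / d * z) eq ⟩
    (+ 1) / d * (ℕ→ℚ d * y)          ≡⟨ unit y ⟨
    y                                ∎
    where
    unit : ∀ x → x ≡ (+ 1) / d * (ℕ→ℚ d * x)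
    unit x = begin
      x                              ≡⟨ ℚ.*-identityˡ x ⟨
      1ℚ * x                         ≡⟨ cong (_* x) (/-*-cancel (+ 1) d) ⟨
      ℕ→ℚ d * ((+ 1) / d) * x        ≡⟨ cong (_* x) (ℚ.*-comm (ℕ→ℚ d) ((+ 1) / d)) ⟩
      (+ 1) / d * ℕ→ℚ d * x          ≡⟨ ℚ.*-assoc ((+ 1) / d) (ℕ→ℚ d) x ⟩
      (+ 1) / d * (ℕ→ℚ d * x)        ∎

  Σ-last : ∀ n f → Σℚ[< suc n ] f ≡ Σℚ[< n ] f + f n
  Σ-last n f = begin
    sumℚ (map f (upTo (suc n)))               ≡⟨ cong (sumℚ ∘ map f) (upTo-∷ʳ n) ⟨
    sumℚ (map f (upTo n ++ n ∷ []))           ≡⟨ cong sumℚ (map-++ f (upTo n) (n ∷ [])) ⟩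
    sumℚ (map f (upTo n) ++ f n ∷ [])         ≡⟨ sum-++ (map f (upTo n)) (f n) ⟩
    sumℚ (map f (upTo n)) + f n               ∎
    where
    sum-++ : ∀ xs y → sumℚ (xs ++ y ∷ []) ≡ sumℚ xs + y
    sum-++ []       y = ℚ.+-comm y 0ℚ
    sum-++ (x ∷ xs) y = trans (cong (λ z → x + z) (sum-++ xs y)) (sym (ℚ.+-assoc x (sumℚ xs) y))

  Σ-scale : ∀ c {f g} → (∀ k → f k ≡ c * g k) → ∀ n → Σℚ[< n ] f ≡ c * Σℚ[< n ] g
  Σ-scale c eq zero = sym (ℚ.*-zeroʳ c)
  Σ-scale c {f} {g} eq (suc n) = begin
    Σℚ[< suc n ] f             ≡⟨ Σ-last n f ⟩
    Σℚ[< n ] f + f n           ≡⟨ cong₂ _+_ (Σ-scale c eq n) (eq n) ⟩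
    c * Σℚ[< n ] g + c * g n   ≡⟨ ℚ.*-distribˡ-+ c (Σℚ[< n ] g) (g n) ⟨
    c * (Σℚ[< n ] g + g n)     ≡⟨ cong (c *_) (Σ-last n g) ⟨
    c * Σℚ[< suc n ] g         ∎

  -- Reduces an equation that follows from a hypothesis `l ≡ r` to a polynomial identity with
  -- cofactor `c`.
  by-combination : ∀ {x y l r} c → l ≡ r → x - y ≡ c * (l - r) → x ≡ y
  by-combination {x} {y} {l} c refl eq = begin
    x                     ≡⟨ split x y ⟩
    (x - y) + y           ≡⟨ cong (_+ y) eq ⟩
    c * (l - l) + y       ≡⟨ zero-term c l y ⟩
    y                     ∎
    where
    split : ∀ x y → x ≡ (x - y) + y
    split = solve-∀-in ℚ-ring
    zero-term : ∀ c l y → c * (l - l) + y ≡ y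
    zero-term = solve-∀-in ℚ-ring

open RationalArithmetic

-- Exact telescoping identities for sums of cubed binomial coefficients.

module BinomialIdentities where
  open ≡-Reasoning

  ℕ→ℚ-suc : ∀ k → ℕ→ℚ (suc k) ≡ ℕ→ℚ k + 1ℚ
  ℕ→ℚ-suc k = trans (ℕ→ℚ-+ 1 k) (ℚ.+-comm 1ℚ (ℕ→ℚ k))

  binomℚ-suc : ∀ a k → ℕ→ℚ (suc k) * binomℚ a (suc k) ≡ (a - ℕ→ℚ k) * binomℚ a k
  binomℚ-suc a k = begin
    ℕ→ℚ (suc k) * (falling a k * (a - ℕ→ℚ k) * i₁)         ≡⟨ regroup (ℕ→ℚ (suc k)) (falling a k) (a - ℕ→ℚ k) i₁ ⟩
    (a - ℕ→ℚ k) * (falling a k * (ℕ→ℚ (suc k) * i₁))       ≡⟨ cong (λ z → (a - ℕ→ℚ k) * (falling a k * z)) inverse ⟩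
    (a - ℕ→ℚ k) * (falling a k * i₀)                       ∎
    where
    instance
      k!≢0 = k ℕ.!≢0
      [1+k]!≢0 = suc k ℕ.!≢0
    i₀ i₁ : ℚ
    i₀ = (+ 1) / (k ℕ.!)
    i₁ = (+ 1) / (suc k ℕ.!)
    regroup : ∀ s f d i → s * (f * d * i) ≡ d * (f * (s * i))
    regroup = solve-∀-in ℚ-ring
    inverse : ℕ→ℚ (suc k) * i₁ ≡ i₀
    inverse = ℕ→ℚ-cancel (k ℕ.!) (begin
      ℕ→ℚ (k ℕ.!) * (ℕ→ℚ (suc k) * i₁)       ≡⟨ swap (ℕ→ℚ (k ℕ.!)) (ℕ→ℚ (suc k)) i₁ ⟩
      ℕ→ℚ (suc k) * ℕ→ℚ (k ℕ.!) * i₁         ≡⟨ cong (_* i₁) (ℕ→ℚ-* (suc k) (k ℕ.!)) ⟨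
      ℕ→ℚ (suc k ℕ.!) * i₁                   ≡⟨ /-*-cancel (+ 1) (suc k ℕ.!) ⟩
      1ℚ                                     ≡⟨ /-*-cancel (+ 1) (k ℕ.!) ⟨
      ℕ→ℚ (k ℕ.!) * i₀                       ∎)
      where
      swap : ∀ x y z → x * (y * z) ≡ y * x * z
      swap = solve-∀-in ℚ-ring

  binomℚ-absorption : ∀ a k → ℕ→ℚ (suc k) * binomℚ a (suc k) ≡ a * binomℚ (a - 1ℚ) k
  binomℚ-absorption a zero    = trans (binomℚ-suc a 0) (lemma a)
    where
    lemma : ∀ a → (a - 0ℚ) * (1ℚ * 1ℚ) ≡ a * (1ℚ * 1ℚ)
    lemma = solve-∀-in ℚ-ring
  binomℚ-absorption a (suc k) = ℕ→ℚ-cancel (suc k) (begin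
    K * (ℕ→ℚ (suc (suc k)) * binomℚ a (suc (suc k)))       ≡⟨ cong (K *_) (binomℚ-suc a (suc k)) ⟩
    K * ((a - K) * binomℚ a (suc k))                       ≡⟨ swap₁ K (a - K) (binomℚ a (suc k)) ⟩
    (a - K) * (K * binomℚ a (suc k))                       ≡⟨ cong₂
        (λ u v → (a - u) * v) (ℕ→ℚ-suc k) (binomℚ-absorption a k) ⟩
    (a - (ℕ→ℚ k + 1ℚ)) * (a * binomℚ (a - 1ℚ) k)           ≡⟨ swap₂ a (ℕ→ℚ k) (binomℚ (a - 1ℚ) k) ⟩
    a * ((a - 1ℚ - ℕ→ℚ k) * binomℚ (a - 1ℚ) k)             ≡⟨ cong (a *_) (binomℚ-suc (a - 1ℚ) k) ⟨
    a * (K * binomℚ (a - 1ℚ) (suc k))                      ≡⟨ swap₁ a K (binomℚ (a - 1ℚ) (suc k)) ⟩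
    K * (a * binomℚ (a - 1ℚ) (suc k))                      ∎)
    where
    K : ℚ
    K = ℕ→ℚ (suc k)
    swap₁ : ∀ x y z → x * (y * z) ≡ y * (x * z)
    swap₁ = solve-∀-in ℚ-ring
    swap₂ : ∀ a k c → (a - (k + 1ℚ)) * (a * c) ≡ a * ((a - 1ℚ - k) * c)
    swap₂ = solve-∀-in ℚ-ring

  binomℚ-pascal : ∀ a k → binomℚ a (suc k) ≡ binomℚ (a - 1ℚ) k + binomℚ (a - 1ℚ) (suc k)
  binomℚ-pascal a k = ℕ→ℚ-cancel (suc k) (begin
    ℕ→ℚ (suc k) * binomℚ a (suc k)                ≡⟨ binomℚ-absorption a k ⟩
    a * u                                         ≡⟨ split a (ℕ→ℚ k) u ⟩
    (ℕ→ℚ k + 1ℚ) * u + (a - 1ℚ - ℕ→ℚ k) * u       ≡⟨ cong₂ (λ s t → s * u + t) (ℕ→ℚ-suc k) (binomℚ-suc (a - 1ℚ) k) ⟨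
    ℕ→ℚ (suc k) * u + ℕ→ℚ (suc k) * v             ≡⟨ ℚ.*-distribˡ-+ (ℕ→ℚ (suc k)) u v ⟨
    ℕ→ℚ (suc k) * (u + v)                         ∎)
    where
    u v : ℚ
    u = binomℚ (a - 1ℚ) k
    v = binomℚ (a - 1ℚ) (suc k)
    split : ∀ a k u → a * u ≡ (k + 1ℚ) * u + (a - 1ℚ - k) * u
    split = solve-∀-in ℚ-ring

  -- Both sides equal (k + 1) C(a, k + 1). The upper argument moves while the lower one stays fixed,
  -- as the descent in a requires.
  binomℚ-upShift : ∀ a k → (a - ℕ→ℚ k) * binomℚ a k ≡ a * binomℚ (a - 1ℚ) k
  binomℚ-upShift a k = trans (sym (binomℚ-suc a k)) (binomℚ-absorption a k)

  S S³ : ℕ → ℚ → ℚ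
  S  n a = Σℚ[< n ] (λ k → (ℕ→ℚ 2 * ℕ→ℚ k - a) * binomℚ a k ^ℚ 3)
  S³ n a = Σℚ[< n ] (λ k → (ℕ→ℚ 2 * ℕ→ℚ k - a) ^ℚ 3 * binomℚ a k ^ℚ 3)

  S-last : ∀ n a → S (suc n) a ≡ S n a + (ℕ→ℚ 2 * ℕ→ℚ n - a) * binomℚ a n ^ℚ 3
  S-last n a = Σ-last n (λ k → (ℕ→ℚ 2 * ℕ→ℚ k - a) * binomℚ a k ^ℚ 3)

  -- With x = k and y = a - k one has 2k - a = x - y and a = x + y, and (x - y)³ + 3 (x + y)² (x -
  -- y) = 4 (x³ - y³). As (a - k) C(a, k) = (k + 1) C(a, k + 1), the sum over k telescopes.
  S³-S : ∀ n a → S³ n a + ℕ→ℚ 3 * (a * a) * S n a ≡ - (ℕ→ℚ 4) * (ℕ→ℚ n * binomℚ a n) ^ℚ 3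
  S³-S zero    a = lemma a (binomℚ a 0)
    where
    lemma : ∀ a b → 0ℚ + ℕ→ℚ 3 * (a * a) * 0ℚ ≡ - (ℕ→ℚ 4) * ((ℕ→ℚ 0 * b) * ((ℕ→ℚ 0 * b) * ((ℕ→ℚ 0 * b) * 1ℚ)))
    lemma = solve-∀-in ℚ-ring
  S³-S (suc n) a = begin
    S³ (suc n) a + ℕ→ℚ 3 * (a * a) * S (suc n) a
      ≡⟨ cong₂ (λ u v → u + ℕ→ℚ 3 * (a * a) * v) (Σ-last n (λ k → (ℕ→ℚ 2 * ℕ→ℚ k - a) ^ℚ 3 * binomℚ a k ^ℚ 3)) (S-last n a) ⟩
    S³ n a + (ℕ→ℚ 2 * k - a) ^ℚ 3 * c ^ℚ 3 + ℕ→ℚ 3 * (a * a) * (S n a + (ℕ→ℚ 2 * k - a) * c ^ℚ 3)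
      ≡⟨ lemma (S³ n a) (S n a) a k c ⟩
    S³ n a + ℕ→ℚ 3 * (a * a) * S n a + (ℕ→ℚ 4 * (k * c) ^ℚ 3 - ℕ→ℚ 4 * ((a - k) * c) ^ℚ 3)
      ≡⟨ cong₂ (λ u v → u + (ℕ→ℚ 4 * (k * c) ^ℚ 3 - ℕ→ℚ 4 * v ^ℚ 3)) (S³-S n a) (sym (binomℚ-suc a n)) ⟩
    - (ℕ→ℚ 4) * (k * c) ^ℚ 3 + (ℕ→ℚ 4 * (k * c) ^ℚ 3 - ℕ→ℚ 4 * (ℕ→ℚ (suc n) * binomℚ a (suc n)) ^ℚ 3)
      ≡⟨ collapse ((k * c) ^ℚ 3) ((ℕ→ℚ (suc n) * binomℚ a (suc n)) ^ℚ 3) ⟩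
    - (ℕ→ℚ 4) * (ℕ→ℚ (suc n) * binomℚ a (suc n)) ^ℚ 3 ∎
    where
    k c : ℚ
    k = ℕ→ℚ n
    c = binomℚ a n
    lemma : ∀ s t a k c → s + (ℕ→ℚ 2 * k - a) * ((ℕ→ℚ 2 * k - a) * ((ℕ→ℚ 2 * k - a) * 1ℚ)) * (c * (c * (c * 1ℚ)))
                            + ℕ→ℚ 3 * (a * a) * (t + (ℕ→ℚ 2 * k - a) * (c * (c * (c * 1ℚ))))
                        ≡ s + ℕ→ℚ 3 * (a * a) * t + (ℕ→ℚ 4 * ((k * c) * ((k * c) * ((k * c) * 1ℚ)))
                            - ℕ→ℚ 4 * (((a - k) * c) * (((a - k) * c) * (((a - k) * c) * 1ℚ))))
    lemma = solve-∀-in ℚ-ring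
    collapse : ∀ x y → - (ℕ→ℚ 4) * x + (ℕ→ℚ 4 * x - ℕ→ℚ 4 * y) ≡ - (ℕ→ℚ 4) * y
    collapse = solve-∀-in ℚ-ring

  -- The closed form is verified by induction on n. With u = C(a - 1, k - 1) and v = C(a - 1, k),
  -- Pascal gives C(a, k) = u + v, and the increments match by means of kv = (a - k)u.
  S-shift : ∀ n a → S (suc n) a + S (suc n) (a - 1ℚ) ≡ (ℕ→ℚ (suc n) - ℕ→ℚ 2 * a) * binomℚ (a - 1ℚ) n ^ℚ 3
  S-shift zero    a = lemma a
    where
    lemma : ∀ a → (ℕ→ℚ 2 * ℕ→ℚ 0 - a) * (ℕ→ℚ 1 * (ℕ→ℚ 1 * (ℕ→ℚ 1 * 1ℚ))) + 0ℚ
                + ((ℕ→ℚ 2 * ℕ→ℚ 0 - (a - 1ℚ)) * (ℕ→ℚ 1 * (ℕ→ℚ 1 * (ℕ→ℚ 1 * 1ℚ))) + 0ℚ)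
                ≡ (ℕ→ℚ 1 - ℕ→ℚ 2 * a) * (ℕ→ℚ 1 * (ℕ→ℚ 1 * (ℕ→ℚ 1 * 1ℚ)))
    lemma = solve-∀-in ℚ-ring
  S-shift (suc n) a = begin
    S (suc k′) a + S (suc k′) (a - 1ℚ)
      ≡⟨ cong₂ _+_ (S-last k′ a) (S-last k′ (a - 1ℚ)) ⟩
    S k′ a + (ℕ→ℚ 2 * k - a) * binomℚ a k′ ^ℚ 3 + (S k′ (a - 1ℚ) + (ℕ→ℚ 2 * k - (a - 1ℚ)) * v ^ℚ 3)
      ≡⟨ cong (λ z → S k′ a + (ℕ→ℚ 2 * k - a) * z ^ℚ 3 + (S k′ (a - 1ℚ) + (ℕ→ℚ 2 * k - (a - 1ℚ)) * v ^ℚ 3))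
          (binomℚ-pascal a n) ⟩
    S k′ a + (ℕ→ℚ 2 * k - a) * (u + v) ^ℚ 3 + (S k′ (a - 1ℚ) + (ℕ→ℚ 2 * k - (a - 1ℚ)) * v ^ℚ 3)
      ≡⟨ regroup (S k′ a) (S k′ (a - 1ℚ)) ((ℕ→ℚ 2 * k - a) * (u + v) ^ℚ 3) ((ℕ→ℚ 2 * k - (a - 1ℚ)) * v ^ℚ 3) ⟩
    S k′ a + S k′ (a - 1ℚ) + ((ℕ→ℚ 2 * k - a) * (u + v) ^ℚ 3 + (ℕ→ℚ 2 * k - (a - 1ℚ)) * v ^ℚ 3)
      -- The cofactor is the quotient of the difference of the two increments, a polynomial in a, k,
      -- u, v, by kv - (a - k)u.
      ≡⟨ cong₂ _+_ (S-shift n a) (by-combination (ℕ→ℚ 3 * (u * u + u * v + v * v)) ratio (identity a k u v)) ⟩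
    (k - ℕ→ℚ 2 * a) * u ^ℚ 3 + ((k + 1ℚ - ℕ→ℚ 2 * a) * v ^ℚ 3 - (k - ℕ→ℚ 2 * a) * u ^ℚ 3)
      ≡⟨ cancel ((k - ℕ→ℚ 2 * a) * u ^ℚ 3) ((k + 1ℚ - ℕ→ℚ 2 * a) * v ^ℚ 3) ⟩
    (k + 1ℚ - ℕ→ℚ 2 * a) * v ^ℚ 3
      ≡⟨ cong (λ z → (z - ℕ→ℚ 2 * a) * v ^ℚ 3) (ℕ→ℚ-suc k′) ⟨
    (ℕ→ℚ (suc k′) - ℕ→ℚ 2 * a) * v ^ℚ 3 ∎
    where
    k′ : ℕ
    k′ = suc n
    k u v : ℚ
    k = ℕ→ℚ k′
    u = binomℚ (a - 1ℚ) n
    v = binomℚ (a - 1ℚ) k′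
    regroup : ∀ w x y z → w + y + (x + z) ≡ w + x + (y + z)
    regroup = solve-∀-in ℚ-ring
    cancel : ∀ x y → x + (y - x) ≡ y
    cancel = solve-∀-in ℚ-ring
    shift : ∀ a n u → (a - 1ℚ - n) * u ≡ (a - (n + 1ℚ)) * u
    shift = solve-∀-in ℚ-ring
    ratio : k * v ≡ (a - k) * u
    ratio = trans (binomℚ-suc (a - 1ℚ) n) (trans (shift a (ℕ→ℚ n) u) (cong (λ z → (a - z) * u) (sym (ℕ→ℚ-suc n))))
    identity : ∀ a k u v →
      (ℕ→ℚ 2 * k - a) * ((u + v) * ((u + v) * ((u + v) * 1ℚ))) + (ℕ→ℚ 2 * k - (a - 1ℚ)) * (v * (v * (v * 1ℚ)))
      - ((k + 1ℚ - ℕ→ℚ 2 * a) * (v * (v * (v * 1ℚ))) - (k - ℕ→ℚ 2 * a) * (u * (u * (u * 1ℚ))))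
      ≡ ℕ→ℚ 3 * (u * u + u * v + v * v) * (k * v - (a - k) * u)
    identity = solve-∀-in ℚ-ring

open BinomialIdentities

-- The p-integral rationals and the ideals generated by powers of p.

module Localisation (p : ℕ) (prime : Prime p) where

  record Integral (r : ℚ) : Set where
    constructor integral
    field
      coprime : Coprime (↧ₙ r) p

  private
    ∤⇒coprime : ∀ {d} → ¬ p ℕ.∣ d → Coprime d p
    ∤⇒coprime p∤d (k∣d , k∣p) with prime⇒irreducible prime k∣p
    ... | inj₁ k≡1  = k≡1
    ... | inj₂ refl = ⊥-elim (p∤d k∣d)

    coprime⇒∤ : ∀ {d} → Coprime d p → ¬ p ℕ.∣ d
    coprime⇒∤ c p∣d = ℕ.nonTrivial⇒≢1 {{prime⇒nonTrivial prime}} (c (p∣d , ℕ.∣-refl))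

    ∤-* : ∀ {d e} → ¬ p ℕ.∣ d → ¬ p ℕ.∣ e → ¬ p ℕ.∣ d ℕ.* e
    ∤-* {d} {e} p∤d p∤e p∣de with euclidsLemma d e prime p∣de
    ... | inj₁ p∣d = p∤d p∣d
    ... | inj₂ p∣e = p∤e p∣e

  integral-/ : ∀ z d .{{_ : ℕ.NonZero d}} → ¬ p ℕ.∣ d → Integral (z / d)
  integral-/ z d p∤d = integral (∤⇒coprime λ p∣↧ → p∤d (ℕ.∣-trans p∣↧ ↧∣d))
    where
    ↧∣d : ↧ₙ (z / d) ℕ.∣ d
    ↧∣d = ℕ.divides ℤ.∣ gcd[z,d] ∣ (trans (sym (trans (sym (ℤₚ.abs-* (↧ (z / d)) gcd[z,d])) (cong ℤ.∣_∣ (ℚ.↧-/ z d))))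
                                          (ℕ.*-comm (↧ₙ (z / d)) ℤ.∣ gcd[z,d] ∣))
      where
      gcd[z,d] : ℤ
      gcd[z,d] = gcd z (+ d)

  integral-ℤ : ∀ z → Integral (ℤ→ℚ z)
  integral-ℤ z = integral-/ z 1 λ p∣1 → ℕ.nonTrivial⇒≢1 {{prime⇒nonTrivial prime}} (ℕ.∣1⇒≡1 p∣1)

  integral-ℕ : ∀ k → Integral (ℕ→ℚ k)
  integral-ℕ k = integral-ℤ (+ k)

  integral-+ : ∀ {x y} → Integral x → Integral y → Integral (x + y)
  integral-+ {mkℚ a b _} {mkℚ c d _} (integral ix) (integral iy) = integral-/ (a ℤ.* + suc d ℤ.+ c ℤ.* + suc b)
      (suc b ℕ.* suc d) (∤-* (coprime⇒∤ ix) (coprime⇒∤ iy))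

  integral-* : ∀ {x y} → Integral x → Integral y → Integral (x * y)
  integral-* {mkℚ a b _} {mkℚ c d _} (integral ix) (integral iy) = integral-/ (a ℤ.* c) (suc b ℕ.* suc d) (∤-*
      (coprime⇒∤ ix) (coprime⇒∤ iy))

  integral-neg : ∀ {x} → Integral x → Integral (- x)
  integral-neg {x} ix = subst Integral (lemma x) (integral-* (integral-ℤ (ℤ.- + 1)) ix)
    where
    lemma : ∀ x → ℤ→ℚ (ℤ.- + 1) * x ≡ - x
    lemma = solve-∀-in ℚ-ring

  integral-- : ∀ {x y} → Integral x → Integral y → Integral (x - y)
  integral-- ix iy = integral-+ ix (integral-neg iy)

  P : ℚ
  P = ℕ→ℚ p

  integral-^ : ∀ {x} n → Integral x → Integral (x ^ℚ n)
  integral-^ zero    ix = integral-ℕ 1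
  integral-^ (suc n) ix = integral-* ix (integral-^ n ix)

  -- Membership in the ideal (pⁿ) of the local ring; congruences are treated as memberships of
  -- differences.
  record Mod (n : ℕ) (x : ℚ) : Set where
    constructor multiple
    field
      quotient : ℚ
      quotient-integral : Integral quotient
      equality : x ≡ P ^ℚ n * quotient

  Mod-resp : ∀ {n x y} → x ≡ y → Mod n x → Mod n y
  Mod-resp = subst (Mod _)

  Mod-+ : ∀ {n x y} → Mod n x → Mod n y → Mod n (x + y)
  Mod-+ {n} (multiple q iq refl) (multiple r ir refl) = multiple (q + r) (integral-+ iq ir) (sym (ℚ.*-distribˡ-+
      (P ^ℚ n) q r))

  Mod-scale : ∀ {n x c} → Integral c → Mod n x → Mod n (c * x)
  Mod-scale {n} {c = c} ic (multiple q iq refl) = multiple (c * q) (integral-* ic iq) (swap c (P ^ℚ n) q)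
    where
    swap : ∀ c u q → c * (u * q) ≡ u * (c * q)
    swap = solve-∀-in ℚ-ring

  Mod-neg : ∀ {n x} → Mod n x → Mod n (- x)
  Mod-neg {n} (multiple q iq refl) = multiple (- q) (integral-neg iq) (ℚ.neg-distribʳ-* (P ^ℚ n) q)

  Mod-- : ∀ {n x y} → Mod n x → Mod n y → Mod n (x - y)
  Mod-- mx my = Mod-+ mx (Mod-neg my)

  ^ℚ-+ : ∀ x m n → x ^ℚ (m ℕ.+ n) ≡ x ^ℚ m * x ^ℚ n
  ^ℚ-+ x zero    n = sym (ℚ.*-identityˡ (x ^ℚ n))
  ^ℚ-+ x (suc m) n = trans (cong (x *_) (^ℚ-+ x m n)) (sym (ℚ.*-assoc x (x ^ℚ m) (x ^ℚ n)))

  Mod-* : ∀ {m n x y} → Mod m x → Mod n y → Mod (m ℕ.+ n) (x * y)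
  Mod-* {m} {n} (multiple q iq refl) (multiple r ir refl) = multiple (q * r) (integral-* iq ir)
    (trans (swap (P ^ℚ m) (P ^ℚ n) q r) (cong (_* (q * r)) (sym (^ℚ-+ P m n))))
    where
    swap : ∀ u v q r → u * q * (v * r) ≡ u * v * (q * r)
    swap = solve-∀-in ℚ-ring

  Mod-cube : ∀ {x} → Mod 1 x → Mod 3 (x ^ℚ 3)
  Mod-cube mx = Mod-* mx (Mod-* mx (Mod-* mx (multiple {0} 1ℚ (integral-ℕ 1) refl)))

  Mod-P* : ∀ {x} → Integral x → Mod 1 (P * x)
  Mod-P* {x} ix = multiple x ix (cong (_* x) (sym (ℚ.*-identityʳ P)))

  Mod⇒integral : ∀ {n x} → Mod n x → Integral x
  Mod⇒integral {n} (multiple q iq refl) = integral-* (integral-^ n (integral-ℕ p)) iq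

  Mod-by : ∀ {n x y l r} c → l ≡ r → x - y ≡ c * (l - r) → Mod n y → Mod n x
  Mod-by c l≡r eq = Mod-resp (sym (by-combination c l≡r eq))

  unit-cancel : ∀ j .{{_ : ℕ.NonZero j}} x → x ≡ (+ 1) / j * (ℕ→ℚ j * x)
  unit-cancel j x = trans (sym (ℚ.*-identityˡ x)) (trans (cong (_* x) (sym (/-*-cancel (+ 1) j)))
    (lemma (ℕ→ℚ j) ((+ 1) / j) x))
    where
    lemma : ∀ a b c → a * b * c ≡ b * (a * c)
    lemma = solve-∀-in ℚ-ring

  Mod-cancel : ∀ {n x} j .{{_ : ℕ.NonZero j}} → ¬ p ℕ.∣ j → Mod n (ℕ→ℚ j * x) → Mod n x
  Mod-cancel {x = x} j p∤j mjx = Mod-resp (sym (unit-cancel j x)) (Mod-scale (integral-/ (+ 1) j p∤j) mjx)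

  integral-cancel : ∀ {x} j .{{_ : ℕ.NonZero j}} → ¬ p ℕ.∣ j → Integral (ℕ→ℚ j * x) → Integral x
  integral-cancel {x} j p∤j ijx = subst Integral (sym (unit-cancel j x)) (integral-* (integral-/ (+ 1) j p∤j) ijx)

  -- In (k + 1) C(a, k + 1) = (a - k) C(a, k) the divisor k + 1 stays prime to p as long as it is
  -- below p.
  integral-binomℚ : ∀ {a} → Integral a → ∀ k → k < p → Integral (binomℚ a k)
  integral-binomℚ     ia zero    _     = integral-ℕ 1
  integral-binomℚ {a} ia (suc k) k+1<p = integral-cancel (suc k) (ℕ.>⇒∤ k+1<p)
    (subst Integral (sym (binomℚ-suc a k)) (integral-* (integral-- ia (integral-ℕ k)) (integral-binomℚ ia k
        (ℕ.<-trans (ℕ.n<1+n k) k+1<p))))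

  open Modulo p using (_≈_; congruent)

  ≈⇒Mod : ∀ {x y} → x ≈ y → Mod 1 (ℤ→ℚ x - ℤ→ℚ y)
  ≈⇒Mod {x} {y} (congruent q refl) = Mod-resp (sym (begin
    ℤ→ℚ (y ℤ.+ q ℤ.* + p) - ℤ→ℚ y         ≡⟨ cong (_- ℤ→ℚ y)
        (trans (ℤ→ℚ-+ y (q ℤ.* + p)) (cong (λ z → ℤ→ℚ y + z) (ℤ→ℚ-* q (+ p)))) ⟩
    ℤ→ℚ y + ℤ→ℚ q * P - ℤ→ℚ y             ≡⟨ lemma (ℤ→ℚ y) (ℤ→ℚ q) P ⟩
    P * ℤ→ℚ q                             ∎)) (Mod-P* (integral-ℤ q))
    where
    open ≡-Reasoning
    lemma : ∀ y q p → y + q * p - y ≡ p * q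
    lemma = solve-∀-in ℚ-ring

  -- With `W` in the role of 1 / j²: (jc)³ - y³ gains p² from jc - y and p² from the quadratic
  -- cofactor, while c³ is divisible by p³, so an error of one factor p in `W` is harmless modulo
  -- p⁴.
  Mod-cube-quotient : ∀ {j c y W} → Integral j → Integral W → Mod 1 c → Mod 1 y → Mod 2 (j * c - y) → Mod 1
      (j * j * W - 1ℚ) →
                      Mod 4 (j * c ^ℚ 3 - y ^ℚ 3 * W)
  Mod-cube-quotient {j} {c} {y} {W} ij iW mc my mjc-y mW = Mod-resp (sym (identity j c y W))
    (Mod-- (Mod-scale iW (Mod-* mjc-y (Mod-+ (Mod-+ (Mod-* mjc mjc) (Mod-* mjc my)) (Mod-* my my))))
           (Mod-scale ij (Mod-* (Mod-* mc (Mod-* mc mc)) mW)))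
    where
    mjc : Mod 1 (j * c)
    mjc = Mod-scale ij mc
    identity : ∀ j c y W → j * (c * (c * (c * 1ℚ))) - (y * (y * (y * 1ℚ))) * W ≡
      W * ((j * c - y) * ((j * c) * (j * c) + (j * c) * y + y * y)) - j * ((c * (c * c)) * (j * j * W - 1ℚ))
    identity = solve-∀-in ℚ-ring

-- Evaluation of the two sums modulo p⁴ at a = pt + j.

module Supercongruence (m : ℕ) (prime : Prime (5 ℕ.+ m ℕ.* 2)) where
  open EulerCongruences m prime using (p; n; A; inverse-square; Pow-via-A)
  open Localisation p prime
  open Modulo p using (congruent; ≈-trans; ≡⇒≈; Appell-cong)

  Â : ℤ → ℚ
  Â x = ℤ→ℚ (A x)

  -- k^(p-3), an integer replacement for 1 / k² modulo p.
  W : ℕ → ℚ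
  W k = ℤ→ℚ (Pow (+ k) n)

  sgn : ℕ → ℚ
  sgn k = (- 1ℚ) ^ℚ k

  q : ℕ
  q = 4 ℕ.+ m ℕ.* 2

  oddℤ : ℕ → ℤ
  oddℤ i = + 2 ℤ.* + i ℤ.+ + 1

  sgn² : ∀ k → sgn k * sgn k ≡ 1ℚ
  sgn² zero    = refl
  sgn² (suc k) = trans (lemma (sgn k)) (sgn² k)
    where
    lemma : ∀ s → (- 1ℚ * s) * (- 1ℚ * s) ≡ s * s
    lemma = solve-∀-in ℚ-ring

  integral-sgn : ∀ k → Integral (sgn k)
  integral-sgn k = integral-^ k (integral-neg (integral-ℕ 1))

  W-inverse-square : ∀ k → suc k < p → Mod 1 (ℕ→ℚ (suc k) * ℕ→ℚ (suc k) * W (suc k) - 1ℚ)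
  W-inverse-square k k<p = Mod-resp (cong (_- 1ℚ) (trans (ℤ→ℚ-* (+ suc k ℤ.* + suc k) (Pow (+ suc k) n))
      (cong (_* W (suc k)) (ℤ→ℚ-* (+ suc k) (+ suc k)))))
    (≈⇒Mod (inverse-square (ℕ.>⇒∤ k<p)))

  odd-suc : ∀ i → + 2 ℤ.* + suc i ℤ.- + 1 ≡ oddℤ i
  odd-suc i = trans (cong (λ z → + 2 ℤ.* z ℤ.- + 1) (ℤₚ.pos-+ 1 i)) (lemma (+ i))
    where
    lemma : ∀ i → + 2 ℤ.* (+ 1 ℤ.+ i) ℤ.- + 1 ≡ + 2 ℤ.* i ℤ.+ + 1
    lemma = ℤS.solve-∀

  W-via-Â : ∀ i → Mod 1 (W (suc i) - ℕ→ℚ 2 * (Â (oddℤ (suc i)) + Â (oddℤ i)))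
  W-via-Â i = Mod-resp (cong (λ z → W (suc i) - z) (trans (ℤ→ℚ-* (+ 2) (A (oddℤ (suc i)) ℤ.+ A
      (+ 2 ℤ.* + suc i ℤ.- + 1))) (cong (ℕ→ℚ 2 *_) (trans (ℤ→ℚ-+ (A (oddℤ (suc i))) (A (+ 2 ℤ.* + suc i ℤ.- + 1)))
      (cong (λ z → Â (oddℤ (suc i)) + Â z) (odd-suc i))))))
    (≈⇒Mod (Pow-via-A (+ suc i)))

  Â-1≡0 : Â (oddℤ 0) ≡ 0ℚ
  Â-1≡0 = cong ℤ→ℚ (Euler-Appell-1 m)

  sgn-odd : ∀ k → sgn (suc (k ℕ.* 2)) ≡ - 1ℚ
  sgn-odd zero    = refl
  sgn-odd (suc k) = trans (lemma (sgn (suc (k ℕ.* 2)))) (sgn-odd k)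
    where
    lemma : ∀ s → - 1ℚ * (- 1ℚ * s) ≡ s
    lemma = solve-∀-in ℚ-ring

  module _ {t : ℚ} (integral-t : Integral t) where

    y : ℚ
    y = P * t

    Mod-y : Mod 1 y
    Mod-y = Mod-P* integral-t

    integral-y : Integral y
    integral-y = Mod⇒integral Mod-y

    Mod-y³ : Mod 3 (y ^ℚ 3)
    Mod-y³ = Mod-cube Mod-y

    Mod-P : Mod 1 P
    Mod-P = Mod-resp (ℚ.*-identityʳ P) (Mod-P* (integral-ℕ 1))

    q≡P-1 : ℕ→ℚ q ≡ P - 1ℚ
    q≡P-1 = trans (lemma (ℕ→ℚ q)) (cong (_- 1ℚ) (sym (ℕ→ℚ-suc q)))
      where
      lemma : ∀ x → x ≡ x + 1ℚ - 1ℚ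
      lemma = solve-∀-in ℚ-ring

    y+[1+i]-1 : ∀ i → y + ℕ→ℚ (suc i) - 1ℚ ≡ y + ℕ→ℚ i
    y+[1+i]-1 i = trans (cong (λ z → y + z - 1ℚ) (ℕ→ℚ-suc i)) (lemma y (ℕ→ℚ i))
      where
      lemma : ∀ y i → y + (i + 1ℚ) - 1ℚ ≡ y + i
      lemma = solve-∀-in ℚ-ring

    -- C(y - 1, k) is the product of the factors (y - i)/i for i from 1 to k, each ≡ -1 because p
    -- divides y.
    binomℚ-y-1 : ∀ k → k < p → Mod 1 (binomℚ (y - 1ℚ) k - sgn k)
    binomℚ-y-1 zero    _     = multiple 0ℚ (integral-ℕ 0) (sym (ℚ.*-zeroʳ (P ^ℚ 1)))
    binomℚ-y-1 (suc k) k+1<p = Mod-cancel (suc k) (ℕ.>⇒∤ k+1<p)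
      (Mod-by 1ℚ relation (identity (ℕ→ℚ (suc k)) P t β β⁺ (sgn k))
        (Mod-- (Mod-P* (integral-* integral-t (integral-binomℚ (integral-- integral-y (integral-ℕ 1)) k k<p)))
               (Mod-scale (integral-ℕ (suc k)) (binomℚ-y-1 k k<p))))
      where
      k<p : k < p
      k<p = ℕ.<-trans (ℕ.n<1+n k) k+1<p
      β β⁺ : ℚ
      β  = binomℚ (y - 1ℚ) k
      β⁺ = binomℚ (y - 1ℚ) (suc k)
      relation : ℕ→ℚ (suc k) * β⁺ ≡ (y - ℕ→ℚ (suc k)) * β
      relation = trans (binomℚ-suc (y - 1ℚ) k) (trans (shift y (ℕ→ℚ k) β) (cong (λ z → (y - z) * β) (sym (ℕ→ℚ-suc k))))
        where
        shift : ∀ y k c → (y - 1ℚ - k) * c ≡ (y - (k + 1ℚ)) * c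
        shift = solve-∀-in ℚ-ring
      identity : ∀ K P t β β⁺ s → K * (β⁺ - - 1ℚ * s) - (P * (t * β) - K * (β - s)) ≡ 1ℚ * (K * β⁺ - (P * t - K) * β)
      identity = solve-∀-in ℚ-ring

    -- `mod₁` is kept beside `mod₂` because divisibility of the coefficient by p is what makes the
    -- correction terms, which carry a factor p already, vanish modulo p².
    record Residue (i : ℕ) (x : ℚ) : Set where
      constructor residue
      field
        mod₁ : Mod 1 (binomℚ x q)
        mod₂ : Mod 2 (ℕ→ℚ (suc i) * binomℚ x q - y)

    -- Induction on i along (x - (p - 1)) C(x, p - 1) = x C(x - 1, p - 1) at x = y + i + 1, which
    -- modulo p² says that (i + 1) C(y + i, p - 1) does not depend on i. The start is (p - 1) C(y, p
    -- - 1) = y C(y - 1, p - 2).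
    binomℚ-residue : ∀ i → i < q → Residue i (y + ℕ→ℚ i)
    binomℚ-residue zero    _     = subst (Residue 0) (sym (ℚ.+-identityʳ y)) (residue mod₁
      (Mod-by (- 1ℚ) relation′ (identity P t β β⁻) (Mod-- (Mod-* Mod-P mod₁) (Mod-* Mod-P (Mod-scale integral-t Mod-β⁻)))))
      where
      q⁻ : ℕ
      q⁻ = 3 ℕ.+ m ℕ.* 2
      q⁻<p : q⁻ < p
      q⁻<p = ℕ.<-trans (ℕ.n<1+n q⁻) (ℕ.n<1+n q)
      β β⁻ : ℚ
      β  = binomℚ y q
      β⁻ = binomℚ (y - 1ℚ) q⁻
      relation : ℕ→ℚ q * β ≡ y * β⁻
      relation = binomℚ-absorption y q⁻
      relation′ : (P - 1ℚ) * β ≡ y * β⁻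
      relation′ = trans (cong (_* β) (sym q≡P-1)) relation
      mod₁ : Mod 1 β
      mod₁ = Mod-cancel q (ℕ.>⇒∤ (ℕ.n<1+n q)) (Mod-resp (trans (sym (ℚ.*-assoc P t β⁻)) (sym relation))
        (Mod-P* (integral-* integral-t (integral-binomℚ (integral-- integral-y (integral-ℕ 1)) q⁻ q⁻<p))))
      -- p - 2 is odd, so the sign (-1)^(p-2) is -1.
      Mod-β⁻ : Mod 1 (β⁻ - - 1ℚ)
      Mod-β⁻ = Mod-resp (cong (λ z → β⁻ - z) (sgn-odd (suc m))) (binomℚ-y-1 q⁻ q⁻<p)
      identity : ∀ P t β β⁻ → ℕ→ℚ 1 * β - P * t - (P * β - P * (t * (β⁻ - - 1ℚ))) ≡ - 1ℚ * ((P - 1ℚ) * β - P * t * β⁻)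
      identity = solve-∀-in ℚ-ring
    binomℚ-residue (suc i) i+1<q = residue mod₁⁺
      (Mod-by 1ℚ relation (trans (cong (λ z → z * β⁺ - y - (I * β - y + (P * (t * β) - P * ((t - 1ℚ) * β⁺))))
          (ℕ→ℚ-suc (suc i))) (identity₂ P t I β β⁺))
        (Mod-+ mod₂ (Mod-- (Mod-* Mod-P (Mod-scale integral-t mod₁)) (Mod-* Mod-P
            (Mod-scale (integral-- integral-t (integral-ℕ 1)) mod₁⁺)))))
      where
      open Residue (binomℚ-residue i (ℕ.<-trans (ℕ.n<1+n i) i+1<q))
      I β β⁺ : ℚ
      I  = ℕ→ℚ (suc i)
      β  = binomℚ (y + ℕ→ℚ i) q
      β⁺ = binomℚ (y + I) q
      relation : (y + I - (P - 1ℚ)) * β⁺ ≡ (y + I) * β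
      relation = trans (cong (λ z → (y + I - z) * β⁺) (sym q≡P-1))
          (trans (binomℚ-upShift (y + I) q) (cong (λ z → (y + I) * binomℚ z q) (y+[1+i]-1 i)))
      integral-β⁺ : Integral β⁺
      integral-β⁺ = integral-binomℚ (integral-+ integral-y (integral-ℕ (suc i))) q (ℕ.n<1+n q)
      mod₁⁺ : Mod 1 β⁺
      mod₁⁺ = Mod-cancel (suc (suc i)) (ℕ.>⇒∤ (s<s i+1<q))
        (Mod-by 1ℚ relation (trans (cong (λ z → z * β⁺ - (I * β + (P * (t * β) - P * ((t - 1ℚ) * β⁺)))) (ℕ→ℚ-suc
            (suc i))) (identity₁ P t I β β⁺))
          (Mod-+ (Mod-scale (integral-ℕ (suc i)) mod₁) (Mod-- (Mod-P* (integral-* integral-t (Mod⇒integral mod₁)))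
                 (Mod-P* (integral-* (integral-- integral-t (integral-ℕ 1)) integral-β⁺)))))
        where
        identity₁ : ∀ P t I β β⁺ → (I + 1ℚ) * β⁺ - (I * β + (P * (t * β) - P * ((t - 1ℚ) * β⁺)))
            ≡ 1ℚ * ((P * t + I - (P - 1ℚ)) * β⁺ - (P * t + I) * β)
        identity₁ = solve-∀-in ℚ-ring
      identity₂ : ∀ P t I β β⁺ → (I + 1ℚ) * β⁺ - P * t - (I * β - P * t + (P * (t * β) - P * ((t - 1ℚ) * β⁺)))
          ≡ 1ℚ * ((P * t + I - (P - 1ℚ)) * β⁺ - (P * t + I) * β)
      identity₂ = solve-∀-in ℚ-ring

    -- The terms of S p y other than the first reduce to an alternating sum of k⁻²; both it and the
    -- recursion in S-congruence are evaluated by k⁻² ≡ 2 (A (2k + 1) + A (2k - 1)).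
    S-y-partial : ∀ i → i < p → Mod 4 (S (suc i) y + y + ℕ→ℚ 4 * y ^ℚ 3 * sgn i * Â (oddℤ i))
    S-y-partial zero    _     = multiple 0ℚ (integral-ℕ 0) (trans (cong (λ z → S 1 y + y + ℕ→ℚ 4 * y ^ℚ 3 * 1ℚ * z) Â-1≡0)
                                                                  (trans (lemma y) (sym (ℚ.*-zeroʳ (P ^ℚ 4)))))
      where
      lemma : ∀ y → (ℕ→ℚ 2 * ℕ→ℚ 0 - y) * (ℕ→ℚ 1 * (ℕ→ℚ 1 * (ℕ→ℚ 1 * 1ℚ))) + 0ℚ + y + ℕ→ℚ 4 * (y * (y *
          (y * 1ℚ))) * 1ℚ * 0ℚ ≡ 0ℚ
      lemma = solve-∀-in ℚ-ring
    S-y-partial (suc i) i+1<p =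
      -- Cubing (-1)ⁱ y leaves the sign to the third power; `sgn²` lowers it to the first.
      Mod-by (ℕ→ℚ 2 * y³ * sgn i * W k) (sgn² i)
        (trans (cong (λ z → z + y + ℕ→ℚ 4 * y³ * (- 1ℚ * sgn i) * Â⁺ -
            (ih + ℕ→ℚ 2 * D - y * β ^ℚ 3 + ℕ→ℚ 2 * sgn i * (y³ * V))) (S-last k y))
               (identity (S k y) y (ℕ→ℚ k) β (W k) (sgn i) Â⁺ Â⁻))
        (Mod-+ (Mod-- (Mod-+ (S-y-partial i i<p) (Mod-scale (integral-ℕ 2) Mod-D)) (Mod-* Mod-y Mod-β³))
               (Mod-scale (integral-* (integral-ℕ 2) (integral-sgn i)) (Mod-* Mod-y³ (W-via-Â i))))
      where
      i<p : i < p
      i<p = ℕ.<-trans (ℕ.n<1+n i) i+1<p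
      k : ℕ
      k = suc i
      β β⁻ y³ Â⁺ Â⁻ ih D V : ℚ
      β  = binomℚ y k
      β⁻ = binomℚ (y - 1ℚ) i
      y³ = y ^ℚ 3
      Â⁺ = Â (oddℤ k)
      Â⁻ = Â (oddℤ i)
      ih = S k y + y + ℕ→ℚ 4 * y³ * sgn i * Â⁻
      D  = ℕ→ℚ k * β ^ℚ 3 - (y * sgn i) ^ℚ 3 * W k
      V  = W k - ℕ→ℚ 2 * (Â⁺ + Â⁻)
      Mod-β : Mod 1 β
      Mod-β = Mod-cancel k (ℕ.>⇒∤ i+1<p) (Mod-resp (trans (sym (ℚ.*-assoc P t β⁻)) (sym (binomℚ-absorption y i)))
        (Mod-P* (integral-* integral-t (integral-binomℚ (integral-- integral-y (integral-ℕ 1)) i i<p))))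
      Mod-β³ : Mod 3 (β ^ℚ 3)
      Mod-β³ = Mod-cube Mod-β
      -- k C(y, k) = y C(y - 1, k - 1) ≡ (-1)^(k-1) y (mod p²), the hypothesis for cubing.
      Mod-D : Mod 4 D
      Mod-D = Mod-cube-quotient (integral-ℕ k) (integral-ℤ (Pow (+ k) n)) Mod-β
        (Mod-resp (ℚ.*-comm (sgn i) y) (Mod-scale (integral-sgn i) Mod-y))
        (Mod-resp (trans (factor y β⁻ (sgn i)) (cong (_- y * sgn i) (sym (binomℚ-absorption y i))))
            (Mod-* Mod-y (binomℚ-y-1 i i<p)))
        (W-inverse-square i i+1<p)
        where
        factor : ∀ y c s → y * (c - s) ≡ y * c - y * s
        factor = solve-∀-in ℚ-ring
      identity : ∀ S y k β W s a⁺ a⁻ →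
        S + (ℕ→ℚ 2 * k - y) * (β * (β * (β * 1ℚ))) + y + ℕ→ℚ 4 * (y * (y * (y * 1ℚ))) * (- 1ℚ * s) * a⁺
        - (S + y + ℕ→ℚ 4 * (y * (y * (y * 1ℚ))) * s * a⁻
           + ℕ→ℚ 2 * (k * (β * (β * (β * 1ℚ))) - ((y * s) * ((y * s) * ((y * s) * 1ℚ))) * W) - y * (β * (β * (β * 1ℚ)))
           + ℕ→ℚ 2 * s * ((y * (y * (y * 1ℚ))) * (W - ℕ→ℚ 2 * (a⁺ + a⁻))))
        ≡ ℕ→ℚ 2 * (y * (y * (y * 1ℚ))) * s * W * (s * s - 1ℚ)
      identity = solve-∀-in ℚ-ring

    -- By `S-shift`, S(y + j) + S(y + j - 1) = (p - 2y - 2j) C(y + j - 1, p - 1)³. The part p - 2y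
    -- meets a cube divisible by p³ and drops out; the rest is -2 y³ / j², which is -4 y³ (A(2j + 1)
    -- + A(2j - 1)). The alternating recursion is thus solved in closed form.
    S-congruence : ∀ j → j < p → Mod 4 (S p (y + ℕ→ℚ j) + sgn j * y + ℕ→ℚ 4 * y ^ℚ 3 * Â (oddℤ j))
    S-congruence zero    _     = Mod-resp rearranged (Mod-- (S-y-partial q (ℕ.n<1+n q))
        (Mod-scale (integral-* (integral-ℕ 4) (integral-sgn q)) (Mod-* Mod-y³ Â-last)))
      where
      -- 2 (p - 1) + 1 ≡ -1 modulo p and A(-1) = A(1) = 0, so only -y is left of S(y).
      Â-last : Mod 1 (Â (oddℤ q) - 0ℚ)
      Â-last = ≈⇒Mod {A (oddℤ q)} {+ 0} (≈-trans (Appell-cong Euler n (congruent (+ 2) (endpoint (+ q))))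
        (≡⇒≈ (trans (Appell-neg (+ 1) (suc m) (+ 1)) (Euler-Appell-1 m))))
        where
        endpoint : ∀ q → + 2 ℤ.* q ℤ.+ + 1 ≡ ℤ.- + 1 ℤ.+ + 2 ℤ.* (+ 1 ℤ.+ q)
        endpoint = ℤS.solve-∀
      rearranged : S p y + y + ℕ→ℚ 4 * y ^ℚ 3 * sgn q * Â (oddℤ q) - ℕ→ℚ 4 * sgn q * (y ^ℚ 3 * (Â (oddℤ q) - 0ℚ))
                 ≡ S p (y + 0ℚ) + sgn 0 * y + ℕ→ℚ 4 * y ^ℚ 3 * Â (oddℤ 0)
      rearranged = trans (lemma (S p y) y (y ^ℚ 3) (sgn q) (Â (oddℤ q)))
        (cong₂ (λ u v → S p u + 1ℚ * y + ℕ→ℚ 4 * y ^ℚ 3 * v) (sym (ℚ.+-identityʳ y)) (sym Â-1≡0))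
        where
        lemma : ∀ S y c s a → S + y + ℕ→ℚ 4 * c * s * a - ℕ→ℚ 4 * s * (c * (a - 0ℚ)) ≡ S + 1ℚ * y + ℕ→ℚ 4 * c * 0ℚ
        lemma = solve-∀-in ℚ-ring
    S-congruence (suc i) i+1<p =
      Mod-by 1ℚ relation (identity P t (S p (y + I)) (S p (y + ℕ→ℚ i)) I β (W k) (sgn i) Â⁺ Â⁻)
        (Mod-- (Mod-- (Mod-- (Mod-* Mod-P (Mod-scale (integral-- (integral-ℕ 1) (integral-*
            (integral-ℕ 2) integral-t)) (Mod-cube mod₁))) (S-congruence i i<p))
                      (Mod-scale (integral-ℕ 2) Mod-D))
               (Mod-scale (integral-ℕ 2) (Mod-* Mod-y³ (W-via-Â i))))
      where
      i<p : i < p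
      i<p = ℕ.<-trans (ℕ.n<1+n i) i+1<p
      open Residue (binomℚ-residue i (ℕ.s<s⁻¹ i+1<p))
      k : ℕ
      k = suc i
      I β Â⁺ Â⁻ : ℚ
      I  = ℕ→ℚ k
      β  = binomℚ (y + ℕ→ℚ i) q
      Â⁺ = Â (oddℤ k)
      Â⁻ = Â (oddℤ i)
      relation : S p (y + I) + S p (y + ℕ→ℚ i) ≡ (P - ℕ→ℚ 2 * (y + I)) * β ^ℚ 3
      relation = subst (λ z → S p (y + I) + S p z ≡ (P - ℕ→ℚ 2 * (y + I)) * binomℚ z q ^ℚ 3) (y+[1+i]-1 i)
          (S-shift q (y + I))
      Mod-D : Mod 4 (I * β ^ℚ 3 - y ^ℚ 3 * W k)
      Mod-D = Mod-cube-quotient (integral-ℕ k) (integral-ℤ (Pow (+ k) n)) mod₁ Mod-y mod₂ (W-inverse-square i i+1<p)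
      identity : ∀ P t S⁺ S I β W s a⁺ a⁻ →
        S⁺ + (- 1ℚ * s) * (P * t) + ℕ→ℚ 4 * ((P * t) * ((P * t) * ((P * t) * 1ℚ))) * a⁺
        - (P * ((1ℚ - ℕ→ℚ 2 * t) * (β * (β * (β * 1ℚ)))) - (S + s * (P * t) + ℕ→ℚ 4 * ((P * t) * ((P * t) *
            ((P * t) * 1ℚ))) * a⁻)
           - ℕ→ℚ 2 * (I * (β * (β * (β * 1ℚ))) - ((P * t) * ((P * t) * ((P * t) * 1ℚ))) * W)
           - ℕ→ℚ 2 * (((P * t) * ((P * t) * ((P * t) * 1ℚ))) * (W - ℕ→ℚ 2 * (a⁺ + a⁻))))
        ≡ 1ℚ * (S⁺ + S - (P - ℕ→ℚ 2 * (P * t + I)) * (β * (β * (β * 1ℚ))))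
      identity = solve-∀-in ℚ-ring

    -- The boundary term of `S³-S` is -4 B³ with B = p C(a, p) = a C(a - 1, p - 1). Here B ≡ y (mod
    -- p²) with both divisible by p, so B³ ≡ y³ (mod p⁴).
    S³-congruence : ∀ i → suc i < p → let a = y + ℕ→ℚ (suc i) in Mod 4 (S³ p a + ℕ→ℚ 3 * (a * a) * S p a + ℕ→ℚ 4 * y ^ℚ 3)
    S³-congruence i i+1<p = Mod-resp (trans (expand B y) (cong (λ z → z + ℕ→ℚ 4 * y ^ℚ 3) (sym total)))
      (Mod-scale (integral-neg (integral-ℕ 4)) (Mod-* Mod-B-y (Mod-+ (Mod-+ (Mod-* Mod-B Mod-B)
          (Mod-* Mod-B Mod-y)) (Mod-* Mod-y Mod-y))))
      where
      open Residue (binomℚ-residue i (ℕ.s<s⁻¹ i+1<p))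
      a β B : ℚ
      a = y + ℕ→ℚ (suc i)
      β = binomℚ (y + ℕ→ℚ i) q
      B = a * β
      total : S³ p a + ℕ→ℚ 3 * (a * a) * S p a ≡ - (ℕ→ℚ 4) * B ^ℚ 3
      total = trans (S³-S p a) (cong (λ z → - (ℕ→ℚ 4) * z ^ℚ 3)
        (trans (binomℚ-absorption a q) (cong (λ z → a * binomℚ z q) (y+[1+i]-1 i))))
      Mod-B : Mod 1 B
      Mod-B = Mod-scale (integral-+ integral-y (integral-ℕ (suc i))) mod₁
      Mod-B-y : Mod 2 (B - y)
      Mod-B-y = Mod-resp (lemma (ℕ→ℚ (suc i)) β y) (Mod-+ mod₂ (Mod-* Mod-y mod₁))
        where
        lemma : ∀ I β y → I * β - y + y * β ≡ (y + I) * β - y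
        lemma = solve-∀-in ℚ-ring
      expand : ∀ B y → - (ℕ→ℚ 4) * ((B - y) * (B * B + B * y + y * y))
          ≡ - (ℕ→ℚ 4) * (B * (B * (B * 1ℚ))) + ℕ→ℚ 4 * (y * (y * (y * 1ℚ)))
      expand = solve-∀-in ℚ-ring

-½ ½ -⅓ -⅙ : ℚ
-½ = - ((+ 1) / 2)
½  = (+ 1) / 2
-⅓ = - ((+ 1) / 3)
-⅙ = - ((+ 1) / 6)

-- The summands of the theorem as multiples of those of `S` and `S³`.

module Summands where
  open ≡-Reasoning

  ℕ→ℚ-^ : ∀ x n → ℕ→ℚ (x ℕ.^ n) ≡ ℕ→ℚ x ^ℚ n
  ℕ→ℚ-^ x zero    = refl
  ℕ→ℚ-^ x (suc n) = trans (ℕ→ℚ-* x (x ℕ.^ n)) (cong (ℕ→ℚ x *_) (ℕ→ℚ-^ x n))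

  ℤ→ℚ-^ : ∀ x n → ℤ→ℚ (x ℤ.^ n) ≡ ℤ→ℚ x ^ℚ n
  ℤ→ℚ-^ x zero    = refl
  ℤ→ℚ-^ x (suc n) = trans (ℤ→ℚ-* x (x ℤ.^ n)) (cong (ℤ→ℚ x *_) (ℤ→ℚ-^ x n))

  ℕ→ℚ-affine : ∀ c d k → ℕ→ℚ (c ℕ.* k ℕ.+ d) ≡ ℕ→ℚ c * ℕ→ℚ k + ℕ→ℚ d
  ℕ→ℚ-affine c d k = trans (ℕ→ℚ-+ (c ℕ.* k) d) (cong (_+ ℕ→ℚ d) (ℕ→ℚ-* c k))

  ℤ→ℚ-pred : ∀ c k → ℤ→ℚ (+ (c ℕ.* k) ℤ.- + 1) ≡ ℕ→ℚ c * ℕ→ℚ k - 1ℚ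
  ℤ→ℚ-pred c k = trans (ℤ→ℚ-+ (+ (c ℕ.* k)) (ℤ.- + 1)) (cong (_+ - 1ℚ) (ℕ→ℚ-* c k))

  /ℤ-unique : ∀ x y {z} → y ≢ + 0 → ℤ→ℚ x ≡ ℤ→ℚ y * z → x /ℤ y ≡ z
  /ℤ-unique x (+ zero)     y≢0 eq = ⊥-elim (y≢0 refl)
  /ℤ-unique x (+ suc d)    y≢0 eq = ℕ→ℚ-cancel (suc d) (trans (/-*-cancel x (suc d)) eq)
  /ℤ-unique x (-[1+ d ]) {z} y≢0 eq = ℕ→ℚ-cancel (suc d) (begin
    ℕ→ℚ (suc d) * ((ℤ.- x) / suc d)    ≡⟨ /-*-cancel (ℤ.- x) (suc d) ⟩
    ℤ→ℚ (ℤ.- x)                        ≡⟨ ℤ→ℚ-neg x ⟩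
    - ℤ→ℚ x                            ≡⟨ cong -_ eq ⟩
    - (ℤ→ℚ (-[1+ d ]) * z)             ≡⟨ cong (λ w → - (w * z)) (ℤ→ℚ-neg (+ suc d)) ⟩
    - (- ℕ→ℚ (suc d) * z)              ≡⟨ lemma (ℕ→ℚ (suc d)) z ⟩
    ℕ→ℚ (suc d) * z                    ∎)
    where
    lemma : ∀ d z → - (- d * z) ≡ d * z
    lemma = solve-∀-in ℚ-ring

  *-≢0 : ∀ {x y} → x ≢ + 0 → y ≢ + 0 → x ℤ.* y ≢ + 0
  *-≢0 {x} {y} x≢0 y≢0 xy≡0 with ℤₚ.i*j≡0⇒i≡0∨j≡0 x xy≡0
  ... | inj₁ x≡0 = x≢0 x≡0
  ... | inj₂ y≡0 = y≢0 y≡0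

  ^-≢0 : ∀ {x} n → x ≢ + 0 → x ℤ.^ n ≢ + 0
  ^-≢0 zero    x≢0 ()
  ^-≢0 (suc n) x≢0 = *-≢0 x≢0 (^-≢0 n x≢0)

  2k-1≢0 : ∀ k → + (2 ℕ.* k) ℤ.- + 1 ≢ + 0
  2k-1≢0 zero    ()
  2k-1≢0 (suc k) rewrite ℕ.+-suc k (k ℕ.+ 0) = λ ()

  -- After one more factor k + 1, absorption applies twice, linked by the symmetry C(2k + 1, k) =
  -- C(2k + 1, k + 1).
  centralBinomial-suc : ∀ k → suc k ℕ.* ((2 ℕ.* suc k) C suc k) ≡ 2 ℕ.* (2 ℕ.* k ℕ.+ 1) ℕ.* ((2 ℕ.* k) C k)
  centralBinomial-suc k = ℕ.*-cancelˡ-≡ _ _ (suc k) (begin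
    suc k ℕ.* (suc k ℕ.* ((2 ℕ.* suc k) C suc k))                         ≡⟨ cong
        (λ z → suc k ℕ.* (suc k ℕ.* (z C suc k))) (double k) ⟩
    suc k ℕ.* (suc k ℕ.* (suc n C suc k))                                 ≡⟨ cong (suc k ℕ.*_) (absorption n k) ⟩
    suc k ℕ.* (suc n ℕ.* (n C k))                                         ≡⟨ cong (λ z → suc k ℕ.* (suc n ℕ.* z)) symmetric ⟩
    suc k ℕ.* (suc n ℕ.* (n C suc k))                                     ≡⟨ swap (suc k) (suc n) (n C suc k) ⟩
    suc n ℕ.* (suc k ℕ.* (n C suc k))                                     ≡⟨ cong (suc n ℕ.*_) (absorption (2 ℕ.* k) k) ⟩
    suc n ℕ.* (n ℕ.* ((2 ℕ.* k) C k))                                     ≡⟨ finish k ((2 ℕ.* k) C k) ⟩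
    suc k ℕ.* (2 ℕ.* (2 ℕ.* k ℕ.+ 1) ℕ.* ((2 ℕ.* k) C k))                 ∎)
    where
    n : ℕ
    n = suc (2 ℕ.* k)
    double : ∀ k → 2 ℕ.* suc k ≡ suc (suc (2 ℕ.* k))
    double = ℕS.solve-∀
    swap : ∀ a b c → a ℕ.* (b ℕ.* c) ≡ b ℕ.* (a ℕ.* c)
    swap = ℕS.solve-∀
    finish : ∀ k c → suc (suc (2 ℕ.* k)) ℕ.* (suc (2 ℕ.* k) ℕ.* c) ≡ suc k ℕ.* (2 ℕ.* (2 ℕ.* k ℕ.+ 1) ℕ.* c)
    finish = ℕS.solve-∀
    n∸k : n ∸ k ≡ suc k
    n∸k = trans (cong (_∸ k) (lemma k)) (ℕ.m+n∸m≡n k (suc k))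
      where
      lemma : ∀ k → suc (2 ℕ.* k) ≡ k ℕ.+ suc k
      lemma = ℕS.solve-∀
    symmetric : n C k ≡ n C suc k
    symmetric = trans (nCk≡nC[n∸k] {k = k} (ℕ.≤-trans (ℕ.m≤m+n k (k ℕ.+ 0)) (ℕ.n≤1+n (2 ℕ.* k)))) (cong (n C_) n∸k)

  -- Both sides have the same first-order recurrence, since 2 (2k + 1) = -4 (-1/2 - k).
  centralBinomial : ∀ k → ℕ→ℚ ((2 ℕ.* k) C k) ≡ ℤ→ℚ ((ℤ.- + 4) ℤ.^ k) * binomℚ -½ k
  centralBinomial zero    = refl
  centralBinomial (suc k) = ℕ→ℚ-cancel (suc k) (begin
    ℕ→ℚ (suc k) * ℕ→ℚ ((2 ℕ.* suc k) C suc k)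
      ≡⟨ ℕ→ℚ-* (suc k) ((2 ℕ.* suc k) C suc k) ⟨
    ℕ→ℚ (suc k ℕ.* ((2 ℕ.* suc k) C suc k))
      ≡⟨ cong ℕ→ℚ (centralBinomial-suc k) ⟩
    ℕ→ℚ (2 ℕ.* (2 ℕ.* k ℕ.+ 1) ℕ.* ((2 ℕ.* k) C k))
      ≡⟨ trans (ℕ→ℚ-* (2 ℕ.* (2 ℕ.* k ℕ.+ 1)) ((2 ℕ.* k) C k)) (cong₂ _*_
          (trans (ℕ→ℚ-* 2 (2 ℕ.* k ℕ.+ 1)) (cong (ℕ→ℚ 2 *_) (ℕ→ℚ-affine 2 1 k))) (centralBinomial k)) ⟩
    ℕ→ℚ 2 * (ℕ→ℚ 2 * ℕ→ℚ k + 1ℚ) * (F * binomℚ -½ k)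
      ≡⟨ lemma (ℕ→ℚ k) F (binomℚ -½ k) ⟩
    ℤ→ℚ (ℤ.- + 4) * F * ((-½ - ℕ→ℚ k) * binomℚ -½ k)
      ≡⟨ cong₂ _*_ (ℤ→ℚ-* (ℤ.- + 4) ((ℤ.- + 4) ℤ.^ k)) (binomℚ-suc -½ k) ⟨
    ℤ→ℚ ((ℤ.- + 4) ℤ.^ suc k) * (ℕ→ℚ (suc k) * binomℚ -½ (suc k))
      ≡⟨ swap (ℤ→ℚ ((ℤ.- + 4) ℤ.^ suc k)) (ℕ→ℚ (suc k)) (binomℚ -½ (suc k)) ⟩
    ℕ→ℚ (suc k) * (ℤ→ℚ ((ℤ.- + 4) ℤ.^ suc k) * binomℚ -½ (suc k)) ∎)
    where
    F : ℚ
    F = ℤ→ℚ ((ℤ.- + 4) ℤ.^ k)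
    lemma : ∀ k f c → ℕ→ℚ 2 * (ℕ→ℚ 2 * k + 1ℚ) * (f * c) ≡ ℤ→ℚ (ℤ.- + 4) * f * ((- ((+ 1) / 2) - k) * c)
    lemma = solve-∀-in ℚ-ring
    swap : ∀ x y z → x * (y * z) ≡ y * (x * z)
    swap = solve-∀-in ℚ-ring

  m64 : ℕ → ℤ
  m64 k = (ℤ.- + 64) ℤ.^ k

  m64≢0 : ∀ k → m64 k ≢ + 0
  m64≢0 k = ^-≢0 k λ ()

  centralBinomial³ : ∀ k → ℤ→ℚ (+ (((2 ℕ.* k) C k) ℕ.^ 3)) ≡ ℤ→ℚ (m64 k) * binomℚ -½ k ^ℚ 3
  centralBinomial³ k = begin
    ℕ→ℚ (((2 ℕ.* k) C k) ℕ.^ 3)                            ≡⟨ ℕ→ℚ-^ ((2 ℕ.* k) C k) 3 ⟩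
    ℕ→ℚ ((2 ℕ.* k) C k) ^ℚ 3                               ≡⟨ cong (_^ℚ 3) (centralBinomial k) ⟩
    (ℤ→ℚ F * binomℚ -½ k) ^ℚ 3                             ≡⟨ cube-* (ℤ→ℚ F) (binomℚ -½ k) ⟩
    ℤ→ℚ F ^ℚ 3 * binomℚ -½ k ^ℚ 3                          ≡⟨ cong (_* binomℚ -½ k ^ℚ 3)
        (trans (sym (ℤ→ℚ-^ F 3)) (cong ℤ→ℚ (cubes k))) ⟩
    ℤ→ℚ (m64 k) * binomℚ -½ k ^ℚ 3                         ∎
    where
    F : ℤ
    F = (ℤ.- + 4) ℤ.^ k
    cube-* : ∀ x y → (x * y) * ((x * y) * ((x * y) * 1ℚ)) ≡ (x * (x * (x * 1ℚ))) * (y * (y * (y * 1ℚ)))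
    cube-* = solve-∀-in ℚ-ring
    cubes : ∀ k → ((ℤ.- + 4) ℤ.^ k) ℤ.^ 3 ≡ m64 k
    cubes zero    = refl
    cubes (suc k) = trans (lemma ((ℤ.- + 4) ℤ.^ k)) (cong ((ℤ.- + 64) ℤ.*_) (cubes k))
      where
      lemma : ∀ x → (ℤ.- + 4 ℤ.* x) ℤ.* ((ℤ.- + 4 ℤ.* x) ℤ.* ((ℤ.- + 4 ℤ.* x) ℤ.* + 1))
          ≡ (ℤ.- + 64) ℤ.* (x ℤ.* (x ℤ.* (x ℤ.* + 1)))
      lemma = ℤS.solve-∀

  -- This cancels (2k - 1)³ in the denominators: the second and third sums become, up to sign and
  -- scale, the sums at a = 1/2.
  binomℚ-½ : ∀ k → binomℚ -½ k ≡ - (ℕ→ℚ 2 * ℕ→ℚ k - 1ℚ) * binomℚ ½ k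
  binomℚ-½ k = by-combination (- (ℕ→ℚ 2)) (binomℚ-upShift ½ k) (lemma (ℕ→ℚ k) (binomℚ ½ k) (binomℚ -½ k))
    where
    lemma : ∀ k b c → c - - (ℕ→ℚ 2 * k - 1ℚ) * b ≡ - (ℕ→ℚ 2) * (((+ 1) / 2 - k) * b - (+ 1) / 2 * c)
    lemma = solve-∀-in ℚ-ring

  summand-½ : ∀ k x → (x ℤ.* + (((2 ℕ.* k) C k) ℕ.^ 3)) /ℤ m64 k ≡ ℤ→ℚ x * binomℚ -½ k ^ℚ 3
  summand-½ k x = /ℤ-unique (x ℤ.* + (((2 ℕ.* k) C k) ℕ.^ 3)) (m64 k) (m64≢0 k) (trans (ℤ→ℚ-* x (+ (((2 ℕ.* k) C k) ℕ.^ 3)))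
    (trans (cong (ℤ→ℚ x *_) (centralBinomial³ k)) (swap (ℤ→ℚ x) (ℤ→ℚ (m64 k)) (binomℚ -½ k ^ℚ 3))))
    where
    swap : ∀ x y z → x * (y * z) ≡ y * (x * z)
    swap = solve-∀-in ℚ-ring

  summand½ : ∀ k x → (x ℤ.* + (((2 ℕ.* k) C k) ℕ.^ 3)) /ℤ (m64 k ℤ.* (+ (2 ℕ.* k) ℤ.- + 1) ℤ.^ 3) ≡ - ℤ→ℚ x * binomℚ ½ k ^ℚ 3
  summand½ k x = /ℤ-unique (x ℤ.* + (((2 ℕ.* k) C k) ℕ.^ 3)) (m64 k ℤ.* (+ (2 ℕ.* k) ℤ.- + 1) ℤ.^ 3)
    (*-≢0 (m64≢0 k) (^-≢0 3 (2k-1≢0 k))) (begin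
    ℤ→ℚ (x ℤ.* + (((2 ℕ.* k) C k) ℕ.^ 3))
      ≡⟨ ℤ→ℚ-* x (+ (((2 ℕ.* k) C k) ℕ.^ 3)) ⟩
    ℤ→ℚ x * ℤ→ℚ (+ (((2 ℕ.* k) C k) ℕ.^ 3))
      ≡⟨ cong (ℤ→ℚ x *_) (trans (centralBinomial³ k) (cong (λ z → ℤ→ℚ (m64 k) * z ^ℚ 3) (binomℚ-½ k))) ⟩
    ℤ→ℚ x * (ℤ→ℚ (m64 k) * (- (ℕ→ℚ 2 * ℕ→ℚ k - 1ℚ) * binomℚ ½ k) ^ℚ 3)
      ≡⟨ lemma (ℤ→ℚ x) (ℤ→ℚ (m64 k)) (ℕ→ℚ 2 * ℕ→ℚ k - 1ℚ) (binomℚ ½ k) ⟩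
    ℤ→ℚ (m64 k) * (ℕ→ℚ 2 * ℕ→ℚ k - 1ℚ) ^ℚ 3 * (- ℤ→ℚ x * binomℚ ½ k ^ℚ 3)
      ≡⟨ cong (_* (- ℤ→ℚ x * binomℚ ½ k ^ℚ 3)) (trans (ℤ→ℚ-* (m64 k) ((+ (2 ℕ.* k) ℤ.- + 1) ℤ.^ 3))
           (cong (ℤ→ℚ (m64 k) *_) (trans (ℤ→ℚ-^ (+ (2 ℕ.* k) ℤ.- + 1) 3) (cong (_^ℚ 3) (ℤ→ℚ-pred 2 k))))) ⟨
    ℤ→ℚ (m64 k ℤ.* (+ (2 ℕ.* k) ℤ.- + 1) ℤ.^ 3) * (- ℤ→ℚ x * binomℚ ½ k ^ℚ 3) ∎)
    where
    lemma : ∀ x m d b → x * (m * ((- d * b) * ((- d * b) * ((- d * b) * 1ℚ))))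
        ≡ m * (d * (d * (d * 1ℚ))) * (- x * (b * (b * (b * 1ℚ))))
    lemma = solve-∀-in ℚ-ring

  summand₁ : ∀ k → ((+ (4 ℕ.* k ℕ.+ 1)) ℤ.^ 3 ℤ.* + (((2 ℕ.* k) C k) ℕ.^ 3)) /ℤ m64 k
                 ≡ ℕ→ℚ 8 * ((ℕ→ℚ 2 * ℕ→ℚ k - -½) ^ℚ 3 * binomℚ -½ k ^ℚ 3)
  summand₁ k = trans (summand-½ k ((+ (4 ℕ.* k ℕ.+ 1)) ℤ.^ 3))
    (trans (cong (_* b ^ℚ 3) (trans (ℤ→ℚ-^ (+ (4 ℕ.* k ℕ.+ 1)) 3)
        (cong (_^ℚ 3) (ℕ→ℚ-affine 4 1 k)))) (lemma (ℕ→ℚ k) (b ^ℚ 3)))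
    where
    b : ℚ
    b = binomℚ -½ k
    lemma : ∀ k c → (ℕ→ℚ 4 * k + ℕ→ℚ 1) * ((ℕ→ℚ 4 * k + ℕ→ℚ 1) * ((ℕ→ℚ 4 * k + ℕ→ℚ 1) * 1ℚ)) * c
                  ≡ ℕ→ℚ 8 * ((ℕ→ℚ 2 * k - -½) * ((ℕ→ℚ 2 * k - -½) * ((ℕ→ℚ 2 * k - -½) * 1ℚ)) * c)
    lemma = solve-∀-in ℚ-ring

  summand₂ : ∀ k → ((+ (4 ℕ.* k) ℤ.- + 1) ℤ.* + (((2 ℕ.* k) C k) ℕ.^ 3)) /ℤ (m64 k ℤ.* (+ (2 ℕ.* k) ℤ.- + 1) ℤ.^ 3)
                 ≡ - ℕ→ℚ 2 * ((ℕ→ℚ 2 * ℕ→ℚ k - ½) * binomℚ ½ k ^ℚ 3)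
  summand₂ k = trans (summand½ k (+ (4 ℕ.* k) ℤ.- + 1))
    (trans (cong (λ z → - z * b ^ℚ 3) (ℤ→ℚ-pred 4 k)) (lemma (ℕ→ℚ k) (b ^ℚ 3)))
    where
    b : ℚ
    b = binomℚ ½ k
    lemma : ∀ k c → - (ℕ→ℚ 4 * k - 1ℚ) * c ≡ - ℕ→ℚ 2 * ((ℕ→ℚ 2 * k - ½) * c)
    lemma = solve-∀-in ℚ-ring

  summand₃ : ∀ k → ((+ (4 ℕ.* k) ℤ.- + 1) ℤ.^ 3 ℤ.* + (((2 ℕ.* k) C k) ℕ.^ 3)) /ℤ (m64 k ℤ.* (+ (2 ℕ.* k) ℤ.- + 1) ℤ.^ 3)
                 ≡ - ℕ→ℚ 8 * ((ℕ→ℚ 2 * ℕ→ℚ k - ½) ^ℚ 3 * binomℚ ½ k ^ℚ 3)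
  summand₃ k = trans (summand½ k ((+ (4 ℕ.* k) ℤ.- + 1) ℤ.^ 3))
    (trans (cong (λ z → - z * b ^ℚ 3) (trans (ℤ→ℚ-^ (+ (4 ℕ.* k) ℤ.- + 1) 3)
        (cong (_^ℚ 3) (ℤ→ℚ-pred 4 k)))) (lemma (ℕ→ℚ k) (b ^ℚ 3)))
    where
    b : ℚ
    b = binomℚ ½ k
    lemma : ∀ k c → - ((ℕ→ℚ 4 * k - 1ℚ) * ((ℕ→ℚ 4 * k - 1ℚ) * ((ℕ→ℚ 4 * k - 1ℚ) * 1ℚ))) * c
                  ≡ - ℕ→ℚ 8 * ((ℕ→ℚ 2 * k - ½) * ((ℕ→ℚ 2 * k - ½) * ((ℕ→ℚ 2 * k - ½) * 1ℚ)) * c)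
    lemma = solve-∀-in ℚ-ring

  summand₄ : ∀ k → ℕ→ℚ (12 ℕ.* k ℕ.+ 1) * binomℚ -⅙ k ^ℚ 3 ≡ ℕ→ℚ 6 * ((ℕ→ℚ 2 * ℕ→ℚ k - -⅙) * binomℚ -⅙ k ^ℚ 3)
  summand₄ k = trans (cong (_* binomℚ -⅙ k ^ℚ 3) (ℕ→ℚ-affine 12 1 k)) (lemma (ℕ→ℚ k) (binomℚ -⅙ k ^ℚ 3))
    where
    lemma : ∀ k c → (ℕ→ℚ 12 * k + ℕ→ℚ 1) * c ≡ ℕ→ℚ 6 * ((ℕ→ℚ 2 * k - -⅙) * c)
    lemma = solve-∀-in ℚ-ring

  summand₅ : ∀ k → ℕ→ℚ (12 ℕ.* k ℕ.+ 1) ^ℚ 3 * binomℚ -⅙ k ^ℚ 3 ≡ ℕ→ℚ 216 * ((ℕ→ℚ 2 * ℕ→ℚ k - -⅙) ^ℚ 3 * binomℚ -⅙ k ^ℚ 3)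
  summand₅ k = trans (cong (λ z → z ^ℚ 3 * binomℚ -⅙ k ^ℚ 3) (ℕ→ℚ-affine 12 1 k)) (lemma (ℕ→ℚ k) (binomℚ -⅙ k ^ℚ 3))
    where
    lemma : ∀ k c → (ℕ→ℚ 12 * k + ℕ→ℚ 1) * ((ℕ→ℚ 12 * k + ℕ→ℚ 1) * ((ℕ→ℚ 12 * k + ℕ→ℚ 1) * 1ℚ)) * c
                  ≡ ℕ→ℚ 216 * ((ℕ→ℚ 2 * k - -⅙) * ((ℕ→ℚ 2 * k - -⅙) * ((ℕ→ℚ 2 * k - -⅙) * 1ℚ)) * c)
    lemma = solve-∀-in ℚ-ring

  summand₆ : ∀ k → ℕ→ℚ (6 ℕ.* k ℕ.+ 1) * binomℚ -⅓ k ^ℚ 3 ≡ ℕ→ℚ 3 * ((ℕ→ℚ 2 * ℕ→ℚ k - -⅓) * binomℚ -⅓ k ^ℚ 3)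
  summand₆ k = trans (cong (_* binomℚ -⅓ k ^ℚ 3) (ℕ→ℚ-affine 6 1 k)) (lemma (ℕ→ℚ k) (binomℚ -⅓ k ^ℚ 3))
    where
    lemma : ∀ k c → (ℕ→ℚ 6 * k + ℕ→ℚ 1) * c ≡ ℕ→ℚ 3 * ((ℕ→ℚ 2 * k - -⅓) * c)
    lemma = solve-∀-in ℚ-ring

  summand₇ : ∀ k → ℕ→ℚ (6 ℕ.* k ℕ.+ 1) ^ℚ 3 * binomℚ -⅓ k ^ℚ 3 ≡ ℕ→ℚ 27 * ((ℕ→ℚ 2 * ℕ→ℚ k - -⅓) ^ℚ 3 * binomℚ -⅓ k ^ℚ 3)
  summand₇ k = trans (cong (λ z → z ^ℚ 3 * binomℚ -⅓ k ^ℚ 3) (ℕ→ℚ-affine 6 1 k)) (lemma (ℕ→ℚ k) (binomℚ -⅓ k ^ℚ 3))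
    where
    lemma : ∀ k c → (ℕ→ℚ 6 * k + ℕ→ℚ 1) * ((ℕ→ℚ 6 * k + ℕ→ℚ 1) * ((ℕ→ℚ 6 * k + ℕ→ℚ 1) * 1ℚ)) * c
                  ≡ ℕ→ℚ 27 * ((ℕ→ℚ 2 * k - -⅓) * ((ℕ→ℚ 2 * k - -⅓) * ((ℕ→ℚ 2 * k - -⅓) * 1ℚ)) * c)
    lemma = solve-∀-in ℚ-ring

  total₁ : ∀ p → Σℚ[< p ] (λ k → ((+ (4 ℕ.* k ℕ.+ 1)) ℤ.^ 3 ℤ.* + (((2 ℕ.* k) C k) ℕ.^ 3)) /ℤ m64 k) ≡ ℕ→ℚ 8 * S³ p -½
  total₁ = Σ-scale (ℕ→ℚ 8) summand₁

  total₂ : ∀ p → Σℚ[< p ] (λ k → ((+ (4 ℕ.* k) ℤ.- + 1) ℤ.* + (((2 ℕ.* k) C k) ℕ.^ 3)) /ℤ (m64 k ℤ.* (+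
      (2 ℕ.* k) ℤ.- + 1) ℤ.^ 3)) ≡ - ℕ→ℚ 2 * S p ½
  total₂ = Σ-scale (- ℕ→ℚ 2) summand₂

  total₃ : ∀ p → Σℚ[< p ] (λ k → ((+ (4 ℕ.* k) ℤ.- + 1) ℤ.^ 3 ℤ.* + (((2 ℕ.* k) C k) ℕ.^ 3)) /ℤ (m64 k ℤ.* (+
      (2 ℕ.* k) ℤ.- + 1) ℤ.^ 3)) ≡ - ℕ→ℚ 8 * S³ p ½
  total₃ = Σ-scale (- ℕ→ℚ 8) summand₃

  total₄ : ∀ p → Σℚ[< p ] (λ k → ℕ→ℚ (12 ℕ.* k ℕ.+ 1) * binomℚ -⅙ k ^ℚ 3) ≡ ℕ→ℚ 6 * S p -⅙
  total₄ = Σ-scale (ℕ→ℚ 6) summand₄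

  total₅ : ∀ p → Σℚ[< p ] (λ k → ℕ→ℚ (12 ℕ.* k ℕ.+ 1) ^ℚ 3 * binomℚ -⅙ k ^ℚ 3) ≡ ℕ→ℚ 216 * S³ p -⅙
  total₅ = Σ-scale (ℕ→ℚ 216) summand₅

  total₆ : ∀ p → Σℚ[< p ] (λ k → ℕ→ℚ (6 ℕ.* k ℕ.+ 1) * binomℚ -⅓ k ^ℚ 3) ≡ ℕ→ℚ 3 * S p -⅓
  total₆ = Σ-scale (ℕ→ℚ 3) summand₆

  total₇ : ∀ p → Σℚ[< p ] (λ k → ℕ→ℚ (6 ℕ.* k ℕ.+ 1) ^ℚ 3 * binomℚ -⅓ k ^ℚ 3) ≡ ℕ→ℚ 27 * S³ p -⅓
  total₇ = Σ-scale (ℕ→ℚ 27) summand₇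

open Summands

-- Matching the evaluations with the stated right-hand sides.

module FinalIdentities where
  identity₁ : ∀ S P s E → ℕ→ℚ 8 * S - (ℤ→ℚ (ℤ.- (+ 3)) * s * P + (P * (P * (P * 1ℚ))) * (ℕ→ℚ 4 - ℕ→ℚ 3 * E))
    ≡ ℕ→ℚ 8 * (S - ℕ→ℚ 3 * (-½ * -½) * (s * (P * -½) + ℕ→ℚ 4 * ((P * -½) * ((P * -½) * ((P * -½) * 1ℚ))) *
        (E)) + ℕ→ℚ 4 * ((P * -½) * ((P * -½) * ((P * -½) * 1ℚ))))
  identity₁ = solve-∀-in ℚ-ring
  identity₂ : ∀ S P s E → - ℕ→ℚ 2 * S - (s * P + (P * (P * (P * 1ℚ))) * (E - ℕ→ℚ 2))
    ≡ - ℕ→ℚ 2 * (S + (- s) * (P * -½) + ℕ→ℚ 4 * ((P * -½) * ((P * -½) * ((P * -½) * 1ℚ))) * (ℕ→ℚ 2 - E))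
  identity₂ = solve-∀-in ℚ-ring
  identity₃ : ∀ S P s E → - ℕ→ℚ 8 * S - (ℤ→ℚ (ℤ.- (+ 3)) * s * P + (P * (P * (P * 1ℚ))) * (ℕ→ℚ 2 - ℕ→ℚ 3 * E))
    ≡ - ℕ→ℚ 8 * (S - ℕ→ℚ 3 * (½ * ½) * ((- s) * (P * -½) + ℕ→ℚ 4 * ((P * -½) * ((P * -½) * ((P * -½) * 1ℚ))) *
        (ℕ→ℚ 2 - E)) + ℕ→ℚ 4 * ((P * -½) * ((P * -½) * ((P * -½) * 1ℚ))))
  identity₃ = solve-∀-in ℚ-ring
  -- The coefficient 5/9 is 6 · 4 · (1/6)³ · 5. Replacing t = -1/6 by -5/6 multiplies it by 125,
  -- which is the 625/9 of the other residue class.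
  identity₄ : ∀ S P s E → ℕ→ℚ 6 * S - (s * P + ((+ 5) / 9) * (P * (P * (P * 1ℚ))) * E)
    ≡ ℕ→ℚ 6 * (S + s * (P * (ℕ→ℚ 1 * -⅙)) + ℕ→ℚ 4 * ((P * (ℕ→ℚ 1 * -⅙)) * ((P * (ℕ→ℚ 1 * -⅙)) * ((P *
        (ℕ→ℚ 1 * -⅙)) * 1ℚ))) * (ℕ→ℚ 5 * E))
  identity₄ = solve-∀-in ℚ-ring
  identity₅ : ∀ S P s E → ℕ→ℚ 6 * S - (ℕ→ℚ 5 * s * P + ((+ 625) / 9) * (P * (P * (P * 1ℚ))) * E)
    ≡ ℕ→ℚ 6 * (S + s * (P * (ℕ→ℚ 5 * -⅙)) + ℕ→ℚ 4 * ((P * (ℕ→ℚ 5 * -⅙)) * ((P * (ℕ→ℚ 5 * -⅙)) * ((P *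
        (ℕ→ℚ 5 * -⅙)) * 1ℚ))) * (ℕ→ℚ 5 * E))
  identity₅ = solve-∀-in ℚ-ring
  identity₆ : ∀ S P s E → ℕ→ℚ 216 * S - (ℤ→ℚ (ℤ.- (+ 3)) * s * P + (P * (P * (P * 1ℚ))) * (ℕ→ℚ 4 - ((+ 5) / 3) * E))
    ≡ ℕ→ℚ 216 * (S - ℕ→ℚ 3 * (-⅙ * -⅙) * (s * (P * (ℕ→ℚ 1 * -⅙)) + ℕ→ℚ 4 * ((P * (ℕ→ℚ 1 * -⅙)) * ((P *
        (ℕ→ℚ 1 * -⅙)) * ((P * (ℕ→ℚ 1 * -⅙)) * 1ℚ))) * (ℕ→ℚ 5 * E)) + ℕ→ℚ 4 * ((P * (ℕ→ℚ 1 * -⅙)) * ((P *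
        (ℕ→ℚ 1 * -⅙)) * ((P * (ℕ→ℚ 1 * -⅙)) * 1ℚ))))
  identity₆ = solve-∀-in ℚ-ring
  identity₇ : ∀ S P s E → ℕ→ℚ 216 * S - (ℤ→ℚ (ℤ.- (+ 15)) * s * P + (P * (P * (P * 1ℚ))) * (ℕ→ℚ 500 - ((+ 625) / 3) * E))
    ≡ ℕ→ℚ 216 * (S - ℕ→ℚ 3 * (-⅙ * -⅙) * (s * (P * (ℕ→ℚ 5 * -⅙)) + ℕ→ℚ 4 * ((P * (ℕ→ℚ 5 * -⅙)) * ((P *
        (ℕ→ℚ 5 * -⅙)) * ((P * (ℕ→ℚ 5 * -⅙)) * 1ℚ))) * (ℕ→ℚ 5 * E)) + ℕ→ℚ 4 * ((P * (ℕ→ℚ 5 * -⅙)) * ((P *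
        (ℕ→ℚ 5 * -⅙)) * ((P * (ℕ→ℚ 5 * -⅙)) * 1ℚ))))
  identity₇ = solve-∀-in ℚ-ring
  -- Here 3 · 4 · (1/3)³ · (9/4) = 1; for t = -2/3 it becomes 8.
  identity₈ : ∀ S P Û → ℕ→ℚ 3 * S - (P + (P * (P * (P * 1ℚ))) * Û)
    ≡ ℕ→ℚ 3 * (S + 1ℚ * (P * (ℕ→ℚ 1 * -⅓)) + ℕ→ℚ 4 * ((P * (ℕ→ℚ 1 * -⅓)) * ((P * (ℕ→ℚ 1 * -⅓)) * ((P *
        (ℕ→ℚ 1 * -⅓)) * 1ℚ))) * ((+ 9) / 4 * Û))
  identity₈ = solve-∀-in ℚ-ring
  identity₉ : ∀ S P Û → ℕ→ℚ 3 * S - (ℤ→ℚ (ℤ.- (+ 2)) * P + ℕ→ℚ 8 * (P * (P * (P * 1ℚ))) * Û)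
    ≡ ℕ→ℚ 3 * (S + (- 1ℚ) * (P * (ℕ→ℚ 2 * -⅓)) + ℕ→ℚ 4 * ((P * (ℕ→ℚ 2 * -⅓)) * ((P * (ℕ→ℚ 2 * -⅓)) * ((P *
        (ℕ→ℚ 2 * -⅓)) * 1ℚ))) * ((+ 9) / 4 * Û))
  identity₉ = solve-∀-in ℚ-ring
  identity₁₀ : ∀ S P Û → ℕ→ℚ 27 * S - (ℤ→ℚ (ℤ.- (+ 3)) * P + (P * (P * (P * 1ℚ))) * (ℕ→ℚ 4 - ℕ→ℚ 3 * Û))
    ≡ ℕ→ℚ 27 * (S - ℕ→ℚ 3 * (-⅓ * -⅓) * (1ℚ * (P * (ℕ→ℚ 1 * -⅓)) + ℕ→ℚ 4 * ((P * (ℕ→ℚ 1 * -⅓)) * ((P *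
        (ℕ→ℚ 1 * -⅓)) * ((P * (ℕ→ℚ 1 * -⅓)) * 1ℚ))) * ((+ 9) / 4 * Û)) + ℕ→ℚ 4 * ((P * (ℕ→ℚ 1 * -⅓)) * ((P *
        (ℕ→ℚ 1 * -⅓)) * ((P * (ℕ→ℚ 1 * -⅓)) * 1ℚ))))
  identity₁₀ = solve-∀-in ℚ-ring
  identity₁₁ : ∀ S P Û → ℕ→ℚ 27 * S - (ℕ→ℚ 6 * P + ℕ→ℚ 8 * (P * (P * (P * 1ℚ))) * (ℕ→ℚ 4 - ℕ→ℚ 3 * Û))
    ≡ ℕ→ℚ 27 * (S - ℕ→ℚ 3 * (-⅓ * -⅓) * ((- 1ℚ) * (P * (ℕ→ℚ 2 * -⅓)) + ℕ→ℚ 4 * ((P * (ℕ→ℚ 2 * -⅓)) * ((P *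
        (ℕ→ℚ 2 * -⅓)) * ((P * (ℕ→ℚ 2 * -⅓)) * 1ℚ))) * ((+ 9) / 4 * Û)) + ℕ→ℚ 4 * ((P * (ℕ→ℚ 2 * -⅓)) * ((P *
        (ℕ→ℚ 2 * -⅓)) * ((P * (ℕ→ℚ 2 * -⅓)) * 1ℚ))))
  identity₁₁ = solve-∀-in ℚ-ring


-- The arguments -1/2, 1/2, -1/6 and -1/3.

module Evaluations (p : ℕ) (p-prime : Prime p) where
  open Localisation p p-prime

  s E Û : ℚ
  s = (- 1ℚ) ^ℚ ⌊ p ∸ 1 /2⌋
  E = ℤ→ℚ (Euler (p ∸ 3))
  Û = ℤ→ℚ (U (p ∸ 3))

  Mod⇒≡[mod] : ∀ {k x y} → Mod k (x - y) → x ≡ y [mod p ℕ.^ k ]over p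
  Mod⇒≡[mod] {k} (multiple r (integral ir) eq) = r , ir , trans eq (cong (_* r) (sym (ℕ→ℚ-^ p k)))

  conclude : ∀ {X Y Z c a} → X ≡ Y → Integral c → Mod 4 a → Y - Z ≡ c * a → X ≡ Z [mod p ℕ.^ 4 ]over p
  conclude {X} {Y} {Z} X≡Y ic ma eq = Mod⇒≡[mod] {4} {X} {Z} (Mod-resp
      (trans (sym eq) (cong (_- Z) (sym X≡Y))) (Mod-scale ic ma))

  -- For a = pt + j the intended values are σ = (-1)ʲ and α ≡ A(2j + 1) modulo p. The second field
  -- results from eliminating S from S³ + 3a² S ≡ -4 (pt)³.
  record Evaluation (a t σ α : ℚ) : Set where
    field
      S-value  : Mod 4 (S p a + σ * (P * t) + ℕ→ℚ 4 * (P * t) ^ℚ 3 * α)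
      S³-value : Mod 4 (S³ p a - ℕ→ℚ 3 * (a * a) * (σ * (P * t) + ℕ→ℚ 4 * (P * t) ^ℚ 3 * α) + ℕ→ℚ 4 * (P * t) ^ℚ 3)

module Specialisation (m : ℕ) (prime : Prime (5 ℕ.+ m ℕ.* 2)) where
  open EulerCongruences m prime using (p; n; A; p∤2; p∤3; A-two-thirds; A-one-third)
  open Localisation p prime
  open Evaluations p prime
  open Modulo p using (_≈_; congruent; ≈-trans; ≡⇒≈; Appell-cong)
  open Supercongruence m prime using (Â; sgn; oddℤ; S-congruence; S³-congruence)

  evaluate : ∀ {a t σ α} i → suc i < p → Integral t → P * t + ℕ→ℚ (suc i) ≡ a → sgn (suc i) ≡ σ →
             Mod 1 (Â (oddℤ (suc i)) - α) → Evaluation a t σ α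
  evaluate {a} {t} {σ} {α} i j<p it refl refl mα = record
    { S-value  = S-value
    ; S³-value = Mod-resp (lemma₂ (S p a) (S³ p a) (ℕ→ℚ 3 * (a * a)) (σ * y) (y ^ℚ 3) α)
        (Mod-- (S³-congruence it i j<p) (Mod-scale (integral-* (integral-ℕ 3) (integral-* ia ia)) S-value))
    }
    where
    y : ℚ
    y = P * t
    iy : Integral y
    iy = integral-* (integral-ℕ p) it
    ia : Integral a
    ia = integral-+ iy (integral-ℕ (suc i))
    lemma₁ : ∀ S u c α Â → S + u + ℕ→ℚ 4 * c * Â - ℕ→ℚ 4 * (c * (Â - α)) ≡ S + u + ℕ→ℚ 4 * c * α
    lemma₁ = solve-∀-in ℚ-ring
    lemma₂ : ∀ S S³ q u c α → S³ + q * S + ℕ→ℚ 4 * c - q * (S + u + ℕ→ℚ 4 * c * α) ≡ S³ - q * (u + ℕ→ℚ 4 * c * α) + ℕ→ℚ 4 * c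
    lemma₂ = solve-∀-in ℚ-ring
    S-value : Mod 4 (S p a + σ * y + ℕ→ℚ 4 * y ^ℚ 3 * α)
    S-value = Mod-resp (lemma₁ (S p a) (σ * y) (y ^ℚ 3) α (Â (oddℤ (suc i))))
      (Mod-- (S-congruence it (suc i) j<p) (Mod-scale (integral-ℕ 4) (Mod-* (Mod-cube (Mod-P* it)) mα)))

  ℕ-≈ : ∀ {x} κ r → x ≡ r ℕ.+ κ ℕ.* p → + x ≈ + r
  ℕ-≈ κ r refl = congruent (+ κ) (trans (ℤₚ.pos-+ r (κ ℕ.* p)) (cong (λ z → + r ℤ.+ z) (ℤₚ.pos-* κ p)))

  oddℤ-pos : ∀ i → oddℤ i ≡ + (2 ℕ.* i ℕ.+ 1)
  oddℤ-pos i = sym (trans (ℤₚ.pos-+ (2 ℕ.* i) 1) (cong (ℤ._+ + 1) (ℤₚ.pos-* 2 i)))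

  3*oddℤ-≈ : ∀ i κ r → 3 ℕ.* (2 ℕ.* i ℕ.+ 1) ≡ r ℕ.+ κ ℕ.* p → + 3 ℤ.* oddℤ i ≈ + r
  3*oddℤ-≈ i κ r eq = ≈-trans (≡⇒≈ (trans (cong (+ 3 ℤ.*_) (oddℤ-pos i)) (sym (ℤₚ.pos-* 3 (2 ℕ.* i ℕ.+ 1))))) (ℕ-≈ κ r eq)

  p∤4 : ¬ p ∣ 4
  p∤4 = ℕ.>⇒∤ (s<s (s<s (s<s (s<s z<s))))

  -- Size alone does not settle p = 5, so 6 is factored.
  p∤6 : ¬ p ∣ 6
  p∤6 p∣6 with euclidsLemma 2 3 prime p∣6
  ... | inj₁ p∣2 = p∤2 p∣2
  ... | inj₂ p∣3 = p∤3 p∣3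

  s≡sgn : s ≡ sgn (2 ℕ.+ m)
  s≡sgn = cong (λ z → sgn (2 ℕ.+ z)) (⌊n*2/2⌋≡n m)

  private
    ℕ→ℚ-relation : ∀ c κ j → c ℕ.* j ℕ.+ 1 ≡ κ ℕ.* p → ℕ→ℚ c * ℕ→ℚ j + 1ℚ ≡ ℕ→ℚ κ * P
    ℕ→ℚ-relation c κ j eq = trans (sym (ℕ→ℚ-affine c 1 j)) (trans (cong ℕ→ℚ eq) (ℕ→ℚ-* κ p))

    p-half : 2 ℕ.* (2 ℕ.+ m) ℕ.+ 1 ≡ 1 ℕ.* p
    p-half = lemma m
      where
      lemma : ∀ m → 2 ℕ.* (2 ℕ.+ m) ℕ.+ 1 ≡ 1 ℕ.* (5 ℕ.+ m ℕ.* 2)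
      lemma = ℕS.solve-∀

    P-half : ℕ→ℚ 2 * ℕ→ℚ (2 ℕ.+ m) + 1ℚ ≡ ℕ→ℚ 1 * P
    P-half = ℕ→ℚ-relation 2 1 (2 ℕ.+ m) p-half

    h+1<p : 3 ℕ.+ m < p
    h+1<p = s≤s (s≤s (s≤s (s≤s (ℕ.≤-trans (ℕ.m≤m*n m 2) (ℕ.n≤1+n (m ℕ.* 2))))))

    integral--½ : Integral -½
    integral--½ = integral-neg (integral-/ (+ 1) 2 p∤2)

  -- j = (p - 1)/2, so that 2j + 1 = p and A is taken at 0, where it is the Euler number.
  minusHalf : Evaluation -½ -½ s E
  minusHalf = evaluate (1 ℕ.+ m) (ℕ.<-trans (ℕ.n<1+n (2 ℕ.+ m)) h+1<p) integral--½
    (by-combination ½ P-half (offset P (ℕ→ℚ (2 ℕ.+ m)))) (sym s≡sgn)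
    (≈⇒Mod (≈-trans (Appell-cong Euler n (≈-trans (≡⇒≈ (oddℤ-pos (2 ℕ.+ m))) (ℕ-≈ 1 0 p-half))) (≡⇒≈ (Appell-0 Euler n))))
    where
    offset : ∀ P h → P * (- ((+ 1) / 2)) + h - (- ((+ 1) / 2)) ≡ (+ 1) / 2 * (ℕ→ℚ 2 * h + 1ℚ - ℕ→ℚ 1 * P)
    offset = solve-∀-in ℚ-ring

  -- j = (p + 1)/2, so that 2j + 1 = p + 2; the difference equation at 1 gives A(2) = 2 - A(0).
  plusHalf : Evaluation ½ -½ (- s) (ℕ→ℚ 2 - E)
  plusHalf = evaluate (2 ℕ.+ m) h+1<p integral--½
    (by-combination ½ P-half (trans (cong (λ z → P * -½ + z - ½) (ℕ→ℚ-suc (2 ℕ.+ m))) (offset P (ℕ→ℚ (2 ℕ.+ m)))))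
    (trans (negate (sgn (2 ℕ.+ m))) (cong -_ (sym s≡sgn)))
    (Mod-resp (cong (λ z → Â (oddℤ (3 ℕ.+ m)) - z) (trans (ℤ→ℚ-+ (+ 2) (ℤ.- Euler n))
        (cong (λ z → ℕ→ℚ 2 + z) (ℤ→ℚ-neg (Euler n)))))
      (≈⇒Mod (≈-trans (Appell-cong Euler n (≈-trans (≡⇒≈ (oddℤ-pos (3 ℕ.+ m))) (ℕ-≈ 1 2 (p+2 m)))) (≡⇒≈ A-2))))
    where
    offset : ∀ P h → P * (- ((+ 1) / 2)) + (h + 1ℚ) - (+ 1) / 2 ≡ (+ 1) / 2 * (ℕ→ℚ 2 * h + 1ℚ - ℕ→ℚ 1 * P)
    offset = solve-∀-in ℚ-ring
    negate : ∀ x → - 1ℚ * x ≡ - x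
    negate = solve-∀-in ℚ-ring
    p+2 : ∀ m → 2 ℕ.* (3 ℕ.+ m) ℕ.+ 1 ≡ 2 ℕ.+ 1 ℕ.* (5 ℕ.+ m ℕ.* 2)
    p+2 = ℕS.solve-∀
    move : ∀ u v w → u ℤ.+ v ≡ w → u ≡ w ℤ.- v
    move u v _ refl = lemma u v
      where
      lemma : ∀ u v → u ≡ u ℤ.+ v ℤ.- v
      lemma = ℤS.solve-∀
    A-2 : A (+ 2) ≡ + 2 ℤ.- Euler n
    A-2 = trans (move (A (+ 2)) (A (+ 0)) (+ 2) (trans (Euler-Appell n (+ 1)) (cong (+ 2 ℤ.*_) (Pow-1 n))))
                (cong (λ z → + 2 ℤ.- z) (Appell-0 Euler n))

  -- -1/6 = -κp/6 + j exactly when 6j + 1 = κp, and then 3 (2j + 1) = κp + 2, so 2j + 1 represents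
  -- 2/3.
  minusSixth : ∀ κ i {σ} → suc i < p → 6 ℕ.* suc i ℕ.+ 1 ≡ κ ℕ.* p → sgn (suc i)
      ≡ σ → Evaluation -⅙ (ℕ→ℚ κ * -⅙) σ (ℕ→ℚ 5 * E)
  minusSixth κ i j<p eq sgn≡σ = evaluate i j<p (integral-* (integral-ℕ κ) (integral-neg (integral-/ (+ 1) 6 p∤6)))
    (by-combination ((+ 1) / 6) (ℕ→ℚ-relation 6 κ (suc i) eq) (offset P (ℕ→ℚ κ) (ℕ→ℚ (suc i)))) sgn≡σ
    (Mod-resp (cong (λ z → Â (oddℤ (suc i)) - z) (ℤ→ℚ-* (+ 5) (Euler n)))
      (≈⇒Mod (A-two-thirds (3*oddℤ-≈ (suc i) κ 2 (trans (lemma i) (cong (2 ℕ.+_) eq))))))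
    where
    offset : ∀ P κ j → P * (κ * (- ((+ 1) / 6))) + j - (- ((+ 1) / 6)) ≡ (+ 1) / 6 * (ℕ→ℚ 6 * j + 1ℚ - κ * P)
    offset = solve-∀-in ℚ-ring
    lemma : ∀ i → 3 ℕ.* (2 ℕ.* suc i ℕ.+ 1) ≡ 2 ℕ.+ (6 ℕ.* suc i ℕ.+ 1)
    lemma = ℕS.solve-∀

  -- Now 3j + 1 = κp and 3 (2j + 1) = 2κp + 1, so 2j + 1 represents 1/3.
  minusThird : ∀ κ i {σ} → suc i < p → 3 ℕ.* suc i ℕ.+ 1 ≡ κ ℕ.* p → sgn (suc i)
      ≡ σ → Evaluation -⅓ (ℕ→ℚ κ * -⅓) σ ((+ 9) / 4 * Û)
  minusThird κ i j<p eq sgn≡σ = evaluate i j<p (integral-* (integral-ℕ κ) (integral-neg (integral-/ (+ 1) 3 p∤3)))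
    (by-combination ((+ 1) / 3) (ℕ→ℚ-relation 3 κ (suc i) eq) (offset P (ℕ→ℚ κ) (ℕ→ℚ (suc i)))) sgn≡σ
    (Mod-cancel 4 p∤4 (Mod-resp (trans (cong₂ _-_ (ℤ→ℚ-* (+ 4) (A (oddℤ (suc i)))) (ℤ→ℚ-* (+ 9) (U n))) (quarter (Â
        (oddℤ (suc i))) Û))
      (≈⇒Mod (A-one-third (3*oddℤ-≈ (suc i) (2 ℕ.* κ) 1 (trans (lemma i) (cong suc
          (trans (cong (2 ℕ.*_) eq) (sym (ℕ.*-assoc 2 κ p))))))))))
    where
    offset : ∀ P κ j → P * (κ * (- ((+ 1) / 3))) + j - (- ((+ 1) / 3)) ≡ (+ 1) / 3 * (ℕ→ℚ 3 * j + 1ℚ - κ * P)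
    offset = solve-∀-in ℚ-ring
    quarter : ∀ a u → ℕ→ℚ 4 * a - ℕ→ℚ 9 * u ≡ ℕ→ℚ 4 * (a - (+ 9) / 4 * u)
    quarter = solve-∀-in ℚ-ring
    lemma : ∀ i → 3 ℕ.* (2 ℕ.* suc i ℕ.+ 1) ≡ suc (2 ℕ.* (3 ℕ.* suc i ℕ.+ 1))
    lemma = ℕS.solve-∀

  sgn-+-even : ∀ a i → sgn (a ℕ.+ i ℕ.* 2) ≡ sgn a
  sgn-+-even zero    zero    = refl
  sgn-+-even zero    (suc i) = trans (lemma (sgn (i ℕ.* 2))) (sgn-+-even zero i)
    where
    lemma : ∀ s → - 1ℚ * (- 1ℚ * s) ≡ s
    lemma = solve-∀-in ℚ-ring
  sgn-+-even (suc a) i       = cong (- 1ℚ *_) (sgn-+-even a i)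

module OneModThree (N : ℕ) (prime : Prime (5 ℕ.+ (1 ℕ.+ N ℕ.* 3) ℕ.* 2)) where
  open Evaluations (5 ℕ.+ (1 ℕ.+ N ℕ.* 3) ℕ.* 2) prime
  open Specialisation (1 ℕ.+ N ℕ.* 3) prime

  sixth : Evaluation -⅙ (ℕ→ℚ 1 * -⅙) s (ℕ→ℚ 5 * E)
  -- p = 6N + 7 and j = (p - 1)/6 = N + 1, which has the parity of 3j = (p - 1)/2.
  sixth = minusSixth 1 N (s≤s (s≤s (bound N))) (e₁ N)
    (trans (sym (sgn-+-even (suc N) (suc N))) (trans (cong ((- 1ℚ) ^ℚ_) (e₂ N)) (sym s≡sgn)))
    where
    e₁ : ∀ N → 6 ℕ.* suc N ℕ.+ 1 ≡ 1 ℕ.* (5 ℕ.+ (1 ℕ.+ N ℕ.* 3) ℕ.* 2)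
    e₁ = ℕS.solve-∀
    e₂ : ∀ N → suc N ℕ.+ suc N ℕ.* 2 ≡ 2 ℕ.+ (1 ℕ.+ N ℕ.* 3)
    e₂ = ℕS.solve-∀
    bound : ∀ N → N ≤ 3 ℕ.+ (1 ℕ.+ N ℕ.* 3) ℕ.* 2
    bound N = ℕ.≤-trans (ℕ.m≤m+n N (5 ℕ.+ 5 ℕ.* N)) (ℕ.≤-reflexive (lemma N))
      where
      lemma : ∀ N → N ℕ.+ (5 ℕ.+ 5 ℕ.* N) ≡ 3 ℕ.+ (1 ℕ.+ N ℕ.* 3) ℕ.* 2
      lemma = ℕS.solve-∀

  third : Evaluation -⅓ (ℕ→ℚ 1 * -⅓) 1ℚ ((+ 9) / 4 * Û)
  third = minusThird 1 (1 ℕ.+ N ℕ.* 2) (s≤s (s≤s (s≤s (bound N)))) (e₁ N) (sgn-+-even 0 (suc N))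
    where
    e₁ : ∀ N → 3 ℕ.* (2 ℕ.+ N ℕ.* 2) ℕ.+ 1 ≡ 1 ℕ.* (5 ℕ.+ (1 ℕ.+ N ℕ.* 3) ℕ.* 2)
    e₁ = ℕS.solve-∀
    bound : ∀ N → N ℕ.* 2 ≤ 2 ℕ.+ (1 ℕ.+ N ℕ.* 3) ℕ.* 2
    bound N = ℕ.≤-trans (ℕ.m≤m+n (N ℕ.* 2) (4 ℕ.+ 4 ℕ.* N)) (ℕ.≤-reflexive (lemma N))
      where
      lemma : ∀ N → N ℕ.* 2 ℕ.+ (4 ℕ.+ 4 ℕ.* N) ≡ 2 ℕ.+ (1 ℕ.+ N ℕ.* 3) ℕ.* 2
      lemma = ℕS.solve-∀

module TwoModThree (N : ℕ) (prime : Prime (5 ℕ.+ N ℕ.* 3 ℕ.* 2)) where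
  open Evaluations (5 ℕ.+ N ℕ.* 3 ℕ.* 2) prime
  open Specialisation (N ℕ.* 3) prime
  open Supercongruence (N ℕ.* 3) prime using (sgn-odd)

  sixth : Evaluation -⅙ (ℕ→ℚ 5 * -⅙) s (ℕ→ℚ 5 * E)
  -- p = 6N + 5 and j = (5p - 1)/6 = 5N + 4; both j and (p - 1)/2 = 3N + 2 have the parity of N.
  sixth = minusSixth 5 (3 ℕ.+ 5 ℕ.* N) (s≤s (bound N)) (e₁ N)
    (trans (cong ((- 1ℚ) ^ℚ_) (e₂ N)) (trans (sgn-+-even N (2 ℕ.+ 2 ℕ.* N))
        (trans (sym (sgn-+-even N (suc N))) (trans (cong ((- 1ℚ) ^ℚ_) (e₃ N)) (sym s≡sgn)))))
    where
    e₁ : ∀ N → 6 ℕ.* (4 ℕ.+ 5 ℕ.* N) ℕ.+ 1 ≡ 5 ℕ.* (5 ℕ.+ N ℕ.* 3 ℕ.* 2)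
    e₁ = ℕS.solve-∀
    e₂ : ∀ N → 4 ℕ.+ 5 ℕ.* N ≡ N ℕ.+ (2 ℕ.+ 2 ℕ.* N) ℕ.* 2
    e₂ = ℕS.solve-∀
    e₃ : ∀ N → N ℕ.+ suc N ℕ.* 2 ≡ 2 ℕ.+ N ℕ.* 3
    e₃ = ℕS.solve-∀
    bound : ∀ N → 4 ℕ.+ 5 ℕ.* N ≤ 4 ℕ.+ N ℕ.* 3 ℕ.* 2
    bound N = ℕ.≤-trans (ℕ.m≤m+n (4 ℕ.+ 5 ℕ.* N) N) (ℕ.≤-reflexive (lemma N))
      where
      lemma : ∀ N → 4 ℕ.+ 5 ℕ.* N ℕ.+ N ≡ 4 ℕ.+ N ℕ.* 3 ℕ.* 2
      lemma = ℕS.solve-∀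

  third : Evaluation -⅓ (ℕ→ℚ 2 * -⅓) (- 1ℚ) ((+ 9) / 4 * Û)
  -- j = (2p - 1)/3 = 4N + 3 is odd, whence the sign -1.
  third = minusThird 2 (2 ℕ.+ 4 ℕ.* N) (s≤s (bound N)) (e₁ N) (trans (cong ((- 1ℚ) ^ℚ_) (e₂ N)) (sgn-odd (1 ℕ.+ 2 ℕ.* N)))
    where
    e₁ : ∀ N → 3 ℕ.* (3 ℕ.+ 4 ℕ.* N) ℕ.+ 1 ≡ 2 ℕ.* (5 ℕ.+ N ℕ.* 3 ℕ.* 2)
    e₁ = ℕS.solve-∀
    e₂ : ∀ N → 3 ℕ.+ 4 ℕ.* N ≡ suc ((1 ℕ.+ 2 ℕ.* N) ℕ.* 2)
    e₂ = ℕS.solve-∀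
    bound : ∀ N → 3 ℕ.+ 4 ℕ.* N ≤ 4 ℕ.+ N ℕ.* 3 ℕ.* 2
    bound N = ℕ.≤-trans (ℕ.m≤m+n (3 ℕ.+ 4 ℕ.* N) (1 ℕ.+ 2 ℕ.* N)) (ℕ.≤-reflexive (lemma N))
      where
      lemma : ∀ N → 3 ℕ.+ 4 ℕ.* N ℕ.+ (1 ℕ.+ 2 ℕ.* N) ≡ 4 ℕ.+ N ℕ.* 3 ℕ.* 2
      lemma = ℕS.solve-∀

-- Residue classes of p and assembly of the congruences.

odd-prime : ∀ p → Prime p → 3 < p → ∃[ m ] p ≡ 5 ℕ.+ m ℕ.* 2
odd-prime p p-prime 3<p with parity p
... | odd (suc (suc m)) = m , refl
... | odd zero          = ⊥-elim (ℕ.<-asym 3<p (s<s z<s))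
... | odd (suc zero)    = ⊥-elim (ℕ.<-irrefl refl 3<p)
... | even k with prime⇒irreducible p-prime (ℕ.divides {2} k refl)
...   | inj₂ 2≡p = ⊥-elim (ℕ.<-asym 3<p (subst (_< 3) 2≡p (ℕ.n<1+n 2)))

3∣m*2⇒3∣m : ∀ m → 3 ∣ m ℕ.* 2 → 3 ∣ m
3∣m*2⇒3∣m m 3∣2m with euclidsLemma m 2 (from-yes (prime? 3)) 3∣2m
... | inj₁ 3∣m = 3∣m
... | inj₂ 3∣2 = ⊥-elim (from-no (3 ℕ.∣? 2) 3∣2)

oneModThree : ∀ m → 3 ∣ 4 ℕ.+ m ℕ.* 2 → ∃[ N ] m ≡ 1 ℕ.+ N ℕ.* 3
oneModThree m 3∣p-1 with 3∣m*2⇒3∣m (2 ℕ.+ m) 3∣p-1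
... | ℕ.divides (suc N) eq = N , ℕ.suc-injective (ℕ.suc-injective eq)

twoModThree : ∀ m → 3 ∣ 3 ℕ.+ m ℕ.* 2 → ∃[ N ] m ≡ N ℕ.* 3
twoModThree m 3∣p-2 with 3∣m*2⇒3∣m m (ℕ.∣m+n∣m⇒∣n 3∣p-2 (ℕ.∣-refl {3}))
... | ℕ.divides N eq = N , eq

-- `p` is kept abstract beside its equation so that matching on `refl` specialises the evaluations,
-- while the theorem itself keeps an arbitrary prime.
oneModThree-values : ∀ {p} m (p-prime : Prime p) → p ≡ 5 ℕ.+ m ℕ.* 2 → 3 ∣ p ∸ 1 → let open Evaluations p p-prime in
  Evaluation -⅙ (ℕ→ℚ 1 * -⅙) s (ℕ→ℚ 5 * E) × Evaluation -⅓ (ℕ→ℚ 1 * -⅓) 1ℚ ((+ 9) / 4 * Û)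
oneModThree-values m p-prime refl 3∣p-1 with oneModThree m 3∣p-1
... | N , refl = OneModThree.sixth N p-prime , OneModThree.third N p-prime

twoModThree-values : ∀ {p} m (p-prime : Prime p) → p ≡ 5 ℕ.+ m ℕ.* 2 → 3 ∣ p ∸ 2 → let open Evaluations p p-prime in
  Evaluation -⅙ (ℕ→ℚ 5 * -⅙) s (ℕ→ℚ 5 * E) × Evaluation -⅓ (ℕ→ℚ 2 * -⅓) (- 1ℚ) ((+ 9) / 4 * Û)
twoModThree-values m p-prime refl 3∣p-2 with twoModThree m 3∣p-2
... | N , refl = TwoModThree.sixth N p-prime , TwoModThree.third N p-prime

halves-values : ∀ {p} m (p-prime : Prime p) → p ≡ 5 ℕ.+ m ℕ.* 2 → let open Evaluations p p-prime in
  Evaluation -½ -½ s E × Evaluation ½ -½ (- s) (ℕ→ℚ 2 - E)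
halves-values m p-prime refl = Specialisation.minusHalf m p-prime , Specialisation.plusHalf m p-prime

theorem4p2 : (p : ℕ) → Prime p → 3 < p →
  let
    P : ℚ
    P = ℕ→ℚ p
    P³ : ℚ
    P³ = P ^ℚ 3
    s : ℚ
    s = (- 1ℚ) ^ℚ ⌊ p ∸ 1 /2⌋
    E : ℚ
    E = ℤ→ℚ (Euler (p ∸ 3))
    Up : ℚ
    Up = ℤ→ℚ (U (p ∸ 3))
    cb : ℕ → ℤ
    cb k = + (((2 Data.Nat.* k) C k) Data.Nat.^ 3)
    m64 : ℕ → ℤ
    m64 k = (ℤ.- (+ 64)) ℤ.^ k
    twoKm1 : ℕ → ℤ
    twoKm1 k = (+ (2 Data.Nat.* k)) ℤ.- (+ 1)
    fourKm1 : ℕ → ℤ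
    fourKm1 k = (+ (4 Data.Nat.* k)) ℤ.- (+ 1)
    b6 : ℕ → ℚ
    b6 k = binomℚ (- ((+ 1) / 6)) k ^ℚ 3
    b3 : ℕ → ℚ
    b3 k = binomℚ (- ((+ 1) / 3)) k ^ℚ 3
  in
  (Σℚ[< p ] (λ k → ((+ (4 Data.Nat.* k Data.Nat.+ 1)) ℤ.^ 3 ℤ.* cb k) /ℤ m64 k)
     ≡ ℤ→ℚ (ℤ.- (+ 3)) * s * P + P³ * (ℕ→ℚ 4 - ℕ→ℚ 3 * E) [mod p Data.Nat.^ 4 ]over p)
  ×
  (Σℚ[< p ] (λ k → (fourKm1 k ℤ.* cb k) /ℤ (m64 k ℤ.* twoKm1 k ℤ.^ 3))
     ≡ s * P + P³ * (E - ℕ→ℚ 2) [mod p Data.Nat.^ 4 ]over p)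
  ×
  (Σℚ[< p ] (λ k → (fourKm1 k ℤ.^ 3 ℤ.* cb k) /ℤ (m64 k ℤ.* twoKm1 k ℤ.^ 3))
     ≡ ℤ→ℚ (ℤ.- (+ 3)) * s * P + P³ * (ℕ→ℚ 2 - ℕ→ℚ 3 * E) [mod p Data.Nat.^ 4 ]over p)
  ×
  (3 ∣ p ∸ 1 →
    Σℚ[< p ] (λ k → ℕ→ℚ (12 Data.Nat.* k Data.Nat.+ 1) * b6 k)
     ≡ s * P + ((+ 5) / 9) * P³ * E [mod p Data.Nat.^ 4 ]over p)
  ×
  (3 ∣ p ∸ 2 →
    Σℚ[< p ] (λ k → ℕ→ℚ (12 Data.Nat.* k Data.Nat.+ 1) * b6 k)
     ≡ ℕ→ℚ 5 * s * P + ((+ 625) / 9) * P³ * E [mod p Data.Nat.^ 4 ]over p)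
  ×
  (3 ∣ p ∸ 1 →
    Σℚ[< p ] (λ k → ℕ→ℚ (12 Data.Nat.* k Data.Nat.+ 1) ^ℚ 3 * b6 k)
     ≡ ℤ→ℚ (ℤ.- (+ 3)) * s * P + P³ * (ℕ→ℚ 4 - ((+ 5) / 3) * E) [mod p Data.Nat.^ 4 ]over p)
  ×
  (3 ∣ p ∸ 2 →
    Σℚ[< p ] (λ k → ℕ→ℚ (12 Data.Nat.* k Data.Nat.+ 1) ^ℚ 3 * b6 k)
     ≡ ℤ→ℚ (ℤ.- (+ 15)) * s * P + P³ * (ℕ→ℚ 500 - ((+ 625) / 3) * E) [mod p Data.Nat.^ 4 ]over p)
  ×
  (3 ∣ p ∸ 1 →
    Σℚ[< p ] (λ k → ℕ→ℚ (6 Data.Nat.* k Data.Nat.+ 1) * b3 k)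
     ≡ P + P³ * Up [mod p Data.Nat.^ 4 ]over p)
  ×
  (3 ∣ p ∸ 2 →
    Σℚ[< p ] (λ k → ℕ→ℚ (6 Data.Nat.* k Data.Nat.+ 1) * b3 k)
     ≡ ℤ→ℚ (ℤ.- (+ 2)) * P + ℕ→ℚ 8 * P³ * Up [mod p Data.Nat.^ 4 ]over p)
  ×
  (3 ∣ p ∸ 1 →
    Σℚ[< p ] (λ k → ℕ→ℚ (6 Data.Nat.* k Data.Nat.+ 1) ^ℚ 3 * b3 k)
     ≡ ℤ→ℚ (ℤ.- (+ 3)) * P + P³ * (ℕ→ℚ 4 - ℕ→ℚ 3 * Up) [mod p Data.Nat.^ 4 ]over p)
  ×
  (3 ∣ p ∸ 2 →
    Σℚ[< p ] (λ k → ℕ→ℚ (6 Data.Nat.* k Data.Nat.+ 1) ^ℚ 3 * b3 k)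
     ≡ ℕ→ℚ 6 * P + ℕ→ℚ 8 * P³ * (ℕ→ℚ 4 - ℕ→ℚ 3 * Up) [mod p Data.Nat.^ 4 ]over p)
theorem4p2 p p-prime 3<p =
    conclude (total₁ p) (integral-ℕ 8) (Evaluation.S³-value (proj₁ halves)) (identity₁ (S³ p -½) P s E)
  , conclude (total₂ p) (integral-neg (integral-ℕ 2)) (Evaluation.S-value (proj₂ halves)) (identity₂ (S p ½) P s E)
  , conclude (total₃ p) (integral-neg (integral-ℕ 8)) (Evaluation.S³-value (proj₂ halves)) (identity₃ (S³ p ½) P s E)
  , (λ d → conclude (total₄ p) (integral-ℕ 6) (Evaluation.S-value (proj₁ (one d))) (identity₄ (S p -⅙) P s E))
  , (λ d → conclude (total₄ p) (integral-ℕ 6) (Evaluation.S-value (proj₁ (two d))) (identity₅ (S p -⅙) P s E))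
  , (λ d → conclude (total₅ p) (integral-ℕ 216) (Evaluation.S³-value (proj₁ (one d))) (identity₆ (S³ p -⅙) P s E))
  , (λ d → conclude (total₅ p) (integral-ℕ 216) (Evaluation.S³-value (proj₁ (two d))) (identity₇ (S³ p -⅙) P s E))
  , (λ d → conclude (total₆ p) (integral-ℕ 3) (Evaluation.S-value (proj₂ (one d))) (identity₈ (S p -⅓) P Û))
  , (λ d → conclude (total₆ p) (integral-ℕ 3) (Evaluation.S-value (proj₂ (two d))) (identity₉ (S p -⅓) P Û))
  , (λ d → conclude (total₇ p) (integral-ℕ 27) (Evaluation.S³-value (proj₂ (one d))) (identity₁₀ (S³ p -⅓) P Û))
  , (λ d → conclude (total₇ p) (integral-ℕ 27) (Evaluation.S³-value (proj₂ (two d))) (identity₁₁ (S³ p -⅓) P Û))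
  where
    open Evaluations p p-prime
    open Localisation p p-prime using (P; integral-ℕ; integral-neg)
    open FinalIdentities
    m : ℕ
    m = proj₁ (odd-prime p p-prime 3<p)
    p≡5+2m : p ≡ 5 ℕ.+ m ℕ.* 2
    p≡5+2m = proj₂ (odd-prime p p-prime 3<p)
    halves = halves-values m p-prime p≡5+2m
    one = oneModThree-values m p-prime p≡5+2m
    two = twoModThree-values m p-prime p≡5+2m
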